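{- Let $q$ be a prime power and let $A=(a_{ij})\in\mathbb{F}_q^{m\times k}$ be the coefficient matrix of a linear system $(\star)$: $\sum_{j=1}^k a_{ij}x_j=0$ for all $i\in[m]$, in unknowns $x_1,\dots,x_k\in\mathbb{F}_q^n$. Assume $(\star)$ is a type (RC) linear system that is non-degenerate and irreducible, and let $\ell$ be its number of column equivalence classes. Suppose that at least one of the following holds: (i) none of the column equivalence classes of size $2$ sums to zero; (ii) every column equivalence class sums to zero, and $k\ge 3$. Then $(\star)$ is moderate.
   Context: The system $(\star)$ is balanced if every row of $A$ sums to zero. Two indices $j,j'\in[k]$ are called equivalent if the $j$-th and $j'$-th columns of $A$ are nonzero scalar multiples of one another; the classes of this equivalence relation are the column equivalence classes. A column equivalence class sums to zero if the columns of $A$ indexed by it add up to the zero vector. $(\star)$ is of type (RC) if it is balanced and has at most one column equivalence class of size $1$. $(\star)$ is non-degenerate if the rows of $A$ are linearly independent and every column of $A$ is nonzero (every variable is used). Two linear systems are equivalent if each equation of either is a linear combination of the equations of the other. $(\star)$ is reducible if it is equivalent to a linear system for which the variables $x_1,\dots,x_k$ can be partitioned into two or more classes such that every equation only uses (has nonzero coefficients on) variables from one class; otherwise it is irreducible. $(\star)$ is moderate if there exist constants $\beta,\gamma>0$ with $\gamma<q$ such that for every $n$, every subset $S\subseteq\mathbb{F}_q^n$ with $|S|\ge\beta\gamma^n$ contains a solution $(x_1,\dots,x_k)\in S^k$ of $(\star)$ with $x_1,\dots,x_k$ pairwise distinct. -}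

module Defs where

open import Level using (0ℓ)
open import Algebra.Bundles using (CommutativeRing)
open import Data.Nat.Base using (ℕ; zero; suc; _≥_)
open import Data.Fin.Base as Fin using (Fin)
open import Data.Bool.Base using (if_then_else_)
open import Data.Vec.Base using (lookup)
open import Data.Fin.Subset using (Subset; _∈_; ∣_∣)
open import Data.Product using (Σ; ∃; ∃-syntax; _×_; _,_)
open import Data.Sum using (_⊎_)
open import Data.List.Base using (List; length)
open import Data.List.Relation.Unary.Any using (Any)
open import Data.List.Relation.Unary.AllPairs using (AllPairs)
open import Relation.Binary.Definitions using (Decidable)
open import Relation.Binary.PropositionalEquality using (_≡_; _≢_)
open import Relation.Nullary using (¬_)
open import Function.Bundles using (_⇔_)
open import Data.Integer.Base using (+_)
open import Data.Rational.Base as ℚ using (ℚ; 0ℚ; 1ℚ; _/_)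

-- Finite fields.  A field is a commutative ring with 1 ≠ 0 in which every
-- nonzero element has a multiplicative inverse.  Finiteness: the carrier is
-- in (setoid-)bijection with Fin q.  (q is then automatically a prime power,
-- and every F_q arises this way.)  Equality is decidable.

record FiniteField : Set₁ where
  field
    commRing : CommutativeRing 0ℓ 0ℓ
  open CommutativeRing commRing public
  field
    _≈?_     : Decidable _≈_
    1≉0      : ¬ (1# ≈ 0#)
    inverse  : ∀ x → ¬ (x ≈ 0#) → ∃[ y ] (x * y ≈ 1#)
    q        : ℕ
    enum     : Fin q → Carrier
    enum-inj : ∀ a b → enum a ≈ enum b → a ≡ b
    enum-sur : ∀ x → ∃[ a ] (enum a ≈ x)

_^ℚ_ : ℚ → ℕ → ℚ
x ^ℚ zero  = 1ℚ
x ^ℚ suc n = x ℚ.* (x ^ℚ n)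

ℕ→ℚ : ℕ → ℚ
ℕ→ℚ n = (+ n) / 1

module _ (F : FiniteField) where
  open FiniteField F

  ∑ : ∀ k → (Fin k → Carrier) → Carrier
  ∑ zero    f = 0#
  ∑ (suc k) f = f Fin.zero + ∑ k (λ j → f (Fin.suc j))

  Matrix : ℕ → ℕ → Set
  Matrix m k = Fin m → Fin k → Carrier

  Vec : ℕ → Set
  Vec n = Fin n → Carrier

  _≋_ : ∀ {n} → Vec n → Vec n → Set
  u ≋ v = ∀ t → u t ≈ v t

  Balanced : ∀ {m k} → Matrix m k → Set
  Balanced {m} {k} A = ∀ i → ∑ k (A i) ≈ 0#

  ColEquiv : ∀ {m k} → Matrix m k → Fin k → Fin k → Set
  ColEquiv A j j' = ∃[ c ] (¬ (c ≈ 0#) × (∀ i → A i j' ≈ c * A i j))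

  IsColClass : ∀ {m k} → Matrix m k → Subset k → Set
  IsColClass A C = ∃[ j ] (∀ j' → (j' ∈ C ⇔ ColEquiv A j j'))

  SumsToZero : ∀ {m k} → Matrix m k → Subset k → Set
  SumsToZero {m} {k} A C =
    ∀ i → ∑ k (λ j → if lookup C j then A i j else 0#) ≈ 0#

  TypeRC : ∀ {m k} → Matrix m k → Set
  TypeRC A = Balanced A ×
    (∀ C C' → IsColClass A C → IsColClass A C' → ∣ C ∣ ≡ 1 → ∣ C' ∣ ≡ 1 → C ≡ C')

  NonDegenerate : ∀ {m k} → Matrix m k → Set
  NonDegenerate {m} {k} A =
    (∀ (c : Fin m → Carrier) → (∀ j → ∑ m (λ i → c i * A i j) ≈ 0#) → ∀ i → c i ≈ 0#)
    × (∀ j → ∃[ i ] (¬ (A i j ≈ 0#)))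

  RowsCombinationsOf : ∀ {m m' k} → Matrix m' k → Matrix m k → Set
  RowsCombinationsOf {m} {m'} {k} B A =
    ∀ i' → Σ (Fin m → Carrier) λ c → (∀ j → B i' j ≈ ∑ m (λ i → c i * A i j))

  EquivSystems : ∀ {m m' k} → Matrix m k → Matrix m' k → Set
  EquivSystems A B = RowsCombinationsOf B A × RowsCombinationsOf A B

  -- Reducible: equivalent to a system B (with any number m' of equations)
  -- and a partition p : [k] → [r] of the variables into r ≥ 2 (nonempty)
  -- classes such that every equation of B only uses variables of one class.
  Reducible : ∀ {m k} → Matrix m k → Set
  Reducible {m} {k} A =
    ∃[ m' ] Σ (Matrix m' k) λ B → EquivSystems A B ×
    ∃[ r ] Σ (Fin k → Fin r) λ p → (r ≥ 2) × (∀ s → ∃[ j ] (p j ≡ s)) ×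
      (∀ i → ∃[ s ] (∀ j → ¬ (B i j ≈ 0#) → p j ≡ s))

  Irreducible : ∀ {m k} → Matrix m k → Set
  Irreducible A = ¬ Reducible A

  IsSolution : ∀ {m k n} → Matrix m k → (Fin k → Vec n) → Set
  IsSolution {m} {k} {n} A x = ∀ i t → ∑ k (λ j → A i j * x j t) ≈ 0#

  -- Finite subsets of F^n: duplicate-free lists; |S| = length.
  DistinctList : ∀ {n} → List (Vec n) → Set
  DistinctList S = AllPairs (λ u v → ¬ (u ≋ v)) S

  _∈S_ : ∀ {n} → Vec n → List (Vec n) → Set
  x ∈S S = Any (λ y → x ≋ y) S

  Moderate : ∀ {m k} → Matrix m k → Set
  Moderate {m} {k} A =
    ∃[ β ] ∃[ γ ] (0ℚ ℚ.< β × 0ℚ ℚ.< γ × γ ℚ.< ℕ→ℚ q ×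
      (∀ n (S : List (Vec n)) → DistinctList S →
        β ℚ.* (γ ^ℚ n) ℚ.≤ ℕ→ℚ (length S) →
        Σ (Fin k → Vec n) λ x →
          (∀ j → x j ∈S S) × (∀ j j' → j ≢ j' → ¬ (x j ≋ x j')) × IsSolution A x))

{-# OPTIONS --safe #-}
module Submission where

-- A single balanced equation in k ≥ 3 variables with nonzero coefficients is
-- moderate. For k = 3 this is the slice rank method: if S contains only constant
-- solutions, then the zero test ∏_t ∏_{e ≠ 0} (Σ a_b x_{b,t} - e) is a diagonal
-- tensor on S × S × S, so that |S| is at most the number of slices needed to write
-- it, for which exponent vectors of exponentially small density suffice. For k > 3,
-- solutions are composed: a large set contains many disjoint solutions of one
-- system, and their centres contain a solution of another.
--
-- If no class of size 2 sums to zero, then each column class gives an equation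
-- between its variables and a common centre y, of this kind unless the class is
-- the unique singleton, whose variable is y itself; as the system is balanced, the
-- solutions for all classes around the same y solve it.
--
-- If all classes sum to zero, then the pigeonhole principle gives differences
-- x_c - x_c′, one for each class c and with all points distinct, that are annihilated
-- by the matrix of class columns, provided that every class column occurs in a linear
-- relation between them. If one of them does not, then some combination of the rows is
-- supported on a single class, so that the system is reducible unless this is the
-- only class. In the class of c, one variable is x_c, and the others are found around
-- the centre x_c′.

open import Defs
open import Data.Nat.Base using (ℕ; _≥_)
open import Data.Fin.Subset using (∣_∣)
open import Data.Product using (_×_)
open import Data.Sum using (_⊎_)
open import Relation.Binary.PropositionalEquality using (_≡_)
open import Relation.Nullary using (¬_)
open import Algebra.Bundles using (CommutativeRing; RawRing)
open import Algebra.Structures using (IsCommutativeRing)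
open import Data.Fin.Base using (Fin; zero; suc)
import Data.Nat as ℕ
open import Data.Nat.Base using (zero; suc)
import Data.Nat.Properties as ℕ
open import Data.Product using (∃-syntax; _,_)
open import Level using (0ℓ)
open import Relation.Binary.PropositionalEquality using (_≢_)

-- The points of a solution must be pairwise distinct, and what prevents this is an equation with
-- two terms: if balanced, it reads a (x - y) = 0 and forces x = y. The equation between the
-- variables of a class and a centre degenerates to this form in two ways, for a singleton class and
-- for a class of size 2 that sums to zero, and this is where the hypotheses on the classes come
-- from. Under (i) only the one singleton remains. Under (ii) a class of size 2 is just a
-- difference, and its second variable is the centre itself.
--
-- All sizes are handled through `Forced`, whose thresholds grow at some rate strictly below q. Such
-- thresholds are closed under sums and constant factors, hence under the extraction of disjoint
-- copies, so that no rate is ever optimised. There are two sources of nontrivial rates: the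
-- weighted count of exponent vectors, with rate q - 1/18, and the pigeonhole argument for l
-- differences, with rate q - 1/l.

module RingNormaliser (R : CommutativeRing 0ℓ 0ℓ) where
  open CommutativeRing R
  open import Algebra.Solver.Ring.AlmostCommutativeRing
    using (AlmostCommutativeRing; _-Raw-AlmostCommutative⟶_; Induced-equivalence; fromCommutativeRing)
  open import Data.Maybe.Base using (just; nothing)
  open import Relation.Binary.Definitions using (WeaklyDecidable)
  import Relation.Binary.PropositionalEquality as ≡
  open import Relation.Nullary using (yes; no)
  open import Algebra.Properties.Semiring.Mult semiring using (×-homo-+; ×1-homo-*) renaming (_×_ to _⋆_)
  open import Algebra.Properties.Ring ring using (-‿distribˡ-*; -‿distribʳ-*; -0#≈0#)
  open import Algebra.Properties.AbelianGroup +-abelianGroup using (⁻¹-∙-comm; ⁻¹-anti-homo-//)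
  open import Algebra.Properties.CommutativeSemigroup +-commutativeSemigroup
    using (interchange)
  open import Relation.Binary.Reasoning.Setoid setoid

  -- Integer coefficients are represented by formal differences of natural
  -- numbers, for which the homomorphism laws need no case distinctions.
  private
    Difference : Set
    Difference = ℕ × ℕ

    difference : Difference → Carrier
    difference (m , n) = m ⋆ 1# - n ⋆ 1#

    -- The constants 0 and 1 should evaluate to 0# and 1# on the nose.
    ⟦_⟧ᵈ : Difference → Carrier
    ⟦ 0 , 0 ⟧ᵈ = 0#
    ⟦ 1 , 0 ⟧ᵈ = 1#
    ⟦ d ⟧ᵈ = difference d

    ⟦⟧-difference : ∀ d → ⟦ d ⟧ᵈ ≈ difference d
    ⟦⟧-difference (0 , 0) = sym (-‿inverseʳ 0#)
    ⟦⟧-difference (0 , suc _) = refl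
    ⟦⟧-difference (1 , 0) = sym (trans (+-congˡ -0#≈0#) (trans (+-identityʳ _) (+-identityʳ 1#)))
    ⟦⟧-difference (1 , suc _) = refl
    ⟦⟧-difference (suc (suc _) , _) = refl

    differences : RawRing 0ℓ 0ℓ
    differences = record
      { Carrier = Difference
      ; _≈_ = _≡_
      ; _+_ = λ (a , b) (c , d) → a ℕ.+ c , b ℕ.+ d
      ; _*_ = λ (a , b) (c , d) → a ℕ.* c ℕ.+ b ℕ.* d , a ℕ.* d ℕ.+ b ℕ.* c
      ; -_ = λ (a , b) → b , a
      ; 0# = 0 , 0
      ; 1# = 1 , 0
      }

    difference-+ : ∀ a b c d → (a + c) - (b + d) ≈ (a - b) + (c - d)
    difference-+ a b c d = trans (+-congˡ (sym (⁻¹-∙-comm b d))) (interchange a c (- b) (- d))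

    difference-* : ∀ a b c d → (a * c + b * d) - (a * d + b * c) ≈ (a - b) * (c - d)
    difference-* a b c d = begin
      (a * c + b * d) - (a * d + b * c)                  ≈⟨ +-cong refl (-‿cong (+-comm _ _)) ⟩
      (a * c + b * d) - (b * c + a * d)                  ≈⟨ difference-+ _ _ _ _ ⟩
      (a * c - b * c) + (b * d - a * d)                  ≈⟨ +-cong refl (sym (⁻¹-anti-homo-// _ _)) ⟩
      (a * c - b * c) - (a * d - b * d)                  ≈⟨ +-cong (factor c) (-‿cong (factor d)) ⟩
      (a - b) * c - (a - b) * d                          ≈⟨ +-congˡ (-‿distribʳ-* _ _) ⟩
      (a - b) * c + (a - b) * (- d)                      ≈⟨ sym (distribˡ _ _ _) ⟩
      (a - b) * (c - d) ∎
      where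
      factor : ∀ x → a * x - b * x ≈ (a - b) * x
      factor x = trans (+-congˡ (-‿distribˡ-* b x)) (sym (distribʳ x a (- b)))

    almostRing : AlmostCommutativeRing 0ℓ 0ℓ
    almostRing = fromCommutativeRing R

    evaluate : differences -Raw-AlmostCommutative⟶ almostRing
    evaluate = record
      { ⟦_⟧ = ⟦_⟧ᵈ
      ; +-homo = λ x@(a , b) y@(c , d) → trans (⟦⟧-difference (a ℕ.+ c , b ℕ.+ d))
          (trans (+-cong (×-homo-+ 1# a c) (-‿cong (×-homo-+ 1# b d)))
          (trans (difference-+ _ _ _ _) (sym (+-cong (⟦⟧-difference x) (⟦⟧-difference y)))))
      ; *-homo = λ x@(a , b) y@(c , d) → trans (⟦⟧-difference (a ℕ.* c ℕ.+ b ℕ.* d , a ℕ.* d ℕ.+ b ℕ.* c))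
          (trans (+-cong (product-sum a c b d) (-‿cong (product-sum a d b c)))
          (trans (difference-* _ _ _ _) (sym (*-cong (⟦⟧-difference x) (⟦⟧-difference y)))))
      ; -‿homo = λ x@(a , b) → trans (⟦⟧-difference (b , a))
          (trans (sym (⁻¹-anti-homo-// _ _)) (-‿cong (sym (⟦⟧-difference x))))
      ; 0-homo = refl
      ; 1-homo = refl
      }
      where
      product-sum : ∀ a c b d → ((a ℕ.* c ℕ.+ b ℕ.* d) ⋆ 1#) ≈ (a ⋆ 1#) * (c ⋆ 1#) + (b ⋆ 1#) * (d ⋆ 1#)
      product-sum a c b d = trans (×-homo-+ 1# (a ℕ.* c) (b ℕ.* d))
                                  (+-cong (×1-homo-* a c) (×1-homo-* b d))

    -- Different pairs can represent the same integer, such as (1 , 1) and (0 , 0), so coefficients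
    -- are compared by cross-addition instead of componentwise.
    _≟ᵈ_ : WeaklyDecidable (Induced-equivalence evaluate)
    (a , b) ≟ᵈ (c , d) with a ℕ.+ d ℕ.≟ c ℕ.+ b
    ... | no _ = nothing
    ... | yes eq = just (trans (⟦⟧-difference (a , b)) (trans (begin
      A - B                       ≈⟨ sym (+-identityʳ _) ⟩
      (A - B) + 0#                ≈⟨ +-congˡ (sym (-‿inverseʳ D)) ⟩
      (A - B) + (D - D)           ≈⟨ sym (difference-+ A B D D) ⟩
      (A + D) - (B + D)           ≈⟨ +-congʳ (trans (sym (×-homo-+ 1# a d))
                                       (trans (reflexive (≡.cong (_⋆ 1#) eq)) (×-homo-+ 1# c b))) ⟩
      (C + B) - (B + D)           ≈⟨ +-congˡ (-‿cong (+-comm B D)) ⟩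
      (C + B) - (D + B)           ≈⟨ difference-+ C D B B ⟩
      (C - D) + (B - B)           ≈⟨ +-congˡ (-‿inverseʳ B) ⟩
      (C - D) + 0#                ≈⟨ +-identityʳ _ ⟩
      C - D                       ∎) (sym (⟦⟧-difference (c , d)))))
      where
      A = a ⋆ 1#
      B = b ⋆ 1#
      C = c ⋆ 1#
      D = d ⋆ 1#

  open import Algebra.Solver.Ring differences almostRing evaluate _≟ᵈ_ public
    using (solve; _:=_; _:+_; _:*_; _:-_; :-_; con; Polynomial)

  :0 :1 : ∀ {n} → Polynomial n
  :0 = con (0 , 0)
  :1 = con (1 , 0)

-- The carrier is `Fin q` with propositional equality, so that scalars, points and tuples can be
-- enumerated, compared and counted. Writing q as `q-2` plus 2 makes q ≥ 2 hold by computation. Here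
-- `p` is q - 1, not the characteristic.
record FinField : Set where
  infix 8 -_
  infixl 7 _*_
  infixl 6 _+_
  field
    q-2 : ℕ

  p : ℕ
  p = suc q-2

  q : ℕ
  q = suc p

  Scalar : Set
  Scalar = Fin q

  field
    _+_ _*_ : Scalar → Scalar → Scalar
    -_ : Scalar → Scalar
    0# 1# : Scalar
    isCommutativeRing : IsCommutativeRing _≡_ _+_ _*_ -_ 0# 1#
    1≢0 : 1# ≢ 0#
    inverse : ∀ x → x ≢ 0# → ∃[ y ] (x * y ≡ 1#)

  commutativeRing : CommutativeRing 0ℓ 0ℓ
  commutativeRing = record { isCommutativeRing = isCommutativeRing }

module FieldLemmas (K : FinField) where
  open import Data.Fin.Base using (punchIn)
  open import Data.Fin.Properties using (punchInᵢ≢i)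
  open import Data.Product using (proj₁; proj₂)
  open import Relation.Binary.PropositionalEquality using (refl; sym; trans; cong; module ≡-Reasoning)
  open FinField K public
  open CommutativeRing commutativeRing public
    using (_-_; semiring; +-identityˡ; +-identityʳ; *-identityˡ; *-identityʳ; zeroˡ; zeroʳ; -‿inverseˡ; -‿inverseʳ; *-comm; +-assoc; *-assoc; distribˡ; distribʳ)
  open RingNormaliser commutativeRing public
  open import Algebra.Properties.Semiring.Sum semiring public

  zero-product : ∀ {x y} → x ≢ 0# → x * y ≡ 0# → y ≡ 0#
  zero-product {x} {y} x≢0 xy≡0 = begin
    y             ≡⟨ sym (*-identityˡ y) ⟩
    1# * y        ≡⟨ cong (_* y) (sym xz≡1) ⟩
    x * z * y     ≡⟨ solve 3 (λ x y z → x :* z :* y := z :* (x :* y)) refl x y z ⟩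
    z * (x * y)   ≡⟨ cong (z *_) xy≡0 ⟩
    z * 0#        ≡⟨ zeroʳ z ⟩
    0#            ∎
    where
    open ≡-Reasoning
    z = proj₁ (inverse x x≢0)
    xz≡1 = proj₂ (inverse x x≢0)

  product-nonzero : ∀ {x y} → x ≢ 0# → y ≢ 0# → x * y ≢ 0#
  product-nonzero x≢0 y≢0 xy≡0 = y≢0 (zero-product x≢0 xy≡0)

  difference-zero : ∀ {x y} → x - y ≡ 0# → x ≡ y
  difference-zero {x} {y} eq = begin
    x           ≡⟨ solve 2 (λ x y → x := (x :- y) :+ y) refl x y ⟩
    x - y + y   ≡⟨ cong (_+ y) eq ⟩
    0# + y      ≡⟨ +-identityˡ y ⟩
    y           ∎
    where open ≡-Reasoning

  sum-zero : ∀ {n} {f : Fin n → Scalar} → (∀ i → f i ≡ 0#) → sum f ≡ 0#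
  sum-zero {n} f≡0 = trans (sum-cong-≗ f≡0) (sum-replicate-zero n)

  sum-*-distribˡ-+ : ∀ {n} (a b c : Fin n → Scalar) →
    sum (λ i → a i * (b i + c i)) ≡ sum (λ i → a i * b i) + sum (λ i → a i * c i)
  sum-*-distribˡ-+ {n} a b c = trans (sum-cong-≗ {n} (λ i → distribˡ (a i) (b i) (c i)))
    (∑-distrib-+ (λ i → a i * b i) (λ i → a i * c i))

  sum-single : ∀ {n} (f : Fin n → Scalar) i → (∀ j → j ≢ i → f j ≡ 0#) → sum f ≡ f i
  sum-single {suc n} f i f≡0 = begin
    sum f                               ≡⟨ sum-remove {i = i} f ⟩
    f i + sum (λ j → f (punchIn i j))   ≡⟨ cong (f i +_) (sum-zero (λ j → f≡0 _ (punchInᵢ≢i i j))) ⟩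
    f i + 0#                            ≡⟨ +-identityʳ _ ⟩
    f i                                 ∎
    where open ≡-Reasoning

-- Slice rank of diagonal tensors

module SliceRank (K : FinField) where
  open import Data.Fin.Base using (punchIn)
  open import Data.Fin.Properties using (punchIn-injective; punchInᵢ≢i; any?) renaming (_≟_ to _≟ᶠ_)
  open import Data.List.Base as List using (List; []; _∷_; length)
  open import Data.List.Properties using (length-map)
  open import Data.Nat.Base using (z≤n; s≤s)
  open import Data.Product using (∃₂; proj₁; proj₂)
  open import Data.Vec.Functional using (updateAt)
  open import Data.Vec.Functional.Properties using (updateAt-updates; updateAt-minimal)
  open import Function.Base using (_∘_; const)
  open import Relation.Binary.PropositionalEquality using (refl; sym; trans; cong; cong₂; subst; module ≡-Reasoning)
  open import Relation.Nullary using (Dec; yes; no; ¬?)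
  open import Relation.Nullary.Decidable using (decidable-stable)
  open import Relation.Nullary.Negation using (contradiction)
  open FieldLemmas K

  Index : ℕ → Set
  Index N = Fin 3 → Fin N

  _[_≔_] : ∀ {N} → Index N → Fin 3 → Fin N → Index N
  u [ a ≔ x ] = updateAt u a (const x)

  NonConstant : ∀ {N} → Index N → Set
  NonConstant u = ∃₂ λ b c → u b ≢ u c

  -- The cofactor is a function of the whole index that is required not to depend on coordinate
  -- `dir`; this treats the three directions uniformly.
  record Slice (N : ℕ) : Set where
    field
      dir : Fin 3
      factor : Fin N → Scalar
      cofactor : Index N → Scalar
      cofactor-cong : ∀ {u v} → (∀ b → b ≢ dir → u b ≡ v b) → cofactor u ≡ cofactor v

    value : Index N → Scalar
    value u = factor (u dir) * cofactor u

  open Slice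

  total : ∀ {N} → List (Slice N) → Index N → Scalar
  total []      u = 0#
  total (s ∷ L) u = value s u + total L u

  private
    -- The subtraction changes only the factor of a slice in direction `a`, and only the cofactor of
    -- any other slice, whose factor does not see that coordinate. So a slice stays a slice, and the
    -- list does not grow.
    eliminate : ∀ {N} → Fin 3 → (Fin N → Scalar) → Fin (suc N) → Slice (suc N) → Slice N
    eliminate a κ x₀ s = record
      { dir = dir s
      ; factor = factor′ (dir s ≟ᶠ a)
      ; cofactor = cofactor′ (dir s ≟ᶠ a)
      ; cofactor-cong = cofactor-cong′ (dir s ≟ᶠ a)
      }
      where
      ι = punchIn x₀
      factor′ : Dec (dir s ≡ a) → _
      factor′ (yes _) x = factor s (ι x) - κ x * factor s x₀
      factor′ (no _)  x = factor s (ι x)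
      cofactor′ : Dec (dir s ≡ a) → Index _ → Scalar
      cofactor′ (yes _) u = cofactor s (ι ∘ u)
      cofactor′ (no _)  u = cofactor s (ι ∘ u) - κ (u a) * cofactor s ((ι ∘ u) [ a ≔ x₀ ])
      cofactor-cong′ : ∀ d {u v} → (∀ b → b ≢ dir s → u b ≡ v b) → cofactor′ d u ≡ cofactor′ d v
      cofactor-cong′ (yes _) u≡v = cofactor-cong s (λ b b≢ → cong ι (u≡v b b≢))
      cofactor-cong′ (no d≢a) {u} {v} u≡v = cong₂ _-_
        (cofactor-cong s (λ b b≢ → cong ι (u≡v b b≢)))
        (cong₂ _*_ (cong κ (u≡v a (d≢a ∘ sym))) (cofactor-cong s updated))
        where
        updated : ∀ b → b ≢ dir s → ((ι ∘ u) [ a ≔ x₀ ]) b ≡ ((ι ∘ v) [ a ≔ x₀ ]) b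
        updated b b≢ with b ≟ᶠ a
        ... | yes refl = trans (updateAt-updates b (ι ∘ u)) (sym (updateAt-updates b (ι ∘ v)))
        ... | no b≢a = trans (updateAt-minimal b a (ι ∘ u) b≢a)
                         (trans (cong ι (u≡v b b≢)) (sym (updateAt-minimal b a (ι ∘ v) b≢a)))

    value-eliminate : ∀ {N} a (κ : Fin N → Scalar) x₀ s u → let w = punchIn x₀ ∘ u in
      value (eliminate a κ x₀ s) u ≡ value s w - κ (u a) * value s (w [ a ≔ x₀ ])
    value-eliminate a κ x₀ s u with dir s ≟ᶠ a
    ... | yes refl = trans
      (solve 4 (λ h k h₀ g → (h :- k :* h₀) :* g := h :* g :- k :* (h₀ :* g)) refl _ _ _ _)
      (cong (λ z → factor s (w a) * cofactor s w - κ (u a) * z)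
        (cong₂ _*_ (cong (factor s) (sym (updateAt-updates a w)))
          (cofactor-cong s (λ b b≢a → sym (updateAt-minimal b a w b≢a)))))
      where w = punchIn x₀ ∘ u
    ... | no d≢a = trans
      (solve 4 (λ h k g g′ → h :* (g :- k :* g′) := h :* g :- k :* (h :* g′)) refl _ _ _ _)
      (cong (λ z → factor s (w (dir s)) * cofactor s w - κ (u a) * (factor s z * cofactor s (w [ a ≔ x₀ ])))
        (sym (updateAt-minimal (dir s) a w d≢a)))
      where w = punchIn x₀ ∘ u

    total-eliminate : ∀ {N} a (κ : Fin N → Scalar) x₀ L u → let w = punchIn x₀ ∘ u in
      total (List.map (eliminate a κ x₀) L) u ≡ total L w - κ (u a) * total L (w [ a ≔ x₀ ])
    total-eliminate a κ x₀ [] u = solve 1 (λ k → :0 := :0 :- k :* :0) refl _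
    total-eliminate a κ x₀ (s ∷ L) u = trans
      (cong₂ _+_ (value-eliminate a κ x₀ s u) (total-eliminate a κ x₀ L u))
      (solve 5 (λ s k s′ t t′ → (s :- k :* s′) :+ (t :- k :* t′) := (s :+ t) :- k :* (s′ :+ t′))
        refl _ _ _ _ _)

  -- A slice h(u a) G(u) with h(x₀) ≠ 0 is removed by restricting to x ≠ x₀ and
  -- subtracting from T(u) the multiple h(u a) / h(x₀) of T(u [ a ≔ x₀ ]), which
  -- vanishes there because u [ a ≔ x₀ ] is not constant.
  diagonal-bound : ∀ l {N} (L : List (Slice N)) → length L ≡ l →
    (∀ u → NonConstant u → total L u ≡ 0#) → (∀ x → total L (const x) ≢ 0#) → N ℕ.≤ l
  diagonal-bound l {zero} L l≡ off-diagonal diagonal = z≤n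
  diagonal-bound l {suc N} [] l≡ off-diagonal diagonal = contradiction refl (diagonal zero)
  diagonal-bound (suc l) {suc N} (s ∷ L) l≡ off-diagonal diagonal with any? (λ x → ¬? (factor s x ≟ᶠ 0#))
  ... | no h≡0 = ℕ.≤-trans (diagonal-bound l L (ℕ.suc-injective l≡)
      (λ u nc → trans (sym (drop u)) (off-diagonal u nc))
      (λ x → subst (_≢ 0#) (drop (const x)) (diagonal x))) (ℕ.n≤1+n _)
    where
    drop : ∀ u → total (s ∷ L) u ≡ total L u
    drop u = trans (cong (λ z → z * cofactor s u + total L u)
                     (decidable-stable (_ ≟ᶠ 0#) (λ h≢0 → h≡0 (_ , h≢0))))
               (solve 2 (λ g t → :0 :* g :+ t := t) refl _ _)
  ... | yes (x₀ , h≢0) = s≤s (diagonal-bound l (List.map (eliminate (dir s) κ x₀) L)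
        (trans (length-map _ L) (ℕ.suc-injective l≡))
        (λ u (b , c , ub≢uc) → trans (restrict u)
          (off-diagonal (ι ∘ u) (b , c , ub≢uc ∘ punchIn-injective x₀ _ _)))
        (λ x → subst (_≢ 0#) (sym (restrict (const x))) (diagonal (ι x))))
    where
    ι = punchIn x₀
    a = dir s
    h₀⁻¹ = proj₁ (inverse (factor s x₀) h≢0)
    κ : Fin N → Scalar
    κ x = factor s (ι x) * h₀⁻¹
    open ≡-Reasoning
    cancel : ∀ u → value s (ι ∘ u) - κ (u a) * value s ((ι ∘ u) [ a ≔ x₀ ]) ≡ 0#
    cancel u = begin
      h * G - h * h₀⁻¹ * value s (w [ a ≔ x₀ ])
        ≡⟨ cong (λ z → h * G - h * h₀⁻¹ * z) (cong₂ _*_ (cong (factor s) (updateAt-updates a w))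
             (cofactor-cong s (λ b b≢a → updateAt-minimal b a w b≢a))) ⟩
      h * G - h * h₀⁻¹ * (factor s x₀ * G)
        ≡⟨ solve 4 (λ h i h₀ g → h :* g :- h :* i :* (h₀ :* g) := h :* g :- h :* g :* (h₀ :* i)) refl _ _ _ _ ⟩
      h * G - h * G * (factor s x₀ * h₀⁻¹)
        ≡⟨ cong (λ z → h * G - h * G * z) (proj₂ (inverse (factor s x₀) h≢0)) ⟩
      h * G - h * G * 1#
        ≡⟨ solve 1 (λ x → x :- x :* :1 := :0) refl _ ⟩
      0# ∎
      where
      w = ι ∘ u
      h = factor s (w a)
      G = cofactor s w
    moved : ∀ u → NonConstant ((ι ∘ u) [ a ≔ x₀ ])
    -- Coordinate `a` is x₀, which lies outside the range of `ι`, while the other coordinates are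
    -- still in it.
    moved u = a , punchIn a zero , λ eq → punchInᵢ≢i x₀ _ (sym (begin
      x₀                                   ≡⟨ sym (updateAt-updates a (ι ∘ u)) ⟩
      ((ι ∘ u) [ a ≔ x₀ ]) a               ≡⟨ eq ⟩
      ((ι ∘ u) [ a ≔ x₀ ]) (punchIn a zero)  ≡⟨ updateAt-minimal _ a (ι ∘ u) (punchInᵢ≢i a zero) ⟩
      ι (u (punchIn a zero))               ∎))
    restrict : ∀ u → total (List.map (eliminate a κ x₀) L) u ≡ total (s ∷ L) (ι ∘ u)
    restrict u = begin
      total (List.map (eliminate a κ x₀) L) u   ≡⟨ total-eliminate a κ x₀ L u ⟩
      t - κ (u a) * t′                          ≡⟨ solve 5 (λ t k t′ v v′ →
                                                     t :- k :* t′ := (v :+ t) :- k :* (v′ :+ t′) :- (v :- k :* v′))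
                                                     refl t (κ (u a)) t′ (value s (ι ∘ u)) (value s w′) ⟩
      total (s ∷ L) (ι ∘ u) - κ (u a) * total (s ∷ L) w′ - (value s (ι ∘ u) - κ (u a) * value s w′)
        ≡⟨ cong₂ (λ y z → total (s ∷ L) (ι ∘ u) - κ (u a) * y - z) (off-diagonal w′ (moved u)) (cancel u) ⟩
      total (s ∷ L) (ι ∘ u) - κ (u a) * 0# - 0# ≡⟨ solve 2 (λ t k → t :- k :* :0 :- :0 := t) refl _ _ ⟩
      total (s ∷ L) (ι ∘ u)                     ∎
      where
      w′ = (ι ∘ u) [ a ≔ x₀ ]
      t = total L (ι ∘ u)
      t′ = total L w′

-- Exponential rates below q, and the weights of exponent vectors

record GrowsBelow (q : ℕ) (N : ℕ → ℕ) : Set where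
  field
    -- The rate is the fraction P / Q, kept in ℕ so that every comparison is a cross-multiplication.
    -- `P<qQ` carries the content; `Q≤P` ensures in the end that the rational rate is positive.
    P Q B : ℕ
    0<Q : 0 ℕ.< Q
    Q≤P : Q ℕ.≤ P
    P<qQ : P ℕ.< q ℕ.* Q
    bound : ∀ n → N n ℕ.* Q ℕ.^ n ℕ.≤ B ℕ.* P ℕ.^ n

module Growth {q : ℕ} where
  open import Data.Sum using (inj₁; inj₂)
  open import Relation.Binary.PropositionalEquality using (refl; sym; trans; cong; subst₂)
  open import Data.Nat.Solver using (module +-*-Solver)
  open +-*-Solver using (solve; _:=_; _:*_; con)
  open ℕ.≤-Reasoning
  open import Data.Nat.Base using (_+_; _*_; _^_; _≤_; _<_)

  ^-distribʳ-* : ∀ a b n → (a * b) ^ n ≡ a ^ n * b ^ n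
  ^-distribʳ-* a b zero = refl
  ^-distribʳ-* a b (suc n) = trans (cong (a * b *_) (^-distribʳ-* a b n))
    (solve 4 (λ a b x y → a :* b :* (x :* y) := a :* x :* (b :* y)) refl a b (a ^ n) (b ^ n))

  private
    -- A bound survives the passage to a larger rate: after multiplication by Q^n, `bound` applies,
    -- and Q^n is cancelled. This brings two thresholds to a common rate before they are added.
    faster : ∀ {N} (g : GrowsBelow q N) P′ Q′ → let open GrowsBelow g in
      P * Q′ ≤ P′ * Q → ∀ n → N n * Q′ ^ n ≤ B * P′ ^ n
    faster {N} g P′ Q′ P/Q≤P′/Q′ n =
      ℕ.*-cancelʳ-≤ _ _ (Q ^ n) ⦃ ℕ.m^n≢0 Q n ⦃ ℕ.>-nonZero 0<Q ⦄ ⦄ (begin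
        N n * Q′ ^ n * Q ^ n     ≡⟨ swap (N n) (Q′ ^ n) (Q ^ n) ⟩
        N n * Q ^ n * Q′ ^ n     ≤⟨ ℕ.*-monoˡ-≤ (Q′ ^ n) (bound n) ⟩
        B * P ^ n * Q′ ^ n       ≡⟨ ℕ.*-assoc B _ _ ⟩
        B * (P ^ n * Q′ ^ n)     ≡⟨ cong (B *_) (sym (^-distribʳ-* P Q′ n)) ⟩
        B * (P * Q′) ^ n         ≤⟨ ℕ.*-monoʳ-≤ B (ℕ.^-monoˡ-≤ n P/Q≤P′/Q′) ⟩
        B * (P′ * Q) ^ n         ≡⟨ cong (B *_) (^-distribʳ-* P′ Q n) ⟩
        B * (P′ ^ n * Q ^ n)     ≡⟨ sym (ℕ.*-assoc B _ _) ⟩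
        B * P′ ^ n * Q ^ n       ∎)
      where
      open GrowsBelow g
      swap : ∀ a b c → a * b * c ≡ a * c * b
      swap = solve 3 (λ a b c → a :* b :* c := a :* c :* b) refl

    add : ∀ (M N : ℕ → ℕ) P Q A B → (∀ n → M n * Q ^ n ≤ A * P ^ n) → (∀ n → N n * Q ^ n ≤ B * P ^ n) →
      ∀ n → (M n + N n) * Q ^ n ≤ (A + B) * P ^ n
    add M N P Q A B boundM boundN n = subst₂ _≤_
      (sym (ℕ.*-distribʳ-+ (Q ^ n) (M n) (N n))) (sym (ℕ.*-distribʳ-+ (P ^ n) A B))
      (ℕ.+-mono-≤ (boundM n) (boundN n))

  below-+ : ∀ {M N} → GrowsBelow q M → GrowsBelow q N → GrowsBelow q (λ n → M n + N n)
  below-+ {M} {N} m n with ℕ.≤-total (M.P * N.Q) (N.P * M.Q)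
    where
    module M = GrowsBelow m
    module N = GrowsBelow n
  ... | inj₁ M≤N = record
    { GrowsBelow n
    ; B = M.B + N.B
    ; bound = add M N N.P N.Q M.B N.B (faster m N.P N.Q M≤N) N.bound }
    where
    module M = GrowsBelow m
    module N = GrowsBelow n
  ... | inj₂ N≤M = record
    { GrowsBelow m
    ; B = M.B + N.B
    ; bound = add M N M.P M.Q M.B N.B M.bound (faster n M.P M.Q N≤M) }
    where
    module M = GrowsBelow m
    module N = GrowsBelow n

  below-* : ∀ {N} c → GrowsBelow q N → GrowsBelow q (λ n → N n * c)
  below-* {N} c g = record
    { GrowsBelow g
    ; B = B * c
    ; bound = λ n → begin
        N n * c * Q ^ n     ≡⟨ swap (N n) c (Q ^ n) ⟩
        N n * Q ^ n * c     ≤⟨ ℕ.*-monoˡ-≤ c (bound n) ⟩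
        B * P ^ n * c       ≡⟨ swap B (P ^ n) c ⟩
        B * c * P ^ n       ∎
    }
    where
    open GrowsBelow g
    swap : ∀ a b c → a * b * c ≡ a * c * b
    swap = solve 3 (λ a b c → a :* b :* c := a :* c :* b) refl

  below-const : 1 < q → ∀ c → GrowsBelow q (λ _ → c)
  below-const 1<q c = record
    { P = 1 ; Q = 1 ; B = c
    ; 0<Q = ℕ.≤-refl
    ; Q≤P = ℕ.≤-refl
    ; P<qQ = ℕ.≤-trans 1<q (ℕ.≤-reflexive (sym (ℕ.*-identityʳ q)))
    ; bound = λ n → ℕ.≤-refl
    }

-- Exponent vectors with entries in {0, …, p} are weighted so that the weights
-- of one entry add up to 18 (p + 1) - 1, although any three entries with sum at
-- most p have weights of product at least 18³.
module ExponentWeights (p′ : ℕ) where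
  import Data.Vec.Base as Vec
  open Vec using ([]; _∷_)
  open import Data.Fin.Base using (toℕ)
  open import Data.List.Base using (List; []; _∷_; _++_; map; length; filter; allFin; tabulate; cartesianProductWith)
  open import Data.List.Properties using (map-++; map-tabulate; filter-accept; filter-reject)
  open import Data.List.Membership.Propositional using (_∈_)
  open import Data.List.Membership.Propositional.Properties using (∈-filter⁺; ∈-allFin; ∈-cartesianProductWith⁺)
  open import Data.List.Relation.Unary.Any using (here)
  open import Data.Nat.Base using (_+_; _*_; _^_; _≤_; z≤n; s≤s)
  open import Data.Nat.ListAction using (sum)
  open import Data.Nat.ListAction.Properties using (sum-++)
  open import Data.Nat.Solver using (module +-*-Solver)
  open import Data.Sum using (inj₁; inj₂)
  open import Relation.Binary.PropositionalEquality using (refl; sym; trans; cong; cong₂)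
  open import Relation.Nullary using (Dec; yes; no)
  open +-*-Solver using (solve; _:=_; _:*_; _:+_; con)
  open ℕ.≤-Reasoning

  p q : ℕ
  p = suc p′
  q = suc p

  private
    -- Exponents strictly between 0 and p weigh 18, and p weighs 8. The recursion recognises the
    -- last element by `k` reaching 0, so that the sum of the weights is computed by induction.
    positive-weight : ∀ {k} → Fin (suc k) → ℕ
    positive-weight {zero}  zero    = 8
    positive-weight {suc k} zero    = 18
    positive-weight {suc k} (suc i) = positive-weight i

    positive-weight-≥8 : ∀ {k} (i : Fin (suc k)) → 8 ≤ positive-weight i
    positive-weight-≥8 {zero}  zero    = ℕ.≤-refl
    positive-weight-≥8 {suc k} zero    = ℕ.m≤m+n 8 10
    positive-weight-≥8 {suc k} (suc i) = positive-weight-≥8 i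

    positive-weight-cases : ∀ {k} (i : Fin (suc k)) → toℕ i ≡ k ⊎ 18 ≤ positive-weight i
    positive-weight-cases {zero}  zero    = inj₁ refl
    positive-weight-cases {suc k} zero    = inj₂ ℕ.≤-refl
    positive-weight-cases {suc k} (suc i) with positive-weight-cases i
    ... | inj₁ eq = inj₁ (cong suc eq)
    ... | inj₂ le = inj₂ le

    positive-weight-sum : ∀ k → sum (tabulate (positive-weight {k})) ≡ 8 + k * 18
    positive-weight-sum zero = refl
    positive-weight-sum (suc k) = trans (cong (18 +_) (positive-weight-sum k))
      (solve 1 (λ k → con 18 :+ (con 8 :+ k :* con 18) := con 8 :+ (con 18 :+ k :* con 18)) refl k)

  -- 18 is the reference value for one exponent. The extreme weights satisfy 27 · 27 · 8 = 18³, so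
  -- that (0, 0, p) just meets the bound on products, and 27 + 8 = 2 · 18 - 1, so that the mean over
  -- all exponents is below 18.
  weight : Fin q → ℕ
  weight zero    = 27
  weight (suc i) = positive-weight i

  weight-≥8 : ∀ i → 8 ≤ weight i
  weight-≥8 zero    = ℕ.m≤m+n 8 19
  weight-≥8 (suc i) = positive-weight-≥8 i

  weight-cases : ∀ i → toℕ i ≡ p ⊎ 18 ≤ weight i
  weight-cases zero    = inj₂ (ℕ.m≤m+n 18 9)
  weight-cases (suc i) with positive-weight-cases i
  ... | inj₁ eq = inj₁ (cong suc eq)
  ... | inj₂ le = inj₂ le

  total-weight : ℕ
  total-weight = 17 + p * 18

  weight-sum : sum (map weight (allFin q)) ≡ total-weight
  weight-sum = trans (cong sum (map-tabulate (λ i → i) weight)) (trans (cong (27 +_) (positive-weight-sum p′))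
    (solve 1 (λ k → con 27 :+ (con 8 :+ k :* con 18) := con 17 :+ (con 18 :+ k :* con 18)) refl p′))

  private
    weight-zero : ∀ i → toℕ i ≡ 0 → weight i ≡ 27
    weight-zero zero _ = refl

    residual-zero : ∀ {a b} → a ≡ p → a + b ≤ p → b ≡ 0
    residual-zero {b = b} refl a+b≤p =
      ℕ.n≤0⇒n≡0 (ℕ.+-cancelˡ-≤ p b 0 (ℕ.≤-trans a+b≤p (ℕ.≤-reflexive (sym (ℕ.+-identityʳ p)))))

    full : ∀ i j k → toℕ i ≡ p → toℕ i + (toℕ j + toℕ k) ≤ p → 18 * 18 * 18 ≤ weight i * weight j * weight k
    full i j k i≡p le = ℕ.*-mono-≤ (ℕ.*-mono-≤ (weight-≥8 i)
        (ℕ.≤-reflexive (sym (weight-zero j (ℕ.m+n≡0⇒m≡0 (toℕ j) rest)))))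
        (ℕ.≤-reflexive (sym (weight-zero k (ℕ.m+n≡0⇒n≡0 (toℕ j) rest))))
      where rest = residual-zero i≡p le

  -- An entry `p` uses up the whole sum and leaves 0 for the other two, which is the case of
  -- equality; if there is no such entry, each weight is at least 18.
  weight-product : ∀ i j k → toℕ i + (toℕ j + toℕ k) ≤ p → 18 * 18 * 18 ≤ weight i * weight j * weight k
  weight-product i j k le with weight-cases i | weight-cases j | weight-cases k
  ... | inj₁ i≡p | _ | _ = full i j k i≡p le
  ... | inj₂ _ | inj₁ j≡p | _ = ℕ.≤-trans
    (full j i k j≡p (ℕ.≤-trans (ℕ.≤-reflexive
      (solve 3 (λ i j k → j :+ (i :+ k) := i :+ (j :+ k)) refl (toℕ i) (toℕ j) (toℕ k))) le))
    (ℕ.≤-reflexive (cong (_* weight k) (ℕ.*-comm (weight j) (weight i))))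
  ... | inj₂ _ | inj₂ _ | inj₁ k≡p = ℕ.≤-trans
    (full k i j k≡p (ℕ.≤-trans (ℕ.≤-reflexive
      (solve 3 (λ i j k → k :+ (i :+ j) := i :+ (j :+ k)) refl (toℕ i) (toℕ j) (toℕ k))) le))
    (ℕ.≤-reflexive (solve 3 (λ i j k → k :* i :* j := i :* j :* k) refl (weight i) (weight j) (weight k)))
  ... | inj₂ wi | inj₂ wj | inj₂ wk = ℕ.*-mono-≤ (ℕ.*-mono-≤ wi wj) wk

  Exponents : ℕ → Set
  Exponents n = Vec.Vec (Fin q) n

  Weight : ∀ {n} → Exponents n → ℕ
  Weight []      = 1
  Weight (e ∷ α) = weight e * Weight α

  -- Small exponents have large weights, so the light vectors are those of large weight.
  Light : ∀ {n} → Exponents n → Set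
  Light {n} α = 18 ^ n ≤ Weight α

  allExponents : ∀ n → List (Exponents n)
  allExponents zero    = [] ∷ []
  allExponents (suc n) = cartesianProductWith _∷_ (allFin q) (allExponents n)

  ∈-allExponents : ∀ {n} (α : Exponents n) → α ∈ allExponents n
  ∈-allExponents []      = here refl
  ∈-allExponents (e ∷ α) = ∈-cartesianProductWith⁺ _∷_ (∈-allFin e) (∈-allExponents α)

  private
    sum-prepend : ∀ {n} e (αs : List (Exponents n)) → sum (map Weight (map (e ∷_) αs)) ≡ weight e * sum (map Weight αs)
    sum-prepend e [] = sym (ℕ.*-zeroʳ (weight e))
    sum-prepend e (α ∷ αs) = trans (cong (weight e * Weight α +_) (sum-prepend e αs))
      (sym (ℕ.*-distribˡ-+ (weight e) _ _))

    sum-product : ∀ {n} es (αs : List (Exponents n)) →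
      sum (map Weight (cartesianProductWith _∷_ es αs)) ≡ sum (map weight es) * sum (map Weight αs)
    sum-product [] αs = refl
    sum-product (e ∷ es) αs = trans (cong sum (map-++ Weight (map (e ∷_) αs) _))
      (trans (sum-++ (map Weight (map (e ∷_) αs)) _)
      (trans (cong₂ _+_ (sum-prepend e αs) (sum-product es αs))
      (sym (ℕ.*-distribʳ-+ (sum (map Weight αs)) (weight e) _))))

  Weight-sum : ∀ n → sum (map Weight (allExponents n)) ≡ total-weight ^ n
  Weight-sum zero    = refl
  Weight-sum (suc n) = trans (sum-product (allFin q) (allExponents n)) (cong₂ _*_ weight-sum (Weight-sum n))

  light? : ∀ {n} (α : Exponents n) → Dec (Light α)
  light? {n} α = 18 ^ n ℕ.≤? Weight α

  lightExponents : ∀ n → List (Exponents n)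
  lightExponents n = filter light? (allExponents n)

  ∈-lightExponents : ∀ {n} (α : Exponents n) → Light α → α ∈ lightExponents n
  ∈-lightExponents α light = ∈-filter⁺ light? (∈-allExponents α) light

  private
    markov : ∀ {n} (αs : List (Exponents n)) →
      length (filter light? αs) * 18 ^ n ≤ sum (map Weight αs)
    markov [] = z≤n
    markov {n} (α ∷ αs) = step (light? α)
      where
      step : Dec (Light α) → length (filter light? (α ∷ αs)) * 18 ^ n ≤ Weight α + sum (map Weight αs)
      step (yes light) = ℕ.≤-trans (ℕ.≤-reflexive (cong (λ l → length l * 18 ^ n) (filter-accept light? {x = α} {xs = αs} light)))
        (ℕ.+-mono-≤ light (markov αs))
      step (no heavy) = ℕ.≤-trans (ℕ.≤-reflexive (cong (λ l → length l * 18 ^ n) (filter-reject light? {x = α} {xs = αs} heavy)))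
        (ℕ.≤-trans (markov αs) (ℕ.m≤n+m _ (Weight α)))

  lightExponents-bound : ∀ n → length (lightExponents n) * 18 ^ n ≤ total-weight ^ n
  lightExponents-bound n = ℕ.≤-trans (markov (allExponents n)) (ℕ.≤-reflexive (Weight-sum n))

  lightExponents-below : GrowsBelow q (λ n → length (lightExponents n))
  lightExponents-below = record
    -- The rate is (18 q - 1) / 18: the total weight of the values of one entry, divided by the
    -- reference weight.
    { P = total-weight ; Q = 18 ; B = 1
    ; 0<Q = s≤s z≤n
    ; Q≤P = ℕ.≤-trans (ℕ.m≤m+n 18 (p′ * 18 + 17)) (ℕ.≤-reflexive
        (solve 1 (λ k → con 18 :+ (k :* con 18 :+ con 17) := con 17 :+ (con 18 :+ k :* con 18)) refl p′))
    ; P<qQ = ℕ.≤-refl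
    ; bound = λ n → ℕ.≤-trans (lightExponents-bound n) (ℕ.≤-reflexive (sym (ℕ.+-identityʳ _)))
    }

  some-light : ∀ {n} (α β γ : Exponents n) →
    18 ^ n * 18 ^ n * 18 ^ n ≤ Weight α * Weight β * Weight γ → Light α ⊎ Light β ⊎ Light γ
  some-light {n} α β γ le with light? α | light? β | light? γ
  ... | yes a | _ | _ = inj₁ a
  ... | no _ | yes b | _ = inj₂ (inj₁ b)
  ... | no _ | no _ | yes c = inj₂ (inj₂ c)
  ... | no a | no b | no c = ⊥-elim (ℕ.<⇒≱
      (ℕ.*-mono-< (ℕ.*-mono-< (ℕ.≰⇒> a) (ℕ.≰⇒> b)) (ℕ.≰⇒> c)) le)
    where open import Data.Empty using (⊥-elim)

-- Expansion of the zero test into monomials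

module Sums (K : FinField) where
  open FieldLemmas K
  open import Relation.Binary.PropositionalEquality using (refl; sym; trans; cong)

  -- Only the existence of an expansion into functions of the kind `P` matters, never the number of
  -- summands or their coefficients, so no list of them is exposed.
  data SumOf {A : Set} (P : (A → Scalar) → Set) : (A → Scalar) → Set where
    nil  : ∀ {f} → (∀ u → f u ≡ 0#) → SumOf P f
    cons : ∀ {f g h} → P g → SumOf P h → (∀ u → f u ≡ g u + h u) → SumOf P f

  module _ {A : Set} where

    private variable
      P Q R : (A → Scalar) → Set
      f g h : A → Scalar

    SumOf-cong : SumOf P g → (∀ u → f u ≡ g u) → SumOf P f
    SumOf-cong (nil g≡0) f≡g = nil (λ u → trans (f≡g u) (g≡0 u))
    SumOf-cong (cons p s g≡) f≡g = cons p s (λ u → trans (f≡g u) (g≡ u))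

    SumOf-single : P f → SumOf P f
    SumOf-single p = cons p (nil (λ u → refl)) (λ u → sym (+-identityʳ _))

    SumOf-+ : SumOf P f → SumOf P g → SumOf P (λ u → f u + g u)
    SumOf-+ {g = g} (nil f≡0) t = SumOf-cong t (λ u → trans (cong (_+ g u) (f≡0 u)) (+-identityˡ _))
    SumOf-+ {g = g} (cons p s f≡) t = cons p (SumOf-+ s t)
      (λ u → trans (cong (_+ g u) (f≡ u)) (+-assoc _ _ _))

    SumOf-* : (∀ {f g} → P f → Q g → R (λ u → f u * g u)) →
      SumOf P f → SumOf Q g → SumOf R (λ u → f u * g u)
    SumOf-* {f = f} {g = g} mult (nil f≡0) t = nil (λ u → trans (cong (_* g u) (f≡0 u)) (zeroˡ _))
    SumOf-* {P = P} {R = R} mult (cons {g = f₁} p s f≡) t = SumOf-cong (SumOf-+ (scale t) (SumOf-* mult s t))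
      (λ u → trans (cong (_* _) (f≡ u)) (distribʳ _ _ _))
      where
      scale : ∀ {g} → SumOf _ g → SumOf R (λ u → f₁ u * g u)
      scale (nil g≡0) = nil (λ u → trans (cong (f₁ u *_) (g≡0 u)) (zeroʳ _))
      scale (cons q t g≡) = cons (mult p q) (scale t)
        (λ u → trans (cong (f₁ u *_) (g≡ u)) (distribˡ _ _ _))

  SumOf-map : ∀ {A B : Set} {P : (A → Scalar) → Set} {Q : (B → Scalar) → Set} (φ : B → A) →
    (∀ {f} → P f → Q (λ u → f (φ u))) → ∀ {f} → SumOf P f → SumOf Q (λ u → f (φ u))
  SumOf-map φ map (nil f≡0) = nil (λ u → f≡0 (φ u))
  SumOf-map φ map (cons p s f≡) = cons (map p) (SumOf-map φ map s) (λ u → f≡ (φ u))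

module Monomials (K : FinField) where
  open FieldLemmas K
  open Sums K
  open ExponentWeights (FinField.q-2 K) hiding (p; q)
  import Data.Vec.Base as Vec
  open Vec using ([]; _∷_; head; tail)
  open import Algebra.Properties.Semiring.Exp semiring using (_^_; ^-homo-*)
  open import Data.Fin.Base using (toℕ; fromℕ<; punchIn; punchOut)
  open import Data.Fin.Properties using (punchIn-punchOut; punchInᵢ≢i; toℕ-fromℕ<)
  open import Data.Nat.Base using (s≤s; z≤n)
  import Data.Nat.Solver as ℕ
  open import Data.Product using (Σ-syntax)
  open import Function.Base using (_∘_)
  open import Relation.Binary.PropositionalEquality using (refl; sym; trans; cong; cong₂; subst; subst₂)

  Triple : Set → Set
  Triple A = Fin 3 → A

  pattern 0F = zero
  pattern 1F = suc zero
  pattern 2F = suc (suc zero)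

  monomial : ℕ → ℕ → ℕ → Triple Scalar → Scalar
  monomial i j k v = v 0F ^ i * (v 1F ^ j * v 2F ^ k)

  Monomial≤ : ℕ → (Triple Scalar → Scalar) → Set
  Monomial≤ d f = ∃[ c ] ∃[ i ] ∃[ j ] ∃[ k ]
    (i ℕ.+ (j ℕ.+ k) ℕ.≤ d × (∀ v → f v ≡ c * monomial i j k v))

  Monomial≤-* : ∀ {d e f g} → Monomial≤ d f → Monomial≤ e g → Monomial≤ (d ℕ.+ e) (λ v → f v * g v)
  Monomial≤-* {d} {e} (c , i , j , k , le , f≡) (c′ , i′ , j′ , k′ , le′ , g≡) =
    c * c′ , i ℕ.+ i′ , j ℕ.+ j′ , k ℕ.+ k′ ,
    subst (ℕ._≤ d ℕ.+ e) (sym degree) (ℕ.+-mono-≤ le le′) , λ v → trans (cong₂ _*_ (f≡ v) (g≡ v)) (product v)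
    where
    degree : i ℕ.+ i′ ℕ.+ (j ℕ.+ j′ ℕ.+ (k ℕ.+ k′)) ≡ i ℕ.+ (j ℕ.+ k) ℕ.+ (i′ ℕ.+ (j′ ℕ.+ k′))
    degree = ℕ.+-*-Solver.solve 6 (λ i j k i′ j′ k′ →
        i ⊕ i′ ⊕ (j ⊕ j′ ⊕ (k ⊕ k′)) ⊜ i ⊕ (j ⊕ k) ⊕ (i′ ⊕ (j′ ⊕ k′))) refl i j k i′ j′ k′
      where open ℕ.+-*-Solver using () renaming (_:+_ to _⊕_; _:=_ to _⊜_)
    product : ∀ v → c * monomial i j k v * (c′ * monomial i′ j′ k′ v) ≡
      c * c′ * monomial (i ℕ.+ i′) (j ℕ.+ j′) (k ℕ.+ k′) v
    product v = sym (trans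
      (cong (c * c′ *_) (cong₂ _*_ (^-homo-* (v 0F) i i′)
        (cong₂ _*_ (^-homo-* (v 1F) j j′) (^-homo-* (v 2F) k k′))))
      (solve 8 (λ c c′ x x′ y y′ z z′ → c :* c′ :* (x :* x′ :* (y :* y′ :* (z :* z′))) :=
        c :* (x :* (y :* z)) :* (c′ :* (x′ :* (y′ :* z′)))) refl c c′ _ _ _ _ _ _))

  linear : Triple Scalar → Triple Scalar → Scalar
  linear a v = a 0F * v 0F + (a 1F * v 1F + a 2F * v 2F)

  factor-sum : ∀ a e → SumOf (Monomial≤ 1) (λ v → linear a v - e)
  factor-sum a e = cons (a 0F , 1 , 0 , 0 , s≤s z≤n , λ v → refl)
    (cons (a 1F , 0 , 1 , 0 , s≤s z≤n , λ v → refl)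
    (cons (a 2F , 0 , 0 , 1 , s≤s z≤n , λ v → refl)
    (cons (- e , 0 , 0 , 0 , z≤n , λ v → refl)
    (nil λ v → refl) λ v → refl) λ v → refl) λ v → refl)
    λ v → solve 7 (λ a b c x y z e → (a :* x :+ (b :* y :+ c :* z)) :- e :=
      a :* (x :* :1 :* (:1 :* :1)) :+ (b :* (:1 :* (y :* :1 :* :1)) :+ (c :* (:1 :* (:1 :* (z :* :1)))
        :+ ((:- e) :* (:1 :* (:1 :* :1)) :+ :0)))) refl (a 0F) (a 1F) (a 2F) (v 0F) (v 1F) (v 2F) e

  product : ∀ {l} → (Fin l → Scalar) → Scalar
  product {zero}  f = 1#
  product {suc l} f = f zero * product (f ∘ suc)

  product-zero : ∀ {l} (f : Fin l → Scalar) i → f i ≡ 0# → product f ≡ 0#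
  product-zero f zero    fi≡0 = trans (cong (_* product (f ∘ suc)) fi≡0) (zeroˡ _)
  product-zero f (suc i) fi≡0 = trans (cong (f zero *_) (product-zero (f ∘ suc) i fi≡0)) (zeroʳ _)

  product-nonzero′ : ∀ {l} (f : Fin l → Scalar) → (∀ i → f i ≢ 0#) → product f ≢ 0#
  product-nonzero′ {zero}  f f≢0 = 1≢0
  product-nonzero′ {suc l} f f≢0 = product-nonzero (f≢0 zero) (product-nonzero′ (f ∘ suc) (f≢0 ∘ suc))

  product-sum : ∀ {l} a (e : Fin l → Scalar) → SumOf (Monomial≤ l) (λ v → product (λ i → linear a v - e i))
  product-sum {zero}  a e = SumOf-single (1# , 0 , 0 , 0 , z≤n , λ v →
    solve 0 (:1 := :1 :* (:1 :* (:1 :* :1))) refl)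
  product-sum {suc l} a e = SumOf-* Monomial≤-* (factor-sum a (e zero)) (product-sum a (e ∘ suc))

  -- Up to sign this is the polynomial 1 - w^(q-1). Written as the product over the nonzero scalars,
  -- which `punchIn 0#` enumerates, its zeros are visible without Fermat's little theorem, and its
  -- degree is `p`.
  indicator : Scalar → Scalar
  indicator w = product {p} (λ i → w - punchIn 0# i)

  indicator-nonzero : indicator 0# ≢ 0#
  indicator-nonzero = product-nonzero′ _ (λ i eq → punchInᵢ≢i 0# i (sym (difference-zero eq)))

  indicator-zero : ∀ {w} → w ≢ 0# → indicator w ≡ 0#
  indicator-zero {w} w≢0 = product-zero (λ i → w - punchIn 0# i) (punchOut (w≢0 ∘ sym))
    (trans (cong (λ z → w - z) (punchIn-punchOut (w≢0 ∘ sym))) (-‿inverseʳ w))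

  Point : ℕ → Set
  Point n = Vec.Vec Scalar n

  power : ∀ {n} → Exponents n → Point n → Scalar
  power []      x = 1#
  power (e ∷ α) x = head x ^ toℕ e * power α (tail x)

  zero-test : ∀ {n} → Triple Scalar → Triple (Point n) → Scalar
  zero-test {zero}  a u = 1#
  zero-test {suc n} a u = indicator (linear a (head ∘ u)) * zero-test a (tail ∘ u)

  -- Of the degree bounds in the single coordinates, only their effect on the weights is kept. It is
  -- multiplicative over the coordinates and is all that `some-light` requires.
  BalancedTerm : ∀ {n} → (Triple (Point n) → Scalar) → Set
  BalancedTerm {n} f = ∃[ c ] Σ[ α ∈ Exponents n ] Σ[ β ∈ Exponents n ] Σ[ γ ∈ Exponents n ]
    (18 ℕ.^ n ℕ.* 18 ℕ.^ n ℕ.* 18 ℕ.^ n ℕ.≤ Weight α ℕ.* Weight β ℕ.* Weight γ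
     × (∀ u → f u ≡ c * (power α (u 0F) * (power β (u 1F) * power γ (u 2F)))))

  private
    cube : ∀ a b c x y z → a ℕ.* b ℕ.* c ℕ.* (x ℕ.* y ℕ.* z) ≡ (a ℕ.* x) ℕ.* (b ℕ.* y) ℕ.* (c ℕ.* z)
    cube = ℕ.+-*-Solver.solve 6 (λ a b c x y z →
        a ⊛ b ⊛ c ⊛ (x ⊛ y ⊛ z) ⊜ (a ⊛ x) ⊛ (b ⊛ y) ⊛ (c ⊛ z)) refl
      where open ℕ.+-*-Solver using () renaming (_:*_ to _⊛_; _:=_ to _⊜_)

    -- The degree bound `p` in the new coordinate makes each of its exponents an element of `Fin q`
    -- directly, without reduction modulo x^q - x.
    extend : ∀ {n f g} → Monomial≤ p f → BalancedTerm {n} g →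
      BalancedTerm {suc n} (λ u → f (head ∘ u) * g (tail ∘ u))
    extend {n} (c , i , j , k , le , f≡) (c′ , α , β , γ , heavy , g≡) =
      c * c′ , e₁ ∷ α , e₂ ∷ β , e₃ ∷ γ ,
      subst₂ ℕ._≤_ (cube 18 18 18 (18 ℕ.^ n) (18 ℕ.^ n) (18 ℕ.^ n)) (cube (weight e₁) (weight e₂) (weight e₃) _ _ _)
        (ℕ.*-mono-≤ (weight-product e₁ e₂ e₃
          (subst (ℕ._≤ p) (sym (cong₂ ℕ._+_ i≡ (cong₂ ℕ._+_ j≡ k≡))) le)) heavy) ,
      λ u → trans (cong₂ _*_ (trans (f≡ (head ∘ u)) (cong (c *_) (cong₂ _*_ (cong (head (u 0F) ^_) (sym i≡))
              (cong₂ _*_ (cong (head (u 1F) ^_) (sym j≡)) (cong (head (u 2F) ^_) (sym k≡)))))) (g≡ (tail ∘ u)))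
        (solve 8 (λ c c′ x x′ y y′ z z′ → c :* (x :* (y :* z)) :* (c′ :* (x′ :* (y′ :* z′))) :=
          c :* c′ :* (x :* x′ :* (y :* y′ :* (z :* z′)))) refl c c′ _ _ _ _ _ _)
      where
      i≤p : i ℕ.< q
      i≤p = s≤s (ℕ.≤-trans (ℕ.m≤m+n i _) le)
      j≤p : j ℕ.< q
      j≤p = s≤s (ℕ.≤-trans (ℕ.≤-trans (ℕ.m≤m+n j k) (ℕ.m≤n+m _ i)) le)
      k≤p : k ℕ.< q
      k≤p = s≤s (ℕ.≤-trans (ℕ.≤-trans (ℕ.m≤n+m k j) (ℕ.m≤n+m _ i)) le)
      e₁ = fromℕ< i≤p
      e₂ = fromℕ< j≤p
      e₃ = fromℕ< k≤p
      i≡ : toℕ e₁ ≡ i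
      i≡ = toℕ-fromℕ< i≤p
      j≡ : toℕ e₂ ≡ j
      j≡ = toℕ-fromℕ< j≤p
      k≡ : toℕ e₃ ≡ k
      k≡ = toℕ-fromℕ< k≤p

  zero-test-sum : ∀ n a → SumOf (BalancedTerm {n}) (zero-test a)
  zero-test-sum zero a = SumOf-single (1# , [] , [] , [] , ℕ.≤-refl , λ u →
    solve 0 (:1 := :1 :* (:1 :* (:1 :* :1))) refl)
  zero-test-sum (suc n) a = combine (product-sum a (punchIn 0#)) (zero-test-sum n a)
    where
    combine : ∀ {f g} → SumOf (Monomial≤ p) f → SumOf (BalancedTerm {n}) g →
      SumOf (BalancedTerm {suc n}) (λ u → f (head ∘ u) * g (tail ∘ u))
    -- `SumOf-*` multiplies functions on one domain, so the terms in the first coordinate and those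
    -- in the remaining ones are both pulled back to full points.
    combine s t = SumOf-* {P = HeadTerm} {Q = TailTerm}
      (λ { (f , mf , f≡) (g , mg , g≡) → respect (extend mf mg) λ u → cong₂ _*_ (f≡ u) (g≡ u) })
      (SumOf-map (head ∘_) (λ m → _ , m , λ u → refl) s)
      (SumOf-map (tail ∘_) (λ m → _ , m , λ u → refl) t)
      where
      HeadTerm TailTerm : (Triple (Point (suc n)) → Scalar) → Set
      HeadTerm h = ∃[ f ] (Monomial≤ p f × (∀ u → h u ≡ f (head ∘ u)))
      TailTerm h = ∃[ g ] (BalancedTerm {n} g × (∀ u → h u ≡ g (tail ∘ u)))
      respect : ∀ {f g} → BalancedTerm {suc n} g → (∀ u → f u ≡ g u) → BalancedTerm f
      respect (c , α , β , γ , heavy , g≡) f≡g = c , α , β , γ , heavy , λ u → trans (f≡g u) (g≡ u)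

  private
    linear-cong : ∀ a {v w} → (∀ b → v b ≡ w b) → linear a v ≡ linear a w
    linear-cong a v≡w = cong₂ _+_ (cong (a 0F *_) (v≡w 0F))
      (cong₂ _+_ (cong (a 1F *_) (v≡w 1F)) (cong (a 2F *_) (v≡w 2F)))

    head-lookup : ∀ {n} (x : Point (suc n)) → head x ≡ Vec.lookup x zero
    head-lookup (x ∷ _) = refl

    tail-lookup : ∀ {n} (x : Point (suc n)) t → Vec.lookup (tail x) t ≡ Vec.lookup x (suc t)
    tail-lookup (_ ∷ _) t = refl

  zero-test-nonzero : ∀ {n} a (u : Triple (Point n)) →
    (∀ t → linear a (λ b → Vec.lookup (u b) t) ≡ 0#) → zero-test a u ≢ 0#
  zero-test-nonzero {zero}  a u solution = 1≢0
  zero-test-nonzero {suc n} a u solution = product-nonzero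
    (subst (λ w → indicator w ≢ 0#)
      (sym (trans (linear-cong a (λ b → head-lookup (u b))) (solution zero))) indicator-nonzero)
    (zero-test-nonzero a (tail ∘ u) λ t →
      trans (linear-cong a (λ b → tail-lookup (u b) t)) (solution (suc t)))

  zero-test-zero : ∀ {n} a (u : Triple (Point n)) t →
    linear a (λ b → Vec.lookup (u b) t) ≢ 0# → zero-test a u ≡ 0#
  zero-test-zero a u zero ≢0 = trans
    (cong (_* zero-test a (tail ∘ u)) (indicator-zero λ eq →
      ≢0 (trans (linear-cong a (λ b → sym (head-lookup (u b)))) eq)))
    (zeroˡ _)
  zero-test-zero a u (suc t) ≢0 = trans
    (cong (indicator (linear a (head ∘ u)) *_) (zero-test-zero a (tail ∘ u) t λ eq →
      ≢0 (trans (linear-cong a (λ b → sym (tail-lookup (u b) t))) eq)))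
    (zeroʳ _)

-- Slice rank bound for equations in three variables

module ThreeTermBound (K : FinField) where
  open FieldLemmas K
  open Sums K
  open SliceRank K
  open Monomials K
  open ExponentWeights (FinField.q-2 K) hiding (p; q)
  open import Data.Fin.Properties using () renaming (_≟_ to _≟ᶠ_)
  open import Data.List.Base using (List; map; _++_; length; lookup; tabulate)
  open import Data.List.Properties using (length-++; length-map; length-tabulate)
  open import Data.List.Membership.Propositional using (_∈_)
  open import Data.List.Membership.Propositional.Properties using (∈-++⁺ˡ; ∈-++⁺ʳ; ∈-map⁺)
  open import Data.List.Relation.Unary.Any using (index)
  open import Data.List.Relation.Unary.Any.Properties using (lookup-index)
  open import Data.Product using (proj₁; proj₂)
  open import Data.Sum using (inj₁; inj₂)
  open import Function.Base using (_∘_; const)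
  open import Relation.Binary.PropositionalEquality using (refl; sym; trans; cong; cong₂; subst)
  open import Relation.Nullary using (Dec; yes; no)
  open import Relation.Nullary.Negation using (contradiction)

  module _ {n N} (s : Fin N → Point n) where

    private
      -- Each pair of a direction and a light exponent vector gives one slice. All terms with the
      -- same key are collected in its cofactor, so the number of slices does not depend on the
      -- number of terms.
      keys : List (Fin 3 × Exponents n)
      keys = map (0F ,_) (lightExponents n) ++ map (1F ,_) (lightExponents n) ++ map (2F ,_) (lightExponents n)

      length-keys : length keys ≡
        length (lightExponents n) ℕ.+ (length (lightExponents n) ℕ.+ length (lightExponents n))
      length-keys = trans (length-++ (map (0F ,_) (lightExponents n)))
        (cong₂ ℕ._+_ (length-map _ (lightExponents n)) (trans (length-++ (map (1F ,_) (lightExponents n)))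
        (cong₂ ℕ._+_ (length-map _ (lightExponents n)) (length-map _ (lightExponents n)))))

      direction : Fin (length keys) → Fin 3
      direction i = proj₁ (lookup keys i)

      exponents : Fin (length keys) → Exponents n
      exponents i = proj₂ (lookup keys i)

      CongAway : Fin 3 → (Index N → Scalar) → Set
      CongAway d g = ∀ {u v} → (∀ b → b ≢ d → u b ≡ v b) → g u ≡ g v

      record Sliced (f : Index N → Scalar) : Set where
        field
          cofactors : Fin (length keys) → Index N → Scalar
          cofactors-cong : ∀ i → CongAway (direction i) (cofactors i)
          expansion : ∀ u → f u ≡ sum (λ i → power (exponents i) (s (u (direction i))) * cofactors i u)

      open Sliced

      sliced-zero : ∀ {f} → (∀ u → f u ≡ 0#) → Sliced f
      sliced-zero f≡0 = record
        { cofactors = λ _ _ → 0#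
        ; cofactors-cong = λ _ _ → refl
        ; expansion = λ u → trans (f≡0 u) (sym (sum-zero {f = λ i → power (exponents i) (s (u (direction i))) * 0#}
                              (λ i → zeroʳ _)))
        }

      sliced-+ : ∀ {f g h} → Sliced g → Sliced h → (∀ u → f u ≡ g u + h u) → Sliced f
      sliced-+ S T f≡ = record
        { cofactors = λ i u → cofactors S i u + cofactors T i u
        ; cofactors-cong = λ i u≡v → cong₂ _+_ (cofactors-cong S i u≡v) (cofactors-cong T i u≡v)
        ; expansion = λ u → trans (f≡ u) (trans (cong₂ _+_ (expansion S u) (expansion T u))
            (sym (sum-*-distribˡ-+ (λ i → power (exponents i) (s (u (direction i))))
              (λ i → cofactors S i u) (λ i → cofactors T i u))))
        }

      sliced-single : ∀ {f d α} → (d , α) ∈ keys → ∀ g → CongAway d g →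
        (∀ u → f u ≡ power α (s (u d)) * g u) → Sliced f
      sliced-single {f} key∈ g g-cong f≡ = record
        { cofactors = λ i → pick (i ≟ᶠ i₀)
        ; cofactors-cong = λ i → pick-cong i (i ≟ᶠ i₀)
        ; expansion = λ u → trans (at-key u) (sym (trans
            (sum-single _ i₀ (λ i i≢i₀ → trans (cong (power (exponents i) (s (u (direction i))) *_)
              (pick-other u (i ≟ᶠ i₀) i≢i₀)) (zeroʳ _)))
            (cong (power (exponents i₀) (s (u (direction i₀))) *_) (pick-same u (i₀ ≟ᶠ i₀)))))
        }
        where
        i₀ = index key∈
        pick : ∀ {i} → Dec (i ≡ i₀) → Index N → Scalar
        pick (yes _) = g
        pick (no _)  = const 0#
        pick-cong : ∀ i (d : Dec (i ≡ i₀)) → CongAway (direction i) (pick d)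
        pick-cong i (yes refl) = subst (λ e → CongAway e g) (cong proj₁ (lookup-index key∈)) g-cong
        pick-cong i (no _) u≡v = refl
        pick-other : ∀ {i} u (d : Dec (i ≡ i₀)) → i ≢ i₀ → pick d u ≡ 0#
        pick-other u (yes eq) i≢i₀ = contradiction eq i≢i₀
        pick-other u (no _)   i≢i₀ = refl
        pick-same : ∀ u (d : Dec (i₀ ≡ i₀)) → pick d u ≡ g u
        pick-same u (yes _) = refl
        pick-same u (no ≢) = contradiction refl ≢
        at-key : ∀ u → f u ≡ power (exponents i₀) (s (u (direction i₀))) * g u
        at-key u = trans (f≡ u) (cong (λ k → power (proj₂ k) (s (u (proj₁ k))) * g u) (lookup-index key∈))

      -- A light vector among the three supplies the factor; the coefficient and the other two
      -- powers do not involve its direction and form the cofactor.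
      term-sliced : ∀ {f} → BalancedTerm f → Sliced (f ∘ (s ∘_))
      term-sliced {f} (c , α , β , γ , heavy , f≡) with some-light α β γ heavy
      ... | inj₁ light = sliced-single (∈-++⁺ˡ (∈-map⁺ _ (∈-lightExponents α light)))
        (λ u → c * (power β (s (u 1F)) * power γ (s (u 2F))))
        (λ u≡v → cong₂ (λ x y → c * (power β (s x) * power γ (s y))) (u≡v 1F λ ()) (u≡v 2F λ ()))
        (λ u → trans (f≡ (s ∘ u)) (solve 4 (λ c x y z → c :* (x :* (y :* z)) := x :* (c :* (y :* z))) refl _ _ _ _))
      ... | inj₂ (inj₁ light) = sliced-single
        (∈-++⁺ʳ (map (0F ,_) (lightExponents n)) (∈-++⁺ˡ (∈-map⁺ _ (∈-lightExponents β light))))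
        (λ u → c * (power α (s (u 0F)) * power γ (s (u 2F))))
        (λ u≡v → cong₂ (λ x y → c * (power α (s x) * power γ (s y))) (u≡v 0F λ ()) (u≡v 2F λ ()))
        (λ u → trans (f≡ (s ∘ u)) (solve 4 (λ c x y z → c :* (x :* (y :* z)) := y :* (c :* (x :* z))) refl _ _ _ _))
      ... | inj₂ (inj₂ light) = sliced-single
        (∈-++⁺ʳ (map (0F ,_) (lightExponents n))
          (∈-++⁺ʳ (map (1F ,_) (lightExponents n)) (∈-map⁺ _ (∈-lightExponents γ light))))
        (λ u → c * (power α (s (u 0F)) * power β (s (u 1F))))
        (λ u≡v → cong₂ (λ x y → c * (power α (s x) * power β (s y))) (u≡v 0F λ ()) (u≡v 1F λ ()))
        (λ u → trans (f≡ (s ∘ u)) (solve 4 (λ c x y z → c :* (x :* (y :* z)) := z :* (c :* (x :* y))) refl _ _ _ _))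

      sum-sliced : ∀ {f} → SumOf BalancedTerm f → Sliced (f ∘ (s ∘_))
      sum-sliced (nil f≡0) = sliced-zero (λ u → f≡0 (s ∘ u))
      sum-sliced (cons t S f≡) = sliced-+ (term-sliced t) (sum-sliced S) (λ u → f≡ (s ∘ u))

      total-tabulate : ∀ {r} (F : Fin r → Slice N) u → total (tabulate F) u ≡ sum (λ i → Slice.value (F i) u)
      total-tabulate {zero}  F u = refl
      total-tabulate {suc r} F u = cong (Slice.value (F zero) u +_) (total-tabulate (F ∘ suc) u)

    three-term-bound : ∀ a →
      (∀ u → NonConstant u → zero-test a (s ∘ u) ≡ 0#) → (∀ x → zero-test a (s ∘ const x) ≢ 0#) →
      N ℕ.≤ length (lightExponents n) ℕ.+ (length (lightExponents n) ℕ.+ length (lightExponents n))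
    three-term-bound a off-diagonal diagonal = subst (N ℕ.≤_) length-keys
      (diagonal-bound (length keys) (tabulate slice) (length-tabulate slice)
        (λ u nc → trans (sym (same u)) (off-diagonal u nc))
        (λ x → subst (_≢ 0#) (same (const x)) (diagonal x)))
      where
      S = sum-sliced (zero-test-sum n a)
      slice : Fin (length keys) → Slice N
      slice i = record
        { dir = direction i
        ; factor = power (exponents i) ∘ s
        ; cofactor = cofactors S i
        ; cofactor-cong = cofactors-cong S i
        }
      same : ∀ u → zero-test a (s ∘ u) ≡ total (tabulate slice) u
      same u = trans (expansion S u) (sym (total-tabulate slice u))

-- Forced configurations and their composition

module ForcedConfigurations (K : FinField) where
  open FieldLemmas K
  open Monomials K using (Point; 0F; 1F; 2F; Triple; linear; zero-test-zero; zero-test-nonzero)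
  open ExponentWeights (FinField.q-2 K) using (lightExponents; lightExponents-below)
  open ThreeTermBound K
  open Growth
  open import Data.Fin.Base using (punchIn; punchOut; inject≤)
  open import Data.Fin.Properties
    using (punchIn-injective; punchInᵢ≢i; punchIn-punchOut; punchOut-injective; suc-injective; inject≤-injective; any?; all?; ¬∀⟶∃¬)
    renaming (_≟_ to _≟ᶠ_)
  open import Data.List.Base using (length)
  open import Data.Nat.Base using (z≤n; s≤s; _∸_)
  open import Data.Product using (Σ-syntax; proj₁; proj₂)
  open import Data.Unit.Base using (⊤; tt)
  open import Data.Vec.Base using (lookup)
  open import Data.Vec.Properties using (tabulate∘lookup; tabulate-cong)
  open import Function.Base using (_∘_; const; id)
  open import Function.Definitions using (Injective)
  open import Relation.Binary.PropositionalEquality using (refl; sym; trans; cong; cong₂; module ≡-Reasoning)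
  open import Relation.Nullary using (Dec; yes; no; ¬?)
  open import Relation.Nullary.Decidable using (_×-dec_)
  open import Relation.Nullary.Negation using (contradiction)

  Relation : Set → Set₁
  Relation I = ∀ n → (I → Point n) → Set

  Inj : {A B : Set} → (A → B) → Set
  Inj = Injective _≡_ _≡_

  -- A set of points is an injective family, and a configuration is a family of indices into it.
  -- Distinctness is then injectivity of `x`, and restricting to subsets or composing searches is
  -- composition of index maps.
  record Forced (I : Set) (R : Relation I) : Set where
    field
      threshold : ℕ → ℕ
      below : GrowsBelow q threshold
      find : ∀ {n} (s : Fin (threshold n) → Point n) → Inj s →
        Σ[ x ∈ (I → Fin (threshold n)) ] (Inj x × R n (s ∘ x))

  open Forced

  Equation : ∀ {k} → (Fin k → Scalar) → Relation (Fin k)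
  Equation a n x = ∀ t → sum (λ j → a j * lookup (x j) t) ≡ 0#

  point-ext : ∀ {n} {x y : Point n} → (∀ t → lookup x t ≡ lookup y t) → x ≡ y
  point-ext {x = x} {y} eq = trans (sym (tabulate∘lookup x)) (trans (tabulate-cong eq) (tabulate∘lookup y))

  forced-free : ∀ k → Forced (Fin k) (λ n x → ⊤)
  forced-free k = record
    { threshold = const k
    ; below = below-const (s≤s (s≤s z≤n)) k
    ; find = λ s s-inj → id , id , tt
    }

  -- As `e` need not be surjective, auxiliary points such as centres and merged variables can be
  -- forgotten.
  reindex : ∀ {I J} {R : Relation I} {R′ : Relation J} (e : J → I) → Inj e →
    (∀ {n x} → R n x → R′ n (x ∘ e)) → Forced I R → Forced J R′
  reindex e e-inj R⇒R′ F = record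
    { threshold = threshold F
    ; below = below F
    ; find = λ s s-inj → let x , x-inj , r = find F s s-inj in
        x ∘ e , e-inj ∘ x-inj , R⇒R′ r
    }

  private
    complement : ∀ {k M} (e : Fin k → Fin M) → Inj e →
      Σ[ g ∈ (Fin (M ∸ k) → Fin M) ] (Inj g × (∀ i j → g i ≢ e j))
    complement {zero}  {M}     e e-inj = id , id , λ _ ()
    complement {suc k} {zero}  e e-inj with () ← e zero
    complement {suc k} {suc M} e e-inj = punchIn (e zero) ∘ g , g-inj ∘ punchIn-injective (e zero) _ _ , avoid
      where
      e₀≢ : ∀ j → e zero ≢ e (suc j)
      e₀≢ j eq with () ← e-inj eq
      rest = complement (λ j → punchOut (e₀≢ j))
        (λ {i} {j} eq → suc-injective (e-inj (punchOut-injective (e₀≢ i) (e₀≢ j) eq)))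
      g = proj₁ rest
      g-inj = proj₁ (proj₂ rest)
      avoid : ∀ i j → punchIn (e zero) (g i) ≢ e j
      avoid i zero    = punchInᵢ≢i (e zero) (g i)
      avoid i (suc j) eq = proj₂ (proj₂ rest) i j
        (punchIn-injective (e zero) _ _ (trans eq (sym (punchIn-punchOut (e₀≢ j)))))

    -- Greedy choice: each copy uses up k points, and as long as `threshold F n` points are left,
    -- there is another copy among them.
    disjoint-copies : ∀ {k} {R : Relation (Fin k)} (F : Forced (Fin k) R) t {M n} (s : Fin M → Point n) → Inj s →
      t ℕ.* k ℕ.+ threshold F n ℕ.≤ M →
      Σ[ y ∈ (Fin t → Fin k → Fin M) ]
        ((∀ {a b a′ b′} → y a b ≡ y a′ b′ → a ≡ a′ × b ≡ b′) × (∀ a → R n (s ∘ y a)))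
    disjoint-copies F zero s s-inj le = (λ ()) , (λ { {()} }) , λ ()
    disjoint-copies {k} {R} F (suc t) {M} {n} s s-inj le = y , y-inj , y-R
      where
      enough : threshold F n ℕ.≤ M
      enough = ℕ.≤-trans (ℕ.m≤n+m _ (suc t ℕ.* k)) le
      first = find F (λ i → s (inject≤ i enough)) (λ eq → inject≤-injective enough enough _ _ (s-inj eq))
      x : Fin k → Fin M
      x i = inject≤ (proj₁ first i) enough
      x-inj : Inj x
      x-inj eq = proj₁ (proj₂ first) (inject≤-injective enough enough _ _ eq)
      others = complement x x-inj
      g = proj₁ others
      rest = disjoint-copies F t (s ∘ g) (λ eq → proj₁ (proj₂ others) (s-inj eq))
        (ℕ.m+n≤o⇒m≤o∸n (t ℕ.* k ℕ.+ threshold F n) (ℕ.≤-trans (ℕ.≤-reflexive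
          (trans (ℕ.+-comm (t ℕ.* k ℕ.+ threshold F n) k) (sym (ℕ.+-assoc k _ _)))) le))
      z = proj₁ rest
      y : Fin (suc t) → Fin k → Fin M
      y zero    b = x b
      y (suc a) b = g (z a b)
      y-inj : ∀ {a b a′ b′} → y a b ≡ y a′ b′ → a ≡ a′ × b ≡ b′
      y-inj {zero}  {b} {zero}   eq = refl , x-inj eq
      y-inj {zero}  {b} {suc a′} eq = contradiction (sym eq) (proj₂ (proj₂ others) _ b)
      y-inj {suc a} {b} {zero} {b′} eq = contradiction eq (proj₂ (proj₂ others) _ b′)
      y-inj {suc a} {b} {suc a′} eq =
        let a≡a′ , b≡b′ = proj₁ (proj₂ rest) (proj₁ (proj₂ others) eq) in cong suc a≡a′ , b≡b′
      y-R : ∀ a → R n (s ∘ y a)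
      y-R zero    = proj₂ (proj₂ first)
      y-R (suc a) = proj₂ (proj₂ rest) a

  -- Find many disjoint copies of the first configuration, and then the second
  -- configuration among their i₀-th points.
  star : ∀ {k J} {R : Relation (Fin k)} {R′ : Relation J} → Forced (Fin k) R → (i₀ : Fin k) → Forced J R′ →
    Forced (J × Fin k) (λ n x → R′ n (λ j → x (j , i₀)) × (∀ j → R n (λ i → x (j , i))))
  star {k} {J} F i₀ G = record
    { threshold = λ n → threshold G n ℕ.* k ℕ.+ threshold F n
    ; below = below-+ (below-* k (below G)) (below F)
    ; find = λ {n} s s-inj →
        let y , y-inj , y-R = disjoint-copies F (threshold G n) s s-inj ℕ.≤-refl
            x , x-inj , r = find G (λ a → s (y a i₀)) (λ eq → proj₁ (y-inj (s-inj eq)))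
        in (λ (j , i) → y (x j) i) ,
           (λ eq → cong₂ _,_ (x-inj (proj₁ (y-inj eq))) (proj₂ (y-inj eq))) ,
           r , λ j → y-R (x j)
    }

  vec3 : {A : Set} → A → A → A → Triple A
  vec3 x y z zero = x
  vec3 x y z (suc zero) = y
  vec3 x y z (suc (suc zero)) = z

  vec3-injective : {A : Set} {x y z : A} → x ≢ y → x ≢ z → y ≢ z → Inj (vec3 x y z)
  vec3-injective x≢y x≢z y≢z {0F} {0F} eq = refl
  vec3-injective x≢y x≢z y≢z {0F} {1F} eq = contradiction eq x≢y
  vec3-injective x≢y x≢z y≢z {0F} {2F} eq = contradiction eq x≢z
  vec3-injective x≢y x≢z y≢z {1F} {0F} eq = contradiction (sym eq) x≢y
  vec3-injective x≢y x≢z y≢z {1F} {1F} eq = refl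
  vec3-injective x≢y x≢z y≢z {1F} {2F} eq = contradiction eq y≢z
  vec3-injective x≢y x≢z y≢z {2F} {0F} eq = contradiction (sym eq) x≢z
  vec3-injective x≢y x≢z y≢z {2F} {1F} eq = contradiction (sym eq) y≢z
  vec3-injective x≢y x≢z y≢z {2F} {2F} eq = refl

  -- As no coefficient vanishes and their sum does, two equal points of a solution force the third
  -- to be equal as well. So a non-constant solution has distinct points, and if an exhaustive
  -- search finds none, the zero test is a diagonal tensor with nonzero diagonal.
  three-terms : (a : Triple Scalar) → (∀ i → a i ≢ 0#) → sum a ≡ 0# → Forced (Fin 3) (Equation a)
  three-terms a a≢0 sum≡0 = record
    -- One point more than the number of slices in `three-term-bound`, which is the contradiction.
    { threshold = λ n → 1 ℕ.+ (L n ℕ.+ (L n ℕ.+ L n))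
    ; below = below-+ (below-const (s≤s (s≤s z≤n)) 1) (below-+ lightExponents-below
        (below-+ lightExponents-below lightExponents-below))
    ; find = search
    }
    where
    L : ℕ → ℕ
    L n = length (lightExponents n)
    open ≡-Reasoning

    cancel : ∀ {a b c x z} → c ≢ 0# → a + b + c ≡ 0# → a * x + b * x + c * z ≡ 0# → z ≡ x
    cancel {a} {b} {c} {x} {z} c≢0 abc eq = difference-zero (zero-product c≢0 (begin
      c * (z - x)                                          ≡⟨ solve 5 (λ a b c x z →
        c :* (z :- x) := (a :* x :+ b :* x :+ c :* z) :- (a :+ b :+ c) :* x) refl a b c x z ⟩
      a * x + b * x + c * z - (a + b + c) * x              ≡⟨ cong₂ (λ y w → y - w * x) eq abc ⟩
      0# - 0# * x                                          ≡⟨ solve 1 (λ x → :0 :- :0 :* x := :0) refl x ⟩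
      0#                                                   ∎))

    module _ {n} (s : Fin (1 ℕ.+ (L n ℕ.+ (L n ℕ.+ L n))) → Point n) (s-inj : Inj s) where
      Index = Fin (1 ℕ.+ (L n ℕ.+ (L n ℕ.+ L n)))

      Solution : Index → Index → Index → Set
      Solution i j k = ∀ t → a 0F * lookup (s i) t + (a 1F * lookup (s j) t + a 2F * lookup (s k) t) ≡ 0#

      solution? : ∀ i j k → Dec (Solution i j k)
      solution? i j k = all? (λ t → _ ≟ᶠ 0#)

      abc : a 0F + a 1F + a 2F ≡ 0#
      abc = trans (solve 3 (λ a b c → a :+ b :+ c := a :+ (b :+ (c :+ :0))) refl _ _ _) sum≡0

      merge01 : ∀ {i k} → Solution i i k → i ≡ k
      merge01 sol = s-inj (point-ext λ t → sym (cancel (a≢0 2F) abc (trans (+-assoc _ _ _) (sol t))))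

      merge02 : ∀ {i j} → Solution i j i → i ≡ j
      merge02 sol = s-inj (point-ext λ t → sym (cancel (a≢0 1F)
        (trans (solve 3 (λ a b c → a :+ c :+ b := a :+ b :+ c) refl _ _ _) abc)
        (trans (solve 3 (λ a b c → a :+ c :+ b := a :+ (b :+ c)) refl _ _ _) (sol t))))

      merge12 : ∀ {i j} → Solution i j j → i ≡ j
      merge12 sol = s-inj (point-ext λ t → cancel (a≢0 0F)
        (trans (solve 3 (λ a b c → b :+ c :+ a := a :+ b :+ c) refl _ _ _) abc)
        (trans (solve 3 (λ a b c → b :+ c :+ a := a :+ (b :+ c)) refl _ _ _) (sol t)))

      search : Σ[ x ∈ (Fin 3 → Index) ] (Inj x × Equation a n (s ∘ x))
      search with any? (λ i → any? λ j → any? λ k → solution? i j k ×-dec ¬? ((i ≟ᶠ j) ×-dec (j ≟ᶠ k)))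
      ... | yes (i , j , k , sol , distinct) = vec3 i j k ,
        vec3-injective
          (λ { refl → distinct (refl , merge01 sol) })
          (λ { refl → distinct (merge02 sol , sym (merge02 sol)) })
          (λ { refl → distinct (merge12 sol , refl) }) ,
        λ t → trans (solve 3 (λ a b c → a :+ (b :+ (c :+ :0)) := a :+ (b :+ c)) refl _ _ _) (sol t)
      ... | no none = contradiction (three-term-bound s a
          (λ u nc → let t , ≢0 = ¬∀⟶∃¬ n _ (λ t → _ ≟ᶠ 0#) (λ sol →
                               none (u 0F , u 1F , u 2F , sol , constant u nc))
                    in zero-test-zero a (s ∘ u) t ≢0)
          (λ x → zero-test-nonzero a _ (λ t → diagonal x t)))
        (ℕ.<⇒≱ ℕ.≤-refl)
        where
        constant : ∀ (u : Fin 3 → Index) → ∃[ b ] ∃[ c ] (u b ≢ u c) → ¬ (u 0F ≡ u 1F × u 1F ≡ u 2F)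
        constant u (b , c , ub≢uc) (eq , eq′) = ub≢uc (trans (at b) (sym (at c)))
          where
          at : ∀ b → u b ≡ u 0F
          at 0F = refl
          at 1F = sym eq
          at 2F = sym (trans eq eq′)
        diagonal : ∀ x t → linear a (λ b → lookup (s x) t) ≡ 0#
        diagonal x t = begin
          a 0F * y + (a 1F * y + a 2F * y)  ≡⟨ solve 4 (λ a b c y → a :* y :+ (b :* y :+ c :* y) := (a :+ b :+ c) :* y)
                                                 refl (a 0F) (a 1F) (a 2F) y ⟩
          (a 0F + a 1F + a 2F) * y          ≡⟨ cong (_* y) abc ⟩
          0# * y                            ≡⟨ zeroˡ y ⟩
          0#                                ∎
          where y = lookup (s x) t

-- Differences in the kernel of a matrix, by the pigeonhole principle

-- M grows at the rate P / l = q - 1/l, and (q - 1/l)^l ≥ q^(l-1) by Bernoulli.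
module PigeonholeRate (q-2 l-1 : ℕ) where
  open import Data.Nat.Base using (_+_; _*_; _^_; _≤_; _<_; z≤n; s≤s; NonZero; _/_; _%_)
  open import Data.Nat.DivMod using (m≡m%n+[m/n]*n; m%n<n; m/n*n≤m)
  open import Data.Nat.Solver using (module +-*-Solver)
  open import Relation.Binary.PropositionalEquality using (refl; sym; trans; cong; cong₂)
  open +-*-Solver using (solve; _:=_; _:*_; _:+_; con)
  open Growth {suc (suc q-2)} using (^-distribʳ-*)
  open ℕ.≤-Reasoning

  l p q P : ℕ
  l = suc l-1
  p = suc q-2
  q = suc p
  P = l-1 + p * l

  private
    module Division (n : ℕ) where
      instance
        l^n-nonZero : NonZero (l ^ n)
        l^n-nonZero = ℕ.m^n≢0 l n

      floor : ℕ
      floor = l * P ^ n / l ^ n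

      floor-≤ : floor * l ^ n ≤ l * P ^ n
      floor-≤ = m/n*n≤m (l * P ^ n) (l ^ n)

      floor-> : l * P ^ n < suc floor * l ^ n
      floor-> = begin-strict
        l * P ^ n                            ≡⟨ m≡m%n+[m/n]*n (l * P ^ n) (l ^ n) ⟩
        l * P ^ n % l ^ n + floor * l ^ n    <⟨ ℕ.+-monoˡ-< (floor * l ^ n) (m%n<n (l * P ^ n) (l ^ n)) ⟩
        suc floor * l ^ n                    ∎

  -- The least integer exceeding l (P / l)^n. The leading factor l becomes l^l in the number of
  -- tuples and thereby absorbs the factor l in the number of codes.
  M : ℕ → ℕ
  M n = suc (Division.floor n)

  l≤P : l ≤ P
  l≤P = ℕ.≤-trans (ℕ.m≤m+n l (q-2 * l)) (ℕ.m≤n+m (p * l) l-1)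

  M-below : GrowsBelow q M
  M-below = record
    { P = P ; Q = l ; B = 1 + l
    ; 0<Q = s≤s z≤n
    ; Q≤P = l≤P
    ; P<qQ = ℕ.≤-refl
    ; bound = λ n → begin
        l ^ n + Division.floor n * l ^ n    ≤⟨ ℕ.+-mono-≤ (ℕ.^-monoˡ-≤ n l≤P) (Division.floor-≤ n) ⟩
        P ^ n + l * P ^ n                   ∎
    }

  -- Bernoulli's inequality for the power of 1 - 1/(y + 1) with exponent k + 1, multiplied out so
  -- that no subtraction occurs.
  bernoulli : ∀ y k → suc y ^ suc k ≤ y ^ suc k + suc k * suc y ^ k
  bernoulli y zero = ℕ.≤-reflexive (solve 1 (λ y → (con 1 :+ y) :* con 1 := y :* con 1 :+ con 1) refl y)
  bernoulli y (suc k) = begin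
    suc y * suc y ^ suc k                                     ≡⟨⟩
    suc y ^ suc k + y * suc y ^ suc k                         ≤⟨ ℕ.+-monoʳ-≤ _ (ℕ.*-monoʳ-≤ y (bernoulli y k)) ⟩
    suc y ^ suc k + y * (y ^ suc k + suc k * suc y ^ k)       ≡⟨ cong (suc y ^ suc k +_) (ℕ.*-distribˡ-+ y (y ^ suc k) _) ⟩
    suc y ^ suc k + (y ^ suc (suc k) + y * (suc k * suc y ^ k)) ≤⟨ ℕ.+-monoʳ-≤ (suc y ^ suc k) (ℕ.+-monoʳ-≤ (y ^ suc (suc k))
                                                                   step) ⟩
    suc y ^ suc k + (y ^ suc (suc k) + suc k * suc y ^ suc k) ≡⟨ solve 3 (λ a b c → a :+ (b :+ c) := b :+ (a :+ c)) refl
                                                                   (suc y ^ suc k) (y ^ suc (suc k)) _ ⟩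
    y ^ suc (suc k) + suc (suc k) * suc y ^ suc k             ∎
    where
    step : y * (suc k * suc y ^ k) ≤ suc k * suc y ^ suc k
    step = ℕ.≤-trans (ℕ.≤-reflexive (solve 3 (λ y s e → y :* (s :* e) := s :* (y :* e)) refl y (suc k) (suc y ^ k)))
      (ℕ.*-monoʳ-≤ (suc k) (ℕ.*-monoˡ-≤ (suc y ^ k) (ℕ.n≤1+n y)))

  -- With P + 1 = q l, both the left side and the loss in Bernoulli's inequality equal l (P +
  -- 1)^(l-1), and (P + 1)^l is at least twice this because q ≥ 2.
  rate : l ^ l * q ^ l-1 ≤ P ^ l
  rate = ℕ.+-cancelʳ-≤ (l * suc P ^ l-1) _ _ (begin
    l ^ l * q ^ l-1 + l * suc P ^ l-1        ≡⟨ cong (_+ l * suc P ^ l-1) product ⟩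
    l * suc P ^ l-1 + l * suc P ^ l-1        ≡⟨ solve 2 (λ l e → l :* e :+ l :* e := con 2 :* l :* e) refl l (suc P ^ l-1) ⟩
    2 * l * suc P ^ l-1                      ≤⟨ ℕ.*-monoˡ-≤ (suc P ^ l-1) (ℕ.*-monoˡ-≤ l (s≤s (s≤s (z≤n {q-2})))) ⟩
    suc P ^ l                                ≤⟨ bernoulli P l-1 ⟩
    P ^ l + l * suc P ^ l-1                  ∎)
    where
    product : l ^ l * q ^ l-1 ≡ l * suc P ^ l-1
    product = trans (ℕ.*-assoc l (l ^ l-1) (q ^ l-1)) (cong (l *_)
      (trans (ℕ.*-comm (l ^ l-1) (q ^ l-1)) (sym (^-distribʳ-* q l l-1))))

  -- The input of the pigeonhole principle: the right side counts tuples, and the left side counts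
  -- codes, which consist of one of l coordinates and l - 1 vectors over the field.
  tuples-exceed : ∀ n → l * (q ^ n) ^ l-1 < M n ^ l
  tuples-exceed n = ℕ.*-cancelʳ-< ((l ^ n) ^ l) _ _ (begin-strict
    l * (q ^ n) ^ l-1 * (l ^ n) ^ l           ≡⟨ ℕ.*-assoc l ((q ^ n) ^ l-1) ((l ^ n) ^ l) ⟩
    l * ((q ^ n) ^ l-1 * (l ^ n) ^ l)         ≡⟨ cong (l *_) (cong₂ _*_ (swap q l-1) (swap l l)) ⟩
    l * ((q ^ l-1) ^ n * (l ^ l) ^ n)         ≡⟨ cong (l *_) (trans (ℕ.*-comm ((q ^ l-1) ^ n) ((l ^ l) ^ n)) (sym (^-distribʳ-* (l ^ l) (q ^ l-1) n))) ⟩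
    l * (l ^ l * q ^ l-1) ^ n                 ≤⟨ ℕ.*-mono-≤ (ℕ.≤-trans (ℕ.≤-reflexive (sym (ℕ.*-identityʳ l)))
                                                    (ℕ.*-monoʳ-≤ l (ℕ.m^n>0 l l-1))) (ℕ.^-monoˡ-≤ n rate) ⟩
    l ^ l * (P ^ l) ^ n                       ≡⟨ cong (l ^ l *_) (sym (swap P l)) ⟩
    l ^ l * (P ^ n) ^ l                       ≡⟨ sym (^-distribʳ-* l (P ^ n) l) ⟩
    (l * P ^ n) ^ l                           <⟨ ℕ.^-monoˡ-< l (Division.floor-> n) ⟩
    (M n * l ^ n) ^ l                         ≡⟨ ^-distribʳ-* (M n) (l ^ n) l ⟩
    M n ^ l * (l ^ n) ^ l                     ∎)
    where
    swap : ∀ a k → (a ^ n) ^ k ≡ (a ^ k) ^ n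
    swap a k = trans (ℕ.^-*-assoc a n k) (trans (cong (a ^_) (ℕ.*-comm n k)) (sym (ℕ.^-*-assoc a k n)))

module Differences (K : FinField) where
  open FieldLemmas K
  open Monomials K using (Point)
  open ForcedConfigurations K
  open Growth
  open import Data.Bool.Base using (Bool; true; false)
  open import Data.Fin.Base using (combine; finToFun; funToFin; punchIn; punchOut)
  open import Data.Fin.Properties
    using (combine-injective; funToFin-finToFin; finToFun-funToFin; punchIn-punchOut; pigeonhole; any?; all?; ¬∀⟶∃¬; <⇒≢)
    renaming (_≟_ to _≟ᶠ_)
  open import Data.Product using (Σ-syntax; proj₁; proj₂)
  import Data.Vec.Base as Vec
  open Vec using (lookup; tabulate)
  open import Data.Vec.Properties using (tabulate-cong; ≡-dec; lookup∘tabulate)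
  open import Function.Base using (_∘_)
  open import Relation.Binary.PropositionalEquality using (refl; sym; trans; cong; cong₂; subst; module ≡-Reasoning)
  open import Relation.Nullary using (Dec; yes; no; ¬?)
  open import Relation.Nullary.Decidable using (_×-dec_; decidable-stable)
  open import Relation.Nullary.Negation using (contradiction)

  funToFin-cong : ∀ {m n} {f g : Fin m → Fin n} → (∀ i → f i ≡ g i) → funToFin f ≡ funToFin g
  funToFin-cong {zero}  f≡g = refl
  funToFin-cong {suc m} f≡g = cong₂ combine (f≡g zero) (funToFin-cong (f≡g ∘ suc))

  finToFun-injective : ∀ {m n} {a b : Fin (m ℕ.^ n)} → (∀ i → finToFun {m} {n} a i ≡ finToFun b i) → a ≡ b
  finToFun-injective {m} {n} {a} {b} eq = trans (sym (funToFin-finToFin {n} {m} a))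
    (trans (funToFin-cong eq) (funToFin-finToFin {n} {m} b))

  funToFin-injective : ∀ {m n} {f g : Fin m → Fin n} → funToFin f ≡ funToFin g → ∀ i → f i ≡ g i
  funToFin-injective {f = f} {g} eq i = trans (sym (finToFun-funToFin f i))
    (trans (cong (λ e → finToFun e i) eq) (finToFun-funToFin g i))

  private
    difference-product : ∀ v x y → v * (x - y) ≡ v * x + - 1# * (v * y)
    difference-product = solve 3 (λ v x y → v :* (x :- y) := v :* x :+ :- :1 :* (v :* y)) refl

    reduction-product : ∀ v x s y → v * (x - s * y) ≡ v * x + - y * (v * s)
    reduction-product = solve 4 (λ v x s y → v :* (x :- s :* y) := v :* x :+ (:- y) :* (v :* s)) refl

    minus-self : ∀ x → x + - 1# * x ≡ 0#
    minus-self = solve 1 (λ x → x :+ :- :1 :* x := :0) refl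

    minus-unit-multiple : ∀ x → x - 1# * x ≡ 0#
    minus-unit-multiple = solve 1 (λ x → x :- :1 :* x := :0) refl

    plus-zero-multiple : ∀ x y → x + - y * 0# ≡ x
    plus-zero-multiple = solve 2 (λ x y → x :+ (:- y) :* :0 := x) refl

    minus-plus : ∀ x y → x - y + y ≡ x
    minus-plus = solve 2 (λ x y → (x :- y) :+ y := x) refl

  DifferenceEquations : ∀ {m l} → (Fin m → Fin l → Scalar) → Relation (Fin l × Bool)
  DifferenceEquations V n x = ∀ i t →
    sum (λ j → V i j * (lookup (x (j , false)) t - lookup (x (j , true)) t)) ≡ 0#

  module _ {m l-1 : ℕ} (V : Fin m → Fin (suc l-1) → Scalar) (σ : Fin (suc l-1) → Fin (suc l-1) → Scalar)
           (σ-kernel : ∀ c i → sum (λ j → V i j * σ c j) ≡ 0#) (σ-diagonal : ∀ c → σ c c ≡ 1#) where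

    private
      l : ℕ
      l = suc l-1

    -- A tuple in (K^n)^l is determined by its image under V, on which a
    -- representative depends, a coordinate c in which it agrees with that
    -- representative, and the entries other than c of its reduction by a multiple
    -- of σ c, which leaves the image under V unchanged. Hence if there are too many
    -- tuples, then some tuple differs in all coordinates from one with the same image.
    module _ {n M} (exceed : l ℕ.* (q ℕ.^ n) ℕ.^ l-1 ℕ.< M ℕ.^ l) (s : Fin (M ℕ.* l) → Point n) (s-inj : Inj s) where
      private
        Tuple = Fin (M ℕ.^ l)

        entry : Tuple → Fin l → Fin (M)
        entry = finToFun

        -- The M · l points are divided into l blocks of M points, and the j-th entry of a tuple is
        -- taken from block j. Points for different j are therefore distinct, and only the two
        -- points for the same j have to be kept apart.
        coordinate : Tuple → Fin l → Fin n → Scalar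
        coordinate a j t = lookup (s (combine (entry a j) j)) t

        image : Tuple → Fin m → Fin n → Scalar
        image a i t = sum (λ j → V i j * coordinate a j t)

        imageVec : Tuple → Vec.Vec (Point n) m
        imageVec a = tabulate (λ i → tabulate (image a i))

        imageVec-injective : ∀ {a b} → imageVec a ≡ imageVec b → ∀ i t → image a i t ≡ image b i t
        imageVec-injective {a} {b} eq i t = trans (sym (at a)) (trans (cong (λ v → lookup (lookup v i) t) eq) (at b))
          where
          at : ∀ a → lookup (lookup (imageVec a) i) t ≡ image a i t
          at a = trans (cong (λ v → lookup v t) (lookup∘tabulate (λ i → tabulate (image a i)) i))
                       (lookup∘tabulate (image a i) t)

        _≟ᵛ_ : (v w : Vec.Vec (Point n) m) → Dec (v ≡ w)
        _≟ᵛ_ = ≡-dec (≡-dec _≟ᶠ_)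

        Apart : Tuple → Tuple → Set
        Apart a b = ∀ c → entry a c ≢ entry b c

        apart? : ∀ a b → Dec (Apart a b)
        apart? a b = all? (λ c → ¬? (entry a c ≟ᶠ entry b c))

        module _ (a b : Tuple) (same : imageVec a ≡ imageVec b) (apart : Apart a b) where
          chosen : Bool → Tuple
          chosen false = a
          chosen true  = b

          solution : Fin l × Bool → Fin (M ℕ.* l)
          solution (j , β) = combine (entry (chosen β) j) j

          solution-injective : Inj solution
          solution-injective {j , β} {j′ , β′} eq with combine-injective (entry (chosen β) j) j (entry (chosen β′) j′) j′ eq
          ... | e , refl = cong (j ,_) (same-side β β′ e)
            where
            same-side : ∀ β β′ → entry (chosen β) j ≡ entry (chosen β′) j → β ≡ β′
            same-side false false e = refl
            same-side false true  e = contradiction e (apart j)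
            same-side true  false e = contradiction (sym e) (apart j)
            same-side true  true  e = refl

          solves : DifferenceEquations V n (s ∘ solution)
          solves i t = begin
            sum (λ j → V i j * (coordinate a j t - coordinate b j t))
              ≡⟨ sum-cong-≗ {l} (λ j → difference-product (V i j) (coordinate a j t) (coordinate b j t)) ⟩
            sum (λ j → V i j * coordinate a j t + - 1# * (V i j * coordinate b j t))
              ≡⟨ ∑-distrib-+ (λ j → V i j * coordinate a j t) (λ j → - 1# * (V i j * coordinate b j t)) ⟩
            image a i t + sum (λ j → - 1# * (V i j * coordinate b j t))
              ≡⟨ cong₂ _+_ (imageVec-injective {a} {b} same i t) (sym (*-distribˡ-sum (- 1#) (λ j → V i j * coordinate b j t))) ⟩
            image b i t + - 1# * image b i t
              ≡⟨ minus-self (image b i t) ⟩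
            0# ∎
            where open ≡-Reasoning

        module _ (none : ∀ a b → imageVec a ≡ imageVec b → ¬ Apart a b) where

          choose : ∀ w → Dec (∃[ b ] (imageVec b ≡ w)) → Tuple → Tuple
          choose w (yes (b , _)) a = b
          choose w (no _)        a = a

          -- The search depends on the image alone, so that tuples with equal images get the same
          -- representative. The tuple itself is only the default for a `w` that is not an image.
          representative : Vec.Vec (Point n) m → Tuple → Tuple
          representative w = choose w (any? (λ b → imageVec b ≟ᵛ w))

          representative-image : ∀ {w a} → imageVec a ≡ w → imageVec (representative w a) ≡ w
          representative-image {w} eq with any? (λ b → imageVec b ≟ᵛ w)
          ... | yes (b , eq′) = eq′
          ... | no _ = eq

          representative-unique : ∀ {w a b} → imageVec a ≡ w → representative w a ≡ representative w b
          representative-unique {w} {a} eq with any? (λ b → imageVec b ≟ᵛ w)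
          ... | yes _ = refl
          ... | no ∄ = contradiction (a , eq) ∄

          agreement : ∀ a → ∃[ c ] (entry a c ≡ entry (representative (imageVec a) a) c)
          agreement a = let c , ≢ = ¬∀⟶∃¬ l _ (λ c → ¬? (_ ≟ᶠ _))
                              (none a (representative (imageVec a) a) (sym (representative-image refl)))
                        in c , decidable-stable (_ ≟ᶠ _) ≢

          reduction : Fin l → Tuple → Fin l → Fin n → Scalar
          reduction c a j t = coordinate a j t - σ c j * coordinate a c t

          reduction-image : ∀ c a i t → image a i t ≡ sum (λ j → V i j * reduction c a j t)
          reduction-image c a i t = sym (begin
            sum (λ j → V i j * reduction c a j t)
              ≡⟨ sum-cong-≗ {l} (λ j → reduction-product (V i j) (coordinate a j t) (σ c j) y) ⟩
            sum (λ j → V i j * coordinate a j t + - y * (V i j * σ c j))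
              ≡⟨ ∑-distrib-+ (λ j → V i j * coordinate a j t) (λ j → - y * (V i j * σ c j)) ⟩
            image a i t + sum (λ j → - y * (V i j * σ c j))
              ≡⟨ cong (image a i t +_) (sym (*-distribˡ-sum (- y) (λ j → V i j * σ c j))) ⟩
            image a i t + - y * sum (λ j → V i j * σ c j)
              ≡⟨ cong (λ z → image a i t + - y * z) (σ-kernel c i) ⟩
            image a i t + - y * 0#
              ≡⟨ plus-zero-multiple (image a i t) y ⟩
            image a i t ∎)
            where
            open ≡-Reasoning
            y = coordinate a c t

          reductionCode : Fin l → Tuple → Fin ((q ℕ.^ n) ℕ.^ l-1)
          reductionCode c a = funToFin (λ j → funToFin (reduction c a (punchIn c j)))

          reductionCode-injective : ∀ {c a b} → reductionCode c a ≡ reductionCode c b →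
            ∀ j t → reduction c a j t ≡ reduction c b j t
          reductionCode-injective {c} {a} {b} eq j t with c ≟ᶠ j
          ... | yes refl = trans (vanish a) (sym (vanish b))
            where
            vanish : ∀ a → reduction c a c t ≡ 0#
            vanish a = trans (cong (λ z → coordinate a c t - z * coordinate a c t) (σ-diagonal c))
              (minus-unit-multiple (coordinate a c t))
          ... | no c≢j = subst (λ j → reduction c a j t ≡ reduction c b j t) (punchIn-punchOut c≢j)
            (funToFin-injective (funToFin-injective eq (punchOut c≢j)) t)

          code : Tuple → Fin (l ℕ.* (q ℕ.^ n) ℕ.^ l-1)
          code a = combine (proj₁ (agreement a)) (reductionCode (proj₁ (agreement a)) a)

          code-injective : ∀ {a b} → code a ≡ code b → a ≡ b
          code-injective {a} {b} eq = finToFun-injective {M} {l} same-entry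
            where
            c c′ : Fin l
            c = proj₁ (agreement a)
            c′ = proj₁ (agreement b)
            parts : c ≡ c′ × reductionCode c a ≡ reductionCode c′ b
            parts = combine-injective c (reductionCode c a) c′ (reductionCode c′ b) eq
            c≡ : c ≡ c′
            c≡ = proj₁ parts
            same-reduction : ∀ j t → reduction c a j t ≡ reduction c b j t
            same-reduction = reductionCode-injective {c} {a} {b}
              (trans (proj₂ parts) (cong (λ c → reductionCode c b) (sym c≡)))
            same-image : imageVec a ≡ imageVec b
            same-image = tabulate-cong λ i → tabulate-cong λ t → trans (reduction-image c a i t)
              (trans (sum-cong-≗ {l} (λ j → cong (V i j *_) (same-reduction j t))) (sym (reduction-image c b i t)))
            same-representative : representative (imageVec a) a ≡ representative (imageVec b) b
            same-representative = trans (representative-unique {imageVec a} {a} {b} refl) (cong (λ w → representative w b) same-image)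
            -- Both tuples agree at `c` with the same representative, hence with each other; this
            -- recovers the multiple of `σ c` that the reduction has removed.
            same-at-c : entry a c ≡ entry b c
            same-at-c = trans (proj₂ (agreement a)) (trans (cong (λ r → entry r c) same-representative)
              (sym (subst (λ c → entry b c ≡ entry (representative (imageVec b) b) c) (sym c≡) (proj₂ (agreement b)))))
            same-coordinate : ∀ j t → coordinate a j t ≡ coordinate b j t
            same-coordinate j t = trans (sym (minus-plus (coordinate a j t) (σ c j * coordinate a c t)))
              (trans (cong₂ _+_ (same-reduction j t)
                (cong (λ e → σ c j * lookup (s (combine e c)) t) same-at-c))
              (minus-plus (coordinate b j t) (σ c j * coordinate b c t)))
            same-entry : ∀ j → entry a j ≡ entry b j
            same-entry j = proj₁ (combine-injective (entry a j) j (entry b j) j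
              (s-inj (point-ext (same-coordinate j))))

      differences-find : Σ[ x ∈ (Fin l × Bool → Fin (M ℕ.* l)) ] (Inj x × DifferenceEquations V n (s ∘ x))
      differences-find = conclude (any? (λ a → any? λ b → (imageVec a ≟ᵛ imageVec b) ×-dec apart? a b))
        where
        conclude : Dec (∃[ a ] ∃[ b ] (imageVec a ≡ imageVec b × Apart a b)) →
          Σ[ x ∈ (Fin l × Bool → Fin (M ℕ.* l)) ] (Inj x × DifferenceEquations V n (s ∘ x))
        conclude (yes (a , b , same , apart)) =
          solution a b same apart , solution-injective a b same apart , solves a b same apart
        conclude (no none) =
          let none′ = λ a b same apart → none (a , b , same , apart)
              a , b , a<b , eq = pigeonhole exceed (code none′)
          in contradiction (code-injective none′ eq) (<⇒≢ a<b)

    open PigeonholeRate (FinField.q-2 K) l-1 using (M; M-below; tuples-exceed)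

    differences : Forced (Fin l × Bool) (DifferenceEquations V)
    differences = record
      { threshold = λ n → M n ℕ.* l
      ; below = below-* l M-below
      ; find = λ {n} → differences-find (tuples-exceed n)
      }

-- Single balanced equations

module Equations (K : FinField) where
  open FieldLemmas K
  open Monomials K using (0F; 1F; 2F; Point)
  open ForcedConfigurations K
  open Differences K
  open import Algebra.Properties.CommutativeMonoid.Sum ℕ.+-0-commutativeMonoid as ℕSum using ()
  open import Data.Bool.Base using (Bool; true; false; if_then_else_)
  open import Data.Fin.Base using (punchIn; punchOut)
  open import Data.Fin.Properties using (any?; punchInᵢ≢i; punchOut-punchIn; punchOut-cong; punchOut-injective)
    renaming (_≟_ to _≟ᶠ_)
  open import Data.Maybe.Base using (Maybe; just; nothing)
  open import Data.Product using (proj₁; proj₂)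
  open import Data.Vec.Base using (lookup)
  open import Data.Vec.Functional using (_∷_)
  open import Function.Base using (_∘_; id)
  open import Relation.Binary.PropositionalEquality using (refl; sym; trans; cong; cong₂; module ≡-Reasoning)
  open import Relation.Nullary using (Dec; yes; no; does)
  open import Relation.Nullary.Negation using (contradiction)

  Equation-cong : ∀ {k n a} {x y : Fin k → Point n} → (∀ i → x i ≡ y i) → Equation a n x → Equation a n y
  Equation-cong {k} {a = a} x≡y eq t = trans (sum-cong-≗ {k} λ j → cong (λ z → a j * lookup z t) (sym (x≡y j))) (eq t)

  private
    pair : Scalar → Scalar → Fin 1 → Fin 2 → Scalar
    pair a b _ = a ∷ b ∷ λ ()

    retraction-injective : {A B : Set} {f : A → B} (g : B → A) → (∀ x → g (f x) ≡ x) → Inj f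
    retraction-injective g gf {x} {y} eq = trans (sym (gf x)) (trans (cong g eq) (gf y))

    -- A row with two nonzero entries has a kernel vector with both entries nonzero, which can be
    -- normalised at either coordinate; this gives the two vectors `σ`.
    four-terms : ∀ {a b} → a ≢ 0# → b ≢ 0# → Forced (Fin 2 × Bool) (DifferenceEquations (pair a b))
    four-terms {a} {b} a≢0 b≢0 = differences (pair a b) σ kernel diagonal
      where
      a⁻¹ = proj₁ (inverse a a≢0)
      b⁻¹ = proj₁ (inverse b b≢0)
      σ : Fin 2 → Fin 2 → Scalar
      σ 0F = 1# ∷ - a * b⁻¹ ∷ λ ()
      σ 1F = - b * a⁻¹ ∷ 1# ∷ λ ()
      open ≡-Reasoning
      kernel : ∀ c i → sum (λ j → pair a b i j * σ c j) ≡ 0#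
      kernel 0F i = begin
        a * 1# + (b * (- a * b⁻¹) + 0#)   ≡⟨ solve 3 (λ a b i → a :* :1 :+ (b :* ((:- a) :* i) :+ :0) := a :* (:1 :- b :* i)) refl a b b⁻¹ ⟩
        a * (1# - b * b⁻¹)                ≡⟨ cong (λ z → a * (1# - z)) (proj₂ (inverse b b≢0)) ⟩
        a * (1# - 1#)                     ≡⟨ solve 1 (λ a → a :* (:1 :- :1) := :0) refl a ⟩
        0#                                ∎
      kernel 1F i = begin
        a * (- b * a⁻¹) + (b * 1# + 0#)   ≡⟨ solve 3 (λ a b i → a :* ((:- b) :* i) :+ (b :* :1 :+ :0) := b :* (:1 :- a :* i)) refl a b a⁻¹ ⟩
        b * (1# - a * a⁻¹)                ≡⟨ cong (λ z → b * (1# - z)) (proj₂ (inverse a a≢0)) ⟩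
        b * (1# - 1#)                     ≡⟨ solve 1 (λ a → a :* (:1 :- :1) := :0) refl b ⟩
        0#                                ∎
      diagonal : ∀ c → σ c c ≡ 1#
      diagonal 0F = refl
      diagonal 1F = refl

    -- The merged variable x satisfies (a₀ + a₁) x = a₀ x₀ + a₁ x₁. `star` attaches such a solution
    -- to every variable of the merged equation, but only the one at variable 0 is expanded; the
    -- other variables stay at their centres.
    merge-two : ∀ {k} (a : Fin (4 ℕ.+ k) → Scalar) → (∀ i → a i ≢ 0#) → sum a ≡ 0# → a 0F + a 1F ≢ 0# →
      (∀ b → (∀ i → b i ≢ 0#) → sum b ≡ 0# → Forced (Fin (3 ℕ.+ k)) (Equation b)) →
      Forced (Fin (4 ℕ.+ k)) (Equation a)
    merge-two {k} a a≢0 sum≡0 ≢0 forced = reindex e e-inj (λ {n} {x} → combine {n} {x})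
      (star (three-terms (vec3 (- (a 0F + a 1F)) (a 0F) (a 1F)) split≢0
              (solve 2 (λ a b → (:- (a :+ b)) :+ (a :+ (b :+ :0)) := :0) refl (a 0F) (a 1F)))
        0F (forced ((a 0F + a 1F) ∷ rest) merged≢0 (trans (+-assoc _ _ _) sum≡0)))
      where
      rest : Fin (2 ℕ.+ k) → Scalar
      rest j = a (suc (suc j))
      split≢0 : ∀ i → vec3 (- (a 0F + a 1F)) (a 0F) (a 1F) i ≢ 0#
      split≢0 0F eq = ≢0 (trans (solve 1 (λ x → x := :0 :- (:- x)) refl _)
        (trans (cong (λ z → 0# - z) eq) (solve 0 (:0 :- :0 := :0) refl)))
      split≢0 1F = a≢0 0F
      split≢0 2F = a≢0 1F
      merged≢0 : ∀ i → ((a 0F + a 1F) ∷ rest) i ≢ 0#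
      merged≢0 zero    = ≢0
      merged≢0 (suc i) = a≢0 (suc (suc i))
      e : Fin (4 ℕ.+ k) → Fin (3 ℕ.+ k) × Fin 3
      e zero          = zero , 1F
      e (suc zero)    = zero , 2F
      e (suc (suc j)) = suc j , 0F
      g : Fin (3 ℕ.+ k) × Fin 3 → Fin (4 ℕ.+ k)
      g (zero , 2F)  = 1F
      g (zero , _)   = 0F
      g (suc j , _)  = suc (suc j)
      e-inj : Inj e
      e-inj = retraction-injective g λ { zero → refl ; (suc zero) → refl ; (suc (suc j)) → refl }
      combine : ∀ {n} {x : Fin (3 ℕ.+ k) × Fin 3 → Point n} →
        Equation ((a 0F + a 1F) ∷ rest) n (λ j → x (j , 0F)) ×
        (∀ j → Equation (vec3 (- (a 0F + a 1F)) (a 0F) (a 1F)) n (λ i → x (j , i))) →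
        Equation a n (x ∘ e)
      combine {x = x} (merged , split) t = trans
        (solve 6 (λ a b x y z r → a :* y :+ (b :* z :+ r) :=
           (a :+ b) :* x :+ r :+ ((:- (a :+ b)) :* x :+ (a :* y :+ (b :* z :+ :0)))) refl
           (a 0F) (a 1F) (lookup (x (zero , 0F)) t) _ _ _)
        (trans (cong₂ _+_ (merged t) (split zero t)) (+-identityˡ 0#))


    cancelling : ∀ {a b} → a + b ≡ 0# → ∀ x y r → a * x + (b * y + r) ≡ a * (x - y) + r
    cancelling {a} {b} ≡0 x y r = trans
      (solve 5 (λ a b x y r → a :* x :+ (b :* y :+ r) := a :* (x :- y) :+ r :+ (a :+ b) :* y) refl a b x y r)
      (trans (cong (λ z → a * (x - y) + r + z * y) ≡0) (solve 2 (λ s y → s :+ :0 :* y := s) refl _ _))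

    rest-zero : ∀ {a b} → a + b ≡ 0# → ∀ {r} → a + (b + r) ≡ 0# → r ≡ 0#
    rest-zero ≡0 {r} eq = trans (sym (+-identityˡ r)) (trans (cong (_+ r) (sym ≡0)) (trans (+-assoc _ _ _) eq))

    four : Fin 4 → Fin 2 × Bool
    four 0F = 0F , false
    four 1F = 0F , true
    four 2F = 1F , false
    four (suc (suc (suc _))) = 1F , true

    four-injective : Inj four
    four-injective = retraction-injective
      (λ { (0F , false) → 0F ; (0F , true) → 1F ; (1F , false) → 2F ; (1F , true) → suc 2F })
      (λ { 0F → refl ; 1F → refl ; 2F → refl ; (suc (suc (suc zero))) → refl })

    two-pairs : (a : Fin 4 → Scalar) → (∀ i → a i ≢ 0#) → sum a ≡ 0# → a 0F + a 1F ≡ 0# → Forced (Fin 4) (Equation a)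
    two-pairs a a≢0 sum≡0 ≡0 = reindex four four-injective (λ {n} {x} → combine {n} {x}) (four-terms (a≢0 0F) (a≢0 2F))
      where
      ≡0′ : a 2F + a (suc 2F) ≡ 0#
      ≡0′ = trans (cong (a 2F +_) (sym (+-identityʳ _))) (rest-zero ≡0 sum≡0)
      combine : ∀ {n} {x : Fin 2 × Bool → Point n} →
        DifferenceEquations (pair (a 0F) (a 2F)) n x → Equation a n (x ∘ four)
      combine {x = x} solution t = trans (cancelling ≡0 _ _ _)
        (trans (cong (a 0F * (lookup (x (0F , false)) t - lookup (x (0F , true)) t) +_) (cancelling ≡0′ _ _ _)) (solution zero t))

    -- The merged variable w is defined by a₀ (x₀ - x₁) + a₂ (x₂ - w) = 0, so that a₂ w replaces the
    -- first three terms. Its coefficient is nonzero although a₀ + a₁ vanishes.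
    merge-three : ∀ {k} (a : Fin (5 ℕ.+ k) → Scalar) → (∀ i → a i ≢ 0#) → a 0F + a 1F ≡ 0# →
      Forced (Fin (3 ℕ.+ k)) (Equation (λ j → a (suc (suc j)))) → Forced (Fin (5 ℕ.+ k)) (Equation a)
    merge-three {k} a a≢0 ≡0 forced = reindex e e-inj (λ {n} {x} → combine {n} {x})
      (star (reindex {R′ = λ n x → ∀ t → a 0F * (lookup (x 0F) t - lookup (x 1F) t) +
                                          (a 2F * (lookup (x 2F) t - lookup (x (suc 2F)) t) + 0#) ≡ 0#}
              four four-injective (λ solution t → solution zero t) (four-terms (a≢0 0F) (a≢0 2F)))
        (suc 2F) forced)
      where
      e : Fin (5 ℕ.+ k) → Fin (3 ℕ.+ k) × Fin 4
      e 0F = zero , 0F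
      e 1F = zero , 1F
      e 2F = zero , 2F
      e (suc (suc (suc j))) = suc j , suc 2F
      g : Fin (3 ℕ.+ k) × Fin 4 → Fin (5 ℕ.+ k)
      g (zero , 0F) = 0F
      g (zero , 1F) = 1F
      g (zero , _)  = 2F
      g (suc j , _) = suc (suc (suc j))
      e-inj : Inj e
      e-inj = retraction-injective g λ { 0F → refl ; 1F → refl ; 2F → refl ; (suc (suc (suc j))) → refl }
      combine : ∀ {n} {x : Fin (3 ℕ.+ k) × Fin 4 → Point n} → _ → Equation a n (x ∘ e)
      combine {x = x} (merged , split) t = trans (cancelling ≡0 _ _ _)
        (trans (solve 6 (λ a c u z w r → a :* u :+ (c :* z :+ r) :=
           a :* u :+ (c :* (z :- w) :+ :0) :+ (c :* w :+ r)) refl (a 0F) (a 2F) _ _ _ _)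
        (trans (cong₂ _+_ (split zero t) (merged t)) (+-identityˡ 0#)))

  -- If a₀ + a₁ ≠ 0, then x₀ and x₁ are merged to a variable with coefficient
  -- a₀ + a₁. Otherwise four variables form two differences, and if there are more,
  -- then x₀, x₁, x₂ are merged to a variable with coefficient a₂.
  nonzero-equation : ∀ k (a : Fin (3 ℕ.+ k) → Scalar) → (∀ i → a i ≢ 0#) → sum a ≡ 0# →
    Forced (Fin (3 ℕ.+ k)) (Equation a)
  nonzero-equation zero a a≢0 sum≡0 = three-terms a a≢0 sum≡0
  nonzero-equation (suc zero) a a≢0 sum≡0 = four-variables (a 0F + a 1F ≟ᶠ 0#)
    where
    four-variables : Dec (a 0F + a 1F ≡ 0#) → Forced (Fin 4) (Equation a)
    four-variables (yes ≡0) = two-pairs a a≢0 sum≡0 ≡0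
    four-variables (no ≢0)  = merge-two a a≢0 sum≡0 ≢0 three-terms
  nonzero-equation (suc (suc k)) a a≢0 sum≡0 =
    more-variables (a 0F + a 1F ≟ᶠ 0#) (nonzero-equation (suc k)) (nonzero-equation k)
    where
    more-variables : Dec (a 0F + a 1F ≡ 0#) →
      (∀ b → (∀ i → b i ≢ 0#) → sum b ≡ 0# → Forced (Fin (4 ℕ.+ k)) (Equation b)) →
      (∀ b → (∀ i → b i ≢ 0#) → sum b ≡ 0# → Forced (Fin (3 ℕ.+ k)) (Equation b)) →
      Forced (Fin (5 ℕ.+ k)) (Equation a)
    more-variables (yes ≡0) _ forced = merge-three a a≢0 ≡0
      (forced (λ j → a (suc (suc j))) (λ i → a≢0 (suc (suc i))) (rest-zero ≡0 sum≡0))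
    more-variables (no ≢0) forced _ = merge-two a a≢0 sum≡0 ≢0 forced

  nonzero : Scalar → ℕ
  nonzero x = if does (x ≟ᶠ 0#) then 0 else 1

  nonzero-zero : ∀ {x} → x ≡ 0# → nonzero x ≡ 0
  nonzero-zero {x} x≡0 with x ≟ᶠ 0#
  ... | yes _ = refl
  ... | no x≢0 = contradiction x≡0 x≢0

  nonzero-nonzero : ∀ {x} → x ≢ 0# → nonzero x ≡ 1
  nonzero-nonzero {x} x≢0 with x ≟ᶠ 0#
  ... | yes x≡0 = contradiction x≡0 x≢0
  ... | no _ = refl

  support : ∀ {k} → (Fin k → Scalar) → ℕ
  support a = ℕSum.sum (λ i → nonzero (a i))

  private
    support-remove : ∀ {k} (a : Fin (suc k) → Scalar) i → a i ≡ 0# → support (λ j → a (punchIn i j)) ≡ support a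
    support-remove a i ai≡0 = sym (trans (ℕSum.sum-remove {i = i} (λ j → nonzero (a j)))
      (cong (ℕ._+ support (λ j → a (punchIn i j))) (nonzero-zero ai≡0)))

    sum-drop : ∀ {k} (a : Fin (suc k) → Scalar) i → a i ≡ 0# → sum a ≡ sum (λ j → a (punchIn i j))
    sum-drop a i ai≡0 = trans (sum-remove {i = i} a) (trans (cong (_+ sum (λ j → a (punchIn i j))) ai≡0) (+-identityˡ _))

    -- A variable with coefficient 0 still needs a point of its own. Every point is doubled by means
    -- of `forced-free 2`, and the second point of one pair is taken; if there is no other variable,
    -- there is nothing to double, and one free point is used.
    add-unused : ∀ {k} (a : Fin (suc k) → Scalar) i → a i ≡ 0# →
      Forced (Fin k) (Equation (λ j → a (punchIn i j))) → Forced (Fin (suc k)) (Equation a)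
    add-unused {zero} a zero a₀≡0 F = reindex id id (λ {n} {x} _ t →
      trans (+-identityʳ _) (trans (cong (_* lookup (x zero) t) a₀≡0) (zeroˡ _)))
      (forced-free 1)
    add-unused {suc k} a i ai≡0 F = reindex (λ j → e j (i ≟ᶠ j)) (λ {j} {j′} → e-inj (i ≟ᶠ j) (i ≟ᶠ j′))
      (λ {n} {x} (eq , _) t → trans
        (sum-drop (λ j → a j * lookup (x (e j (i ≟ᶠ j))) t) i
          (trans (cong (_* lookup (x (e i (i ≟ᶠ i))) t) ai≡0) (zeroˡ _)))
        (Equation-cong {a = λ j → a (punchIn i j)} {λ j → x (j , 0F)} {λ j → x (e (punchIn i j) (i ≟ᶠ punchIn i j))}
          (λ j → cong x (sym (e-punchIn j (i ≟ᶠ punchIn i j)))) eq t))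
      (star (forced-free 2) 0F F)
      where
      e : ∀ j → Dec (i ≡ j) → Fin (suc k) × Fin 2
      e j (yes _)  = zero , 1F
      e j (no i≢j) = punchOut i≢j , 0F
      e-inj : ∀ {j j′} d d′ → e j d ≡ e j′ d′ → j ≡ j′
      e-inj (yes i≡j) (yes i≡j′) eq = trans (sym i≡j) i≡j′
      e-inj (no i≢j)  (no i≢j′)  eq = punchOut-injective i≢j i≢j′ (cong proj₁ eq)
      e-inj (yes _)   (no _)     ()
      e-inj (no _)    (yes _)    ()
      e-punchIn : ∀ j d → e (punchIn i j) d ≡ (j , 0F)
      e-punchIn j (yes eq) = contradiction (sym eq) (punchInᵢ≢i i j)
      e-punchIn j (no ≢)   = cong (_, 0F) (trans (punchOut-cong i refl) (punchOut-punchIn i))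

    all-nonzero : ∀ {k} (a : Fin k → Scalar) → (∀ i → a i ≢ 0#) → sum a ≡ 0# → support a ≢ 2 →
      Forced (Fin k) (Equation a)
    all-nonzero {0} a a≢0 sum≡0 ≢2 = reindex id id (λ _ t → refl) (forced-free 0)
    all-nonzero {1} a a≢0 sum≡0 ≢2 = contradiction (trans (sym (+-identityʳ _)) sum≡0) (a≢0 zero)
    all-nonzero {2} a a≢0 sum≡0 ≢2 = contradiction
      (cong₂ ℕ._+_ (nonzero-nonzero (a≢0 0F)) (cong (ℕ._+ 0) (nonzero-nonzero (a≢0 1F)))) ≢2
    all-nonzero {suc (suc (suc k))} a a≢0 sum≡0 ≢2 = nonzero-equation k a a≢0 sum≡0

  -- Support 0 imposes no condition, support 1 contradicts the vanishing sum, and support at least 3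
  -- is `nonzero-equation`. Support 2 has to be excluded, as a (x - y) = 0 has no solution in
  -- distinct points.
  equation : ∀ {k} (a : Fin k → Scalar) → sum a ≡ 0# → support a ≢ 2 → Forced (Fin k) (Equation a)
  equation {zero}  a sum≡0 ≢2 = all-nonzero a (λ ()) sum≡0 ≢2
  equation {suc k} a sum≡0 ≢2 = cases (any? (λ i → a i ≟ᶠ 0#))
    where
    cases : Dec (∃[ i ] (a i ≡ 0#)) → Forced (Fin (suc k)) (Equation a)
    cases (yes (i , ai≡0)) = add-unused a i ai≡0 (equation (λ j → a (punchIn i j))
      (trans (sym (sum-drop a i ai≡0)) sum≡0) (λ eq → ≢2 (trans (sym (support-remove a i ai≡0)) eq)))
    cases (no ∄) = all-nonzero a (λ i ai≡0 → ∄ (i , ai≡0)) sum≡0 ≢2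

  -- One `star` per equation, all of them centred at the same points of `F`, which serve as variable
  -- 0. `nothing` marks such a centre, and `just (c , i)` is variable i + 1 of equation c around it.
  attach : ∀ {J R} r {k} (a : Fin r → Fin (suc k) → Scalar) → (∀ c → Forced (Fin (suc k)) (Equation (a c))) →
    Forced J R → Forced (J × Maybe (Fin r × Fin k)) (λ n x →
      R n (λ j → x (j , nothing)) ×
      (∀ c j → Equation (a c) n (x (j , nothing) ∷ λ i → x (j , just (c , i)))))
  attach zero a forced F = reindex proj₁ (λ { {_ , nothing} {_ , nothing} refl → refl }) (λ r → r , λ ()) F
  attach {J} {R} (suc r) {k} a forced F = reindex e (retraction-injective g g∘e)
    (λ { {n} {x} ((base , eqs) , new) → base , λ where
      zero    j → Equation-cong {a = a zero} {λ i → x ((j , nothing) , i)}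
                    {x ((j , nothing) , zero) ∷ λ i → x ((j , nothing) , suc i)}
                    (λ { zero → refl ; (suc i) → refl }) (new (j , nothing))
      (suc c) j → eqs c j })
    (star (forced zero) zero (attach r (λ c → a (suc c)) (λ c → forced (suc c)) F))
    where
    e : J × Maybe (Fin (suc r) × Fin k) → (J × Maybe (Fin r × Fin k)) × Fin (suc k)
    e (j , nothing)           = (j , nothing) , zero
    e (j , just (zero , i))   = (j , nothing) , suc i
    e (j , just (suc c , i))  = (j , just (c , i)) , zero
    g : (J × Maybe (Fin r × Fin k)) × Fin (suc k) → J × Maybe (Fin (suc r) × Fin k)
    g ((j , nothing) , zero)      = j , nothing
    g ((j , nothing) , suc i)     = j , just (zero , i)
    g ((j , just (c , i)) , _)    = j , just (suc c , i)
    g∘e : ∀ x → g (e x) ≡ x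
    g∘e (j , nothing)          = refl
    g∘e (j , just (zero , i))  = refl
    g∘e (j , just (suc c , i)) = refl

-- Linear alternatives

module LinearAlgebra (K : FinField) where
  open FieldLemmas K
  open import Data.Fin.Properties using () renaming (_≟_ to _≟ᶠ_; any? to anyᶠ?)
  open import Data.Product using (Σ-syntax; proj₁; proj₂)
  open import Data.Sum using (inj₁; inj₂)
  open import Function.Base using (_∘_)
  open import Relation.Binary.PropositionalEquality using (refl; sym; trans; cong; cong₂; module ≡-Reasoning)
  open import Relation.Nullary using (Dec; yes; no; ¬?)
  open import Relation.Nullary.Decidable using (decidable-stable)
  open import Relation.Nullary.Negation using (contradiction)

  when : ∀ {P : Set} → Dec P → Scalar → Scalar
  when (yes _) x = x
  when (no _)  x = 0#

  when-true : ∀ {P : Set} (d : Dec P) {x} → P → when d x ≡ x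
  when-true (yes _) p = refl
  when-true (no ¬p) p = contradiction p ¬p

  when-false : ∀ {P : Set} (d : Dec P) {x} → ¬ P → when d x ≡ 0#
  when-false (yes p) ¬p = contradiction p ¬p
  when-false (no _)  ¬p = refl

  when-* : ∀ {P : Set} (d : Dec P) x y → when d (x * y) ≡ x * when d y
  when-* (yes _) x y = refl
  when-* (no _)  x y = sym (zeroʳ x)

  sum-when : ∀ {n} (f : Fin n → Scalar) i → sum (λ j → when (i ≟ᶠ j) (f j)) ≡ f i
  sum-when f i = trans (sum-single (λ j → when (i ≟ᶠ j) (f j)) i (λ j j≢i → when-false (i ≟ᶠ j) (j≢i ∘ sym)))
    (when-true (i ≟ᶠ i) refl)

  dot : ∀ {m} → (Fin m → Scalar) → (Fin m → Scalar) → Scalar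
  dot w u = sum (λ i → w i * u i)

  dot-combinationʳ : ∀ {m} (w u v : Fin m → Scalar) c → dot w (λ i → u i + c * v i) ≡ dot w u + c * dot w v
  dot-combinationʳ w u v c = begin
    sum (λ i → w i * (u i + c * v i))
      ≡⟨ sum-*-distribˡ-+ w u (λ i → c * v i) ⟩
    dot w u + sum (λ i → w i * (c * v i))
      ≡⟨ cong (dot w u +_) (trans (sum-cong-≗ (λ i → solve 3 (λ w c v → w :* (c :* v) := c :* (w :* v)) refl (w i) c (v i)))
           (sym (*-distribˡ-sum c (λ i → w i * v i)))) ⟩
    dot w u + c * dot w v ∎
    where open ≡-Reasoning

  dot-comm : ∀ {m} (w u : Fin m → Scalar) → dot w u ≡ dot u w
  dot-comm w u = sum-cong-≗ (λ i → *-comm (w i) (u i))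

  dot-combinationˡ : ∀ {m} (u v w : Fin m → Scalar) c → dot (λ i → u i + c * v i) w ≡ dot u w + c * dot v w
  dot-combinationˡ u v w c = trans (dot-comm (λ i → u i + c * v i) w) (trans (dot-combinationʳ w u v c)
    (cong₂ (λ x y → x + c * y) (dot-comm w u) (dot-comm w v)))

  Spanned Separated : ∀ {r m} → (Fin r → Fin m → Scalar) → (Fin m → Scalar) → Set
  Spanned {r} u v = Σ[ s ∈ (Fin r → Scalar) ] (∀ i → v i ≡ sum (λ j → s j * u j i))
  Separated {r} {m} u v = Σ[ w ∈ (Fin m → Scalar) ] ((∀ j → dot w (u j) ≡ 0#) × dot w v ≡ 1#)

  -- The Fredholm alternative, by induction on the number of vectors. If the functional `w` that
  -- separates v from the later vectors does not vanish on u₀, then v is reduced by the multiple of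
  -- u₀ on which `w` has the same value as on v. A functional found for the reduced vector is
  -- corrected by a multiple of `w`.
  spanned-or-separated : ∀ {r m} (u : Fin r → Fin m → Scalar) v → Spanned u v ⊎ Separated u v
  spanned-or-separated {zero} {m} u v with anyᶠ? (λ i → ¬? (v i ≟ᶠ 0#))
  ... | no ∄ = inj₁ ((λ ()) , λ i → decidable-stable (v i ≟ᶠ 0#) (λ ≢0 → ∄ (i , ≢0)))
  ... | yes (i , vi≢0) = inj₂ (w , (λ ()) , (begin
      sum (λ j → when (i ≟ᶠ j) vi⁻¹ * v j)   ≡⟨ sum-cong-≗ (λ j → trans (*-comm (when (i ≟ᶠ j) vi⁻¹) (v j))
                                                  (sym (when-* (i ≟ᶠ j) (v j) vi⁻¹))) ⟩
      sum (λ j → when (i ≟ᶠ j) (v j * vi⁻¹)) ≡⟨ sum-when (λ j → v j * vi⁻¹) i ⟩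
      v i * vi⁻¹                             ≡⟨ proj₂ (inverse (v i) vi≢0) ⟩
      1#                                     ∎))
    where
    open ≡-Reasoning
    vi⁻¹ = proj₁ (inverse (v i) vi≢0)
    w : Fin m → Scalar
    w j = when (i ≟ᶠ j) vi⁻¹
  spanned-or-separated {suc r} {m} u v = cases (spanned-or-separated (u ∘ suc) v)
    where
    u₀ = u zero

    separate-remainder : ∀ w d → (∀ j → dot w (u (suc j)) ≡ 0#) → dot w v ≡ 1# → dot w u₀ * d ≡ 1# →
      Spanned (u ∘ suc) (λ i → v i + - d * u₀ i) ⊎ Separated (u ∘ suc) (λ i → v i + - d * u₀ i) →
      Spanned u v ⊎ Separated u v
    separate-remainder w d w·u w·v d-inv (inj₁ (s , eq)) = inj₁
      ((λ { zero → d ; (suc j) → s j }) , λ i → trans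
        (solve 3 (λ v d u → v := d :* u :+ (v :+ (:- d) :* u)) refl (v i) d (u₀ i)) (cong (d * u₀ i +_) (eq i)))
    separate-remainder w d w·u w·v d-inv (inj₂ (w′ , w′·u , w′·v)) = inj₂ (w″ , w″·u , (begin
        dot w″ v                                      ≡⟨ dot-combinationˡ w′ w v c ⟩
        dot w′ v + c * dot w v                        ≡⟨ cong (λ z → dot w′ v + c * z) w·v ⟩
        dot w′ v + c * 1#                             ≡⟨ solve 3 (λ x d y → x :+ (:- (d :* y)) :* :1 := x :+ (:- d) :* y) refl (dot w′ v) d (dot w′ u₀) ⟩
        dot w′ v + - d * dot w′ u₀                    ≡⟨ sym (dot-combinationʳ w′ v u₀ (- d)) ⟩
        dot w′ (λ i → v i + - d * u₀ i)               ≡⟨ w′·v ⟩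
        1#                                            ∎))
      where
      open ≡-Reasoning
      -- The multiple of `w` for which `w″` annihilates u₀.
      c = - (d * dot w′ u₀)
      w″ : Fin m → Scalar
      w″ i = w′ i + c * w i
      w″·u : ∀ j → dot w″ (u j) ≡ 0#
      w″·u zero = begin
        dot w″ u₀                                     ≡⟨ dot-combinationˡ w′ w u₀ c ⟩
        dot w′ u₀ + - (d * dot w′ u₀) * dot w u₀      ≡⟨ solve 3 (λ x d y → x :+ (:- (d :* x)) :* y := x :+ (:- x) :* (y :* d)) refl (dot w′ u₀) d (dot w u₀) ⟩
        dot w′ u₀ + - dot w′ u₀ * (dot w u₀ * d)      ≡⟨ cong (λ z → dot w′ u₀ + - dot w′ u₀ * z) d-inv ⟩
        dot w′ u₀ + - dot w′ u₀ * 1#                  ≡⟨ solve 1 (λ x → x :+ (:- x) :* :1 := :0) refl (dot w′ u₀) ⟩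
        0#                                            ∎
      w″·u (suc j) = begin
        dot w″ (u (suc j))                            ≡⟨ dot-combinationˡ w′ w (u (suc j)) c ⟩
        dot w′ (u (suc j)) + c * dot w (u (suc j))    ≡⟨ cong₂ (λ x y → x + c * y) (w′·u j) (w·u j) ⟩
        0# + c * 0#                                   ≡⟨ solve 1 (λ c → :0 :+ c :* :0 := :0) refl c ⟩
        0#                                            ∎

    cases : Spanned (u ∘ suc) v ⊎ Separated (u ∘ suc) v → Spanned u v ⊎ Separated u v
    cases (inj₁ (s , eq)) = inj₁ ((λ { zero → 0# ; (suc j) → s j }) ,
      λ i → trans (eq i) (solve 2 (λ x y → x := :0 :* y :+ x) refl _ (u₀ i)))
    cases (inj₂ (w , w·u , w·v)) with dot w u₀ ≟ᶠ 0#
    ... | yes w·u₀ = inj₂ (w , (λ { zero → w·u₀ ; (suc j) → w·u j }) , w·v)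
    ... | no w·u₀≢0 = let d , d-inv = inverse (dot w u₀) w·u₀≢0 in
      separate-remainder w d w·u w·v d-inv (spanned-or-separated (u ∘ suc) (λ i → v i + - d * u₀ i))

  Related Isolated : ∀ {m k} → (Fin m → Fin k → Scalar) → Fin k → Set
  Related {m} {k} V c = Σ[ σ ∈ (Fin k → Scalar) ] ((∀ i → sum (λ j → V i j * σ j) ≡ 0#) × σ c ≡ 1#)
  Isolated {m} V c = Σ[ w ∈ (Fin m → Scalar) ]
    ((∀ j → j ≢ c → dot w (λ i → V i j) ≡ 0#) × dot w (λ i → V i c) ≡ 1#)

  related-or-isolated : ∀ {m k} (V : Fin m → Fin k → Scalar) c → Related V c ⊎ Isolated V c
  -- Column c is replaced by zero in the spanning family instead of being removed, so that the index
  -- set remains `Fin k`.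
  related-or-isolated {m} {k} V c with spanned-or-separated (λ j i → when (¬? (c ≟ᶠ j)) (V i j)) (λ i → V i c)
  ... | inj₂ (w , w·V , w·Vc) = inj₂ (w ,
    (λ j j≢c → trans (sum-cong-≗ {m} λ i → cong (w i *_) (sym (when-true (¬? (c ≟ᶠ j)) (j≢c ∘ sym)))) (w·V j)) , w·Vc)
  ... | inj₁ (s , eq) = inj₁ (σ , kernel , trans
      (cong₂ _-_ (when-true (c ≟ᶠ c) refl) (when-false (¬? (c ≟ᶠ c)) (λ ≢ → ≢ refl))) (solve 0 (:1 :- :0 := :1) refl))
    where
    open ≡-Reasoning
    σ : Fin k → Scalar
    σ j = when (c ≟ᶠ j) 1# - when (¬? (c ≟ᶠ j)) (s j)
    split : ∀ i j → V i j * σ j ≡ when (c ≟ᶠ j) (V i j) + - 1# * (s j * when (¬? (c ≟ᶠ j)) (V i j))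
    split i j with c ≟ᶠ j
    ... | yes _ = solve 2 (λ v s → v :* (:1 :- :0) := v :+ :- :1 :* (s :* :0)) refl (V i j) (s j)
    ... | no _  = solve 2 (λ v s → v :* (:0 :- s) := :0 :+ :- :1 :* (s :* v)) refl (V i j) (s j)
    kernel : ∀ i → sum (λ j → V i j * σ j) ≡ 0#
    kernel i = begin
      sum (λ j → V i j * σ j)
        ≡⟨ sum-cong-≗ {k} (split i) ⟩
      sum (λ j → when (c ≟ᶠ j) (V i j) + - 1# * (s j * when (¬? (c ≟ᶠ j)) (V i j)))
        ≡⟨ ∑-distrib-+ (λ j → when (c ≟ᶠ j) (V i j)) (λ j → - 1# * (s j * when (¬? (c ≟ᶠ j)) (V i j))) ⟩
      sum (λ j → when (c ≟ᶠ j) (V i j)) + sum (λ j → - 1# * (s j * when (¬? (c ≟ᶠ j)) (V i j)))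
        ≡⟨ cong₂ _+_ (sum-when (V i) c) (trans (sym (*-distribˡ-sum (- 1#) (λ j → s j * when (¬? (c ≟ᶠ j)) (V i j))))
             (cong (- 1# *_) (sym (eq i)))) ⟩
      V i c + - 1# * V i c
        ≡⟨ solve 1 (λ x → x :+ :- :1 :* x := :0) refl (V i c) ⟩
      0# ∎

-- Terms of small sums

module Counting where
  open import Algebra.Properties.CommutativeMonoid.Sum ℕ.+-0-commutativeMonoid using (sum; sum-remove)
  open import Data.Fin.Base using (punchIn; punchOut; toℕ)
  open import Data.Fin.Properties using (punchIn-punchOut; punchInᵢ≢i) renaming (_≟_ to _≟ᶠ_)
  open import Data.Nat.Base using (z≤n; s≤s; _≤_)
  open import Data.Product using (∃)
  open import Data.Sum using (inj₁; inj₂)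
  open import Function.Base using (_∘_)
  open import Relation.Binary.PropositionalEquality using (refl; sym; trans; cong; subst)
  open import Relation.Nullary using (Dec; yes; no)
  open import Relation.Nullary.Negation using (contradiction)

  sum≡0 : ∀ {k} (g : Fin k → ℕ) → sum g ≡ 0 → ∀ j → g j ≡ 0
  sum≡0 g eq zero    = ℕ.m+n≡0⇒m≡0 (g zero) eq
  sum≡0 g eq (suc j) = sum≡0 (g ∘ suc) (ℕ.m+n≡0⇒n≡0 (g zero) eq) j

  positive-term : ∀ {k n} (g : Fin (suc k) → ℕ) → (∀ j → g j ≤ 1) → sum g ≡ suc n →
    ∃[ j ] (g j ≢ 0 × sum (λ i → g (punchIn j i)) ≡ n)
  positive-term {k} {n} g g≤1 eq = conclude (find k g eq)
    where
    one : ∀ {x} → x ≤ 1 → x ≢ 0 → x ≡ 1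
    one {zero}        _         ≢0 = contradiction refl ≢0
    one {suc zero}    _         _  = refl
    one {suc (suc x)} (s≤s ())  _
    find : ∀ k (g : Fin (suc k) → ℕ) → sum g ≡ suc n → ∃[ j ] (g j ≢ 0)
    find k g eq with g zero ℕ.≟ 0
    ... | no ≢0 = zero , ≢0
    find zero g eq | yes ≡0 = contradiction (trans (sym eq) (trans (ℕ.+-identityʳ (g zero)) ≡0)) λ ()
    find (suc k) g eq | yes ≡0 =
      let j , ≢0 = find k (g ∘ suc) (trans (cong (ℕ._+ sum (g ∘ suc)) (sym ≡0)) eq) in suc j , ≢0
    conclude : ∃[ j ] (g j ≢ 0) → ∃[ j ] (g j ≢ 0 × sum (λ i → g (punchIn j i)) ≡ n)
    conclude (j , ≢0) = j , ≢0 , ℕ.suc-injective (trans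
      (cong (ℕ._+ sum (λ i → g (punchIn j i))) (sym (one (g≤1 j) ≢0))) (trans (sym (sum-remove {i = j} g)) eq))

  single-term : ∀ {k} (g : Fin k → ℕ) → (∀ j → g j ≤ 1) → sum g ≡ 1 →
    ∃[ j ] (g j ≢ 0 × (∀ i → g i ≢ 0 → i ≡ j))
  single-term {suc k} g g≤1 eq with positive-term g g≤1 eq
  ... | j , gj≢0 , rest = j , gj≢0 , unique
    where
    unique : ∀ i → g i ≢ 0 → i ≡ j
    unique i gi≢0 with j ≟ᶠ i
    ... | yes j≡i = sym j≡i
    ... | no j≢i = contradiction (trans (cong g (sym (punchIn-punchOut j≢i))) (sum≡0 (λ i → g (punchIn j i)) rest (punchOut j≢i))) gi≢0

  two-terms : ∀ {k} (g : Fin k → ℕ) → (∀ j → g j ≤ 1) → sum g ≡ 2 →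
    ∃[ j ] ∃[ j′ ] (j ≢ j′ × g j ≢ 0 × g j′ ≢ 0 × (∀ i → g i ≢ 0 → i ≡ j ⊎ i ≡ j′))
  two-terms {suc k} g g≤1 eq with positive-term g g≤1 eq
  ... | j , gj≢0 , rest with single-term (λ i → g (punchIn j i)) (λ i → g≤1 (punchIn j i)) rest
  ... | i′ , gj′≢0 , unique = j , punchIn j i′ , (λ eq → punchInᵢ≢i j i′ (sym eq)) , gj≢0 , gj′≢0 , cover
    where
    cover : ∀ i → g i ≢ 0 → i ≡ j ⊎ i ≡ punchIn j i′
    cover i gi≢0 with j ≟ᶠ i
    ... | yes j≡i = inj₁ (sym j≡i)
    ... | no j≢i = inj₂ (trans (sym (punchIn-punchOut j≢i)) (cong (punchIn j)
      (unique (punchOut j≢i) (subst (λ i → g i ≢ 0) (sym (punchIn-punchOut j≢i)) gi≢0))))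

  least : ∀ {n} {P : Fin n → Set} → (∀ i → Dec (P i)) → ∃ P → ∃[ i ] (P i × (∀ j → P j → toℕ i ≤ toℕ j))
  least {suc n} P? (i , Pi) with P? zero
  ... | yes P0 = zero , P0 , λ _ _ → z≤n
  least {suc n} P? (zero , P0)  | no ¬P0 = contradiction P0 ¬P0
  least {suc n} P? (suc i , Pi) | no ¬P0 with least (λ i → P? (suc i)) (i , Pi)
  ... | i′ , Pi′ , minimal = suc i′ , Pi′ , λ where
    zero    P0 → contradiction P0 ¬P0
    (suc j) Pj → s≤s (minimal j Pj)

-- Column equivalence classes

module ColumnClasses (K : FinField) {m k : ℕ} (A : Fin m → Fin k → FinField.Scalar K)
                     (column≢0 : ∀ j → ∃[ i ] (A i j ≢ FinField.0# K)) where
  open FieldLemmas K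
  open LinearAlgebra K
  open ForcedConfigurations K
  open Equations K
  open Counting using (least)
  open import Data.Fin.Base using (punchIn; punchOut; toℕ)
  open import Data.Fin.Properties using (punchIn-punchOut; punchInᵢ≢i; punchIn-injective; toℕ-injective; any?; all?) renaming (_≟_ to _≟ᶠ_)
  open import Data.Product using (proj₁; proj₂)
  open import Data.Vec.Base using (lookup)
  open import Function.Base using (const)
  open import Relation.Binary.PropositionalEquality using (refl; sym; trans; cong; subst; module ≡-Reasoning)
  open import Relation.Nullary using (Dec; yes; no; ¬?)
  open import Relation.Nullary.Decidable using (_×-dec_)
  open import Relation.Nullary.Negation using (contradiction)

  infix 4 _~_ _~?_

  _~_ : Fin k → Fin k → Set
  j ~ j′ = ∃[ c ] (c ≢ 0# × (∀ i → A i j′ ≡ c * A i j))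

  _~?_ : ∀ j j′ → Dec (j ~ j′)
  j ~? j′ = any? (λ c → ¬? (c ≟ᶠ 0#) ×-dec all? (λ i → A i j′ ≟ᶠ c * A i j))

  ~-refl : ∀ {j} → j ~ j
  ~-refl = 1# , 1≢0 , λ i → sym (*-identityˡ _)

  ~-sym : ∀ {j j′} → j ~ j′ → j′ ~ j
  ~-sym {j} {j′} (c , c≢0 , eq) = d , d≢0 , λ i → begin
      A i j              ≡⟨ sym (*-identityˡ _) ⟩
      1# * A i j         ≡⟨ cong (_* A i j) (sym (proj₂ (inverse c c≢0))) ⟩
      c * d * A i j      ≡⟨ solve 3 (λ c d x → c :* d :* x := d :* (c :* x)) refl c d (A i j) ⟩
      d * (c * A i j)    ≡⟨ cong (d *_) (sym (eq i)) ⟩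
      d * A i j′         ∎
    where
    open ≡-Reasoning
    d = proj₁ (inverse c c≢0)
    d≢0 : d ≢ 0#
    d≢0 d≡0 = 1≢0 (trans (sym (proj₂ (inverse c c≢0))) (trans (cong (c *_) d≡0) (zeroʳ c)))

  ~-trans : ∀ {i j l} → i ~ j → j ~ l → i ~ l
  ~-trans (c , c≢0 , eq) (d , d≢0 , eq′) = d * c , product-nonzero d≢0 c≢0 ,
    λ i → trans (eq′ i) (trans (cong (d *_) (eq i)) (sym (*-assoc d c _)))

  private
    least-equivalent : ∀ j → ∃[ i ] (i ~ j × (∀ i′ → i′ ~ j → toℕ i ℕ.≤ toℕ i′))
    least-equivalent j = least (_~? j) (j , ~-refl)

  abstract
    -- Choosing the least index of a class makes the representatives of equivalent columns equal,
    -- not only equivalent.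
    rep : Fin k → Fin k
    rep j = proj₁ (least-equivalent j)

    rep-~ : ∀ j → rep j ~ j
    rep-~ j = proj₁ (proj₂ (least-equivalent j))

    rep-cong : ∀ {j j′} → j ~ j′ → rep j ≡ rep j′
    rep-cong {j} {j′} j~j′ = toℕ-injective (ℕ.≤-antisym
      (proj₂ (proj₂ (least-equivalent j)) (rep j′) (~-trans (rep-~ j′) (~-sym j~j′)))
      (proj₂ (proj₂ (least-equivalent j′)) (rep j) (~-trans (rep-~ j) j~j′)))

  rep-injective : ∀ {j j′} → rep j ≡ rep j′ → j ~ j′
  rep-injective {j} {j′} eq = ~-trans (~-sym (rep-~ j)) (subst (_~ j′) (sym eq) (rep-~ j′))

  rep-rep : ∀ j → rep (rep j) ≡ rep j
  rep-rep j = rep-cong (rep-~ j)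

  ratio : Fin k → Scalar
  ratio j = proj₁ (rep-~ j)

  ratio≢0 : ∀ j → ratio j ≢ 0#
  ratio≢0 j = proj₁ (proj₂ (rep-~ j))

  column : ∀ i j → A i j ≡ ratio j * A i (rep j)
  column i j = proj₂ (proj₂ (rep-~ j)) i

  -- Classes are indexed by all of `Fin k`. If `c` is not a representative, its class is empty and
  -- all entries are 0, so the classes never have to be enumerated.
  classRatio : Fin k → Fin k → Scalar
  classRatio c j = when (rep j ≟ᶠ c) (ratio j)

  classRatio-in : ∀ {c j} → rep j ≡ c → classRatio c j ≡ ratio j
  classRatio-in {c} {j} = when-true (rep j ≟ᶠ c)

  classRatio-out : ∀ {c j} → rep j ≢ c → classRatio c j ≡ 0#
  classRatio-out {c} {j} = when-false (rep j ≟ᶠ c)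

  classRatio-nonzero : ∀ {c j} → classRatio c j ≢ 0# → rep j ≡ c
  classRatio-nonzero {c} {j} ≢0 with rep j ≟ᶠ c
  ... | yes eq = eq
  ... | no _ = contradiction refl ≢0

  classRatio-cong : ∀ {c j x y} → (rep j ≡ c → x ≡ y) → classRatio c j * x ≡ classRatio c j * y
  classRatio-cong {c} {j} {x} {y} x≡y with rep j ≟ᶠ c
  ... | yes eq = cong (ratio j *_) (x≡y eq)
  ... | no _ = trans (zeroˡ x) (sym (zeroˡ y))

  classTotal : Fin k → Scalar
  classTotal c = sum (classRatio c)

  regroup : ∀ (f : Fin k → Scalar) → sum f ≡ sum (λ c → sum (λ j → when (rep j ≟ᶠ c) (f j)))
  regroup f = sym (trans (∑-comm (λ c j → when (rep j ≟ᶠ c) (f j)))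
    (sum-cong-≗ (λ j → sum-when (λ _ → f j) (rep j))))

  class-column : ∀ i c j y → when (rep j ≟ᶠ c) (A i j * y) ≡ A i c * (classRatio c j * y)
  class-column i c j y with rep j ≟ᶠ c
  ... | yes refl = trans (cong (_* y) (column i j))
    (solve 3 (λ r a y → r :* a :* y := a :* (r :* y)) refl (ratio j) (A i (rep j)) y)
  ... | no _ = solve 2 (λ a y → :0 := a :* (:0 :* y)) refl (A i c) y

  -- All columns in the class of `c` are multiples of column `c`, so the system sees the variables
  -- only through one weighted sum per class.
  sum-by-classes : ∀ i (y g : Fin k → Scalar) → (∀ c → sum (λ j → classRatio c j * y j) ≡ g c) →
    sum (λ j → A i j * y j) ≡ sum (λ c → A i c * g c)
  sum-by-classes i y g eq = trans (regroup (λ j → A i j * y j)) (sum-cong-≗ λ c → begin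
      sum (λ j → when (rep j ≟ᶠ c) (A i j * y j))      ≡⟨ sum-cong-≗ {k} (λ j → class-column i c j (y j)) ⟩
      sum (λ j → A i c * (classRatio c j * y j))       ≡⟨ sym (*-distribˡ-sum (A i c) (λ j → classRatio c j * y j)) ⟩
      A i c * sum (λ j → classRatio c j * y j)         ≡⟨ cong (A i c *_) (eq c) ⟩
      A i c * g c                                      ∎)
    where open ≡-Reasoning

  System : Relation (Fin k)
  System n x = ∀ i t → sum (λ j → A i j * lookup (x j) t) ≡ 0#

  -- An equation of support 2 is not forced. It is replaced by the zero equation, and is later
  -- satisfied by placing the variables concerned at the centre.
  drop : ∀ {P : Set} {l} → Dec P → (Fin l → Scalar) → Fin l → Scalar
  drop (yes _) a = const 0#
  drop (no _)  a = a

  drop-forced : ∀ {l} (a : Fin l → Scalar) → sum a ≡ 0# → (d : Dec (support a ≡ 2)) → Forced (Fin l) (Equation (drop d a))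
  drop-forced a sum≡0 (no ≢2) = equation a sum≡0 ≢2
  drop-forced {l} a sum≡0 (yes _) = equation (const 0#) (sum-zero {l} (λ _ → refl)) (λ eq → contradiction (trans (sym (zeros l)) eq) λ ())
    where
    zeros : ∀ l → support {l} (const 0#) ≡ 0
    zeros zero = refl
    zeros (suc l) = trans (cong (ℕ._+ support {l} (const 0#)) (nonzero-zero refl)) (zeros l)

  nonzero≤1 : ∀ x → nonzero x ℕ.≤ 1
  nonzero≤1 x with x ≟ᶠ 0#
  ... | yes _ = ℕ.z≤n
  ... | no _ = ℕ.≤-refl

  nonzero≢0 : ∀ {x} → nonzero x ≢ 0 → x ≢ 0#
  nonzero≢0 ≢0 x≡0 = ≢0 (nonzero-zero x≡0)

  nonzero≢0′ : ∀ {x} → x ≢ 0# → nonzero x ≢ 0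
  nonzero≢0′ x≢0 eq = contradiction (trans (sym (nonzero-nonzero x≢0)) eq) λ ()

  sum-pair : ∀ {l} (f : Fin l → Scalar) i j → i ≢ j → (∀ h → h ≢ i → h ≢ j → f h ≡ 0#) → sum f ≡ f i + f j
  sum-pair {suc l} f i j i≢j others = trans (sum-remove {i = i} f) (cong (f i +_) (trans
    (sum-single (λ h → f (punchIn i h)) (punchOut i≢j) (λ h h≢ → others (punchIn i h) (punchInᵢ≢i i h)
      (λ eq → h≢ (punchIn-injective i _ _ (trans eq (sym (punchIn-punchOut i≢j)))))))
    (cong f (punchIn-punchOut i≢j))))

-- Case (i): no class of size 2 sums to zero

module NoCancellingPair (K : FinField) {m k : ℕ} (A : Fin m → Fin k → FinField.Scalar K)
                        (column≢0 : ∀ j → ∃[ i ] (A i j ≢ FinField.0# K)) where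
  open FieldLemmas K
  open LinearAlgebra K
  open ForcedConfigurations K
  open Monomials K using (Point)
  open Equations K
  open ColumnClasses K A column≢0
  open Counting using (two-terms; single-term)
  open import Data.Fin.Properties using () renaming (_≟_ to _≟ᶠ_)
  open import Data.Maybe.Base using (Maybe; just; nothing)
  open import Data.Sum as Sum using (inj₁; inj₂)
  open import Data.Unit.Base using (⊤; tt)
  open import Data.Vec.Base using (lookup)
  open import Data.Vec.Functional using (_∷_)
  open import Relation.Binary.PropositionalEquality using (refl; sym; trans; cong; cong₂; module ≡-Reasoning)
  open import Relation.Nullary using (Dec; yes; no)
  open import Relation.Nullary.Negation using (contradiction)

  module _ (balanced : ∀ i → sum (A i) ≡ 0#)
           (one-singleton : ∀ j j′ → (∀ l → j ~ l → l ≡ j) → (∀ l → j′ ~ l → l ≡ j′) → j ≡ j′)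
           (no-cancelling-pair : ∀ j j′ → j ≢ j′ → j ~ j′ → (∀ l → j ~ l → l ≡ j ⊎ l ≡ j′) →
              ¬ (∀ i → A i j + A i j′ ≡ 0#)) where

    private
      -- Coefficients of Σ ratio j * x j = classTotal c * y, the sum being over the
      -- class c, where the centre y is variable 0 and shared by all classes.
      coefficients : Fin k → Fin (suc k) → Scalar
      coefficients c = - classTotal c ∷ classRatio c

      special? : ∀ c → Dec (support (coefficients c) ≡ 2)
      special? c = support (coefficients c) ℕ.≟ 2

      in-class : ∀ {c j} → nonzero (classRatio c j) ≢ 0 → rep j ≡ c
      in-class ≢0 = classRatio-nonzero (nonzero≢0 ≢0)

      in-class′ : ∀ {c j} → rep j ≡ c → nonzero (classRatio c j) ≢ 0
      in-class′ {c} {j} eq = nonzero≢0′ (λ ≡0 → ratio≢0 j (trans (sym (classRatio-in eq)) ≡0))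

      -- If the class total is nonzero, the centre takes up one of the two nonzero coefficients and
      -- a single member is left. If it is zero, there are two members with opposite ratios, hence
      -- opposite columns, which is excluded.
      special-singleton : ∀ {c} → support (coefficients c) ≡ 2 → ∃[ j ] (rep j ≡ c × (∀ l → rep l ≡ c → l ≡ j))
      special-singleton {c} eq = cases (classTotal c ≟ᶠ 0#)
        where
        cases : Dec (classTotal c ≡ 0#) → ∃[ j ] (rep j ≡ c × (∀ l → rep l ≡ c → l ≡ j))
        cases (no ≢0) =
          let j , in-j , unique = single-term (λ j → nonzero (classRatio c j)) (λ j → nonzero≤1 (classRatio c j))
                (ℕ.suc-injective (trans (cong (ℕ._+ support (classRatio c)) (sym (nonzero-nonzero
                  (λ eq → ≢0 (trans (solve 1 (λ x → x := :0 :- (:- x)) refl (classTotal c))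
                    (trans (cong (λ z → 0# - z) eq) (-‿inverseʳ 0#))))))) eq))
          in j , in-class in-j , λ l rep-l → unique l (in-class′ rep-l)
        cases (yes ≡0)
          with j , j′ , j≢j′ , in-j , in-j′ , cover ← two-terms (λ j → nonzero (classRatio c j)) (λ j → nonzero≤1 (classRatio c j))
                 (trans (cong (ℕ._+ support (classRatio c)) (sym (nonzero-zero
                   (trans (cong -_ ≡0) (solve 0 (:- :0 := :0) refl))))) eq)
          = contradiction cancel (no-cancelling-pair j j′ j≢j′ (rep-injective (trans (in-class in-j) (sym (in-class in-j′))))
              (λ l j~l → cover l (in-class′ (trans (sym (rep-cong j~l)) (in-class in-j)))))
          where
          open ≡-Reasoning
          ratios : ratio j + ratio j′ ≡ 0#
          ratios = begin
            ratio j + ratio j′                       ≡⟨ sym (cong₂ _+_ (classRatio-in (in-class in-j)) (classRatio-in (in-class in-j′))) ⟩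
            classRatio c j + classRatio c j′         ≡⟨ sym (sum-pair (classRatio c) j j′ j≢j′ (λ h h≢j h≢j′ →
                                                          classRatio-out (λ rep-h → Sum.[ h≢j , h≢j′ ] (cover h (in-class′ rep-h))))) ⟩
            classTotal c                             ≡⟨ ≡0 ⟩
            0#                                       ∎
          cancel : ∀ i → A i j + A i j′ ≡ 0#
          cancel i = begin
            A i j + A i j′                                         ≡⟨ cong₂ _+_ (column i j) (column i j′) ⟩
            ratio j * A i (rep j) + ratio j′ * A i (rep j′)        ≡⟨ cong₂ (λ c c′ → ratio j * A i c + ratio j′ * A i c′)
                                                                        (in-class in-j) (in-class in-j′) ⟩
            ratio j * A i c + ratio j′ * A i c                     ≡⟨ sym (distribʳ (A i c) (ratio j) (ratio j′)) ⟩
            (ratio j + ratio j′) * A i c                           ≡⟨ cong (_* A i c) ratios ⟩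
            0# * A i c                                             ≡⟨ zeroˡ (A i c) ⟩
            0#                                                     ∎

      special-unique : ∀ {j j′} → support (coefficients (rep j)) ≡ 2 → support (coefficients (rep j′)) ≡ 2 → j ≡ j′
      special-unique {j} {j′} s s′ = one-singleton j j′ (singleton s) (singleton s′)
        where
        singleton : ∀ {j} → support (coefficients (rep j)) ≡ 2 → ∀ l → j ~ l → l ≡ j
        singleton {j} s l j~l with _ , _ , unique ← special-singleton s =
          trans (unique l (sym (rep-cong j~l))) (sym (unique j refl))

      Places : Set
      Places = ⊤ × Maybe (Fin k × Fin k)

      place : ∀ j → Dec (support (coefficients (rep j)) ≡ 2) → Places
      place j (yes _) = tt , nothing
      place j (no _)  = tt , just (rep j , j)

      place-injective : ∀ {j j′} d d′ → place j d ≡ place j′ d′ → j ≡ j′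
      place-injective (yes s) (yes s′) eq = special-unique s s′
      place-injective (no _)  (no _)   refl = refl
      place-injective (yes _) (no _)   ()
      place-injective (no _)  (yes _)  ()

    no-cancelling-pair⇒forced : Forced (Fin k) System
    no-cancelling-pair⇒forced = reindex (λ j → place j (special? (rep j)))
      (λ {j} {j′} → place-injective (special? (rep j)) (special? (rep j′)))
      (λ {n} {x} (_ , equations) → solves x equations)
      (attach {R = λ _ _ → ⊤} k (λ c → drop (special? c) (coefficients c))
        (λ c → drop-forced (coefficients c) (-‿inverseˡ (classTotal c)) (special? c))
        -- The base configuration is one arbitrary point, the common centre.
        (reindex (λ _ → zero) (λ _ → refl) (λ t → t) (forced-free 1)))
      where
      open ≡-Reasoning
      solves : ∀ {n} (x : Places → Point n) →
        (∀ c j → Equation (drop (special? c) (coefficients c)) n (x (j , nothing) ∷ λ i → x (j , just (c , i)))) →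
        System n (λ j → x (place j (special? (rep j))))
      solves x equations i t = begin
        sum (λ j → A i j * value j)             ≡⟨ sum-by-classes i value (λ c → classTotal c * y) class-sum ⟩
        sum (λ c → A i c * (classTotal c * y))  ≡⟨ sum-cong-≗ {k} (λ c → sym (*-assoc (A i c) (classTotal c) y)) ⟩
        sum (λ c → A i c * classTotal c * y)    ≡⟨ sym (*-distribʳ-sum y (λ c → A i c * classTotal c)) ⟩
        -- The sum over classes is the row sum, regrouped with every variable set to 1.
        sum (λ c → A i c * classTotal c) * y    ≡⟨ cong (_* y) (sym (sum-by-classes i (λ _ → 1#) classTotal
                                                     (λ c → sum-cong-≗ {k} (λ j → *-identityʳ (classRatio c j))))) ⟩
        sum (λ j → A i j * 1#) * y              ≡⟨ cong (_* y) (sum-cong-≗ {k} (λ j → *-identityʳ (A i j))) ⟩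
        sum (A i) * y                           ≡⟨ cong (_* y) (balanced i) ⟩
        0# * y                                  ≡⟨ zeroˡ y ⟩
        0#                                      ∎
        where
        y = lookup (x (tt , nothing)) t
        value : Fin k → Scalar
        value j = lookup (x (place j (special? (rep j)))) t
        placeIn : ∀ c j → Dec (support (coefficients c) ≡ 2) → Places
        placeIn c j (yes _) = tt , nothing
        placeIn c j (no _)  = tt , just (c , j)
        place-placeIn : ∀ {c j} → rep j ≡ c → place j (special? (rep j)) ≡ placeIn c j (special? c)
        place-placeIn {j = j} refl with special? (rep j)
        ... | yes _ = refl
        ... | no _ = refl
        class-equation : ∀ c d → Equation (drop d (coefficients c)) _ (x (tt , nothing) ∷ λ j → x (tt , just (c , j))) →
          sum (λ j → classRatio c j * lookup (x (placeIn c j d)) t) ≡ classTotal c * y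
        -- The equation has been dropped, but all variables of the class are at y, so it holds
        -- trivially.
        class-equation c (yes _) eq = sym (*-distribʳ-sum y (classRatio c))
        class-equation c (no _)  eq = difference-zero (trans
          (solve 3 (λ s l y → s :- l :* y := (:- l) :* y :+ s) refl _ (classTotal c) y) (eq t))
        class-sum : ∀ c → sum (λ j → classRatio c j * value j) ≡ classTotal c * y
        class-sum c = trans
          (sum-cong-≗ {k} (λ j → classRatio-cong {c} {j} (λ rep-j → cong (λ h → lookup (x h) t) (place-placeIn rep-j))))
          (class-equation c (special? c) (equations c tt))

-- Case (ii): every class sums to zero

module CancellingClasses (K : FinField) {m k : ℕ} (A : Fin m → Fin k → FinField.Scalar K)
                         (column≢0 : ∀ j → ∃[ i ] (A i j ≢ FinField.0# K)) where
  open FieldLemmas K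
  open LinearAlgebra K
  open ForcedConfigurations K
  open Monomials K using (Point)
  open Differences K
  open Equations K
  open ColumnClasses K A column≢0
  open Counting using (single-term)
  open import Data.Bool.Base using (Bool; true; false)
  open import Data.Fin.Properties using () renaming (_≟_ to _≟ᶠ_)
  open import Data.Maybe.Base using (Maybe; just; nothing)
  open import Data.Product using (Σ-syntax; proj₁; proj₂)
  open import Data.Sum using (inj₁; inj₂)
  open import Data.Vec.Base using (lookup)
  open import Data.Vec.Functional using (_∷_)
  open import Function.Base using (_∘_)
  open import Relation.Binary.PropositionalEquality using (refl; sym; trans; cong; cong₂; module ≡-Reasoning)
  open import Relation.Nullary using (Dec; yes; no; ¬?)
  open import Relation.Nullary.Decidable using (decidable-stable)
  open import Relation.Nullary.Negation using (contradiction)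

  private
    all-or-any : ∀ {l} {P Q : Fin l → Set} → (∀ c → P c ⊎ Q c) → (∀ c → P c) ⊎ (∃[ c ] Q c)
    all-or-any {zero} f = inj₁ λ ()
    all-or-any {suc l} f with f zero | all-or-any (f ∘ suc)
    ... | inj₂ q | _              = inj₂ (zero , q)
    ... | inj₁ _ | inj₂ (c , q)   = inj₂ (suc c , q)
    ... | inj₁ p | inj₁ ps        = inj₁ λ { zero → p ; (suc c) → ps c }

    sum-split : ∀ {l} (f : Fin l → Scalar) i → sum f ≡ f i + sum (λ j → when (¬? (i ≟ᶠ j)) (f j))
    sum-split {l} f i = trans (sum-cong-≗ {l} split) (trans
      (∑-distrib-+ (λ j → when (i ≟ᶠ j) (f j)) (λ j → when (¬? (i ≟ᶠ j)) (f j)))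
      (cong (_+ sum (λ j → when (¬? (i ≟ᶠ j)) (f j))) (sum-when f i)))
      where
      split : ∀ j → f j ≡ when (i ≟ᶠ j) (f j) + when (¬? (i ≟ᶠ j)) (f j)
      split j with i ≟ᶠ j
      ... | yes _ = sym (+-identityʳ (f j))
      ... | no _  = sym (+-identityˡ (f j))

  module _ (class-sums : ∀ c i → sum (λ j → when (c ~? j) (A i j)) ≡ 0#)
           (inseparable : ∀ c w → (∀ j → ¬ (c ~ j) → dot w (λ i → A i j) ≡ 0#) →
              dot w (λ i → A i c) ≢ 0# → ∀ j → c ~ j) where

    private
      class-empty : ∀ {c} → rep c ≢ c → ∀ j → rep j ≢ c
      class-empty rep-c≢c j refl = rep-c≢c (rep-rep j)

      -- `ratio` is read off from an arbitrary witness of equivalence; that it is 1 at a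
      -- representative follows by cancelling a nonzero entry of the column.
      ratio-rep : ∀ {c} → rep c ≡ c → ratio c ≡ 1#
      ratio-rep {c} rep-c = difference-zero (zero-product (proj₂ (column≢0 c)) (begin
          A i c * (ratio c - 1#)         ≡⟨ solve 2 (λ a r → a :* (r :- :1) := r :* a :- a) refl (A i c) (ratio c) ⟩
          ratio c * A i c - A i c        ≡⟨ cong (_- A i c) (trans (cong (λ h → ratio c * A i h) (sym rep-c)) (sym (column i c))) ⟩
          A i c - A i c                  ≡⟨ -‿inverseʳ (A i c) ⟩
          0#                             ∎))
        where
        open ≡-Reasoning
        i = proj₁ (column≢0 c)

      classRatio-rep : ∀ {c} → rep c ≡ c → classRatio c c ≡ 1#
      classRatio-rep rep-c = trans (classRatio-in rep-c) (ratio-rep rep-c)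

      classTotal-zero : ∀ c → classTotal c ≡ 0#
      classTotal-zero c = cases (rep c ≟ᶠ c)
        where
        open ≡-Reasoning
        cases : Dec (rep c ≡ c) → classTotal c ≡ 0#
        cases (no ≢c)    = sum-zero {k} (λ j → classRatio-out {c} {j} (class-empty ≢c j))
        cases (yes rep-c) = zero-product (proj₂ (column≢0 c)) (begin
            A i c * classTotal c                      ≡⟨ *-distribˡ-sum (A i c) (classRatio c) ⟩
            sum (λ j → A i c * classRatio c j)        ≡⟨ sum-cong-≗ {k} member ⟩
            sum (λ j → when (c ~? j) (A i j))         ≡⟨ class-sums c i ⟩
            0#                                        ∎)
          where
          i = proj₁ (column≢0 c)
          member : ∀ j → A i c * classRatio c j ≡ when (c ~? j) (A i j)
          member j = by (c ~? j)
            where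
            by : (d : Dec (c ~ j)) → A i c * classRatio c j ≡ when d (A i j)
            by (yes c~j) = let rep-j = trans (sym (rep-cong c~j)) rep-c in begin
              A i c * classRatio c j      ≡⟨ cong (A i c *_) (classRatio-in rep-j) ⟩
              A i c * ratio j             ≡⟨ *-comm (A i c) (ratio j) ⟩
              ratio j * A i c             ≡⟨ cong (λ h → ratio j * A i h) (sym rep-j) ⟩
              ratio j * A i (rep j)       ≡⟨ sym (column i j) ⟩
              A i j                       ∎
            by (no c≁j) = trans (cong (A i c *_) (classRatio-out (λ rep-j → c≁j (rep-injective (trans rep-c (sym rep-j))))))
              (zeroʳ (A i c))

      -- The matrix of class columns, padded with zero columns at the indices that represent no
      -- class. A zero column is never isolated, so the padding does not affect the alternative.
      V : Fin m → Fin k → Scalar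
      V i c = when (rep c ≟ᶠ c) (A i c)

      V-rep : ∀ i {c} → rep c ≡ c → V i c ≡ A i c
      V-rep i {c} = when-true (rep c ≟ᶠ c)

    -- An isolated class column leaves only one class, so all equations are multiples of the one
    -- with coefficients `ratio`, which is balanced because the class sums to zero. The result on
    -- such equations is an argument because it concerns k of the form 3 + k₀.
    isolated-forced : (∀ (a : Fin k → Scalar) → (∀ i → a i ≢ 0#) → sum a ≡ 0# → Forced (Fin k) (Equation a)) →
      ∀ c w → (∀ j → j ≢ c → dot w (λ i → V i j) ≡ 0#) → dot w (λ i → V i c) ≡ 1# → Forced (Fin k) System
    isolated-forced nonzero-equation c w w·V w·Vc = reindex (λ j → j) (λ eq → eq) (λ {n} {x} → solves {n} {x})
      (nonzero-equation ratio ratio≢0 (trans (sym (sum-cong-≗ {k} λ j → classRatio-in (all-in-class j))) (classTotal-zero c)))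
      where
      open ≡-Reasoning
      -- The product of `w` with column `c` is 1, so this column is not one of the padding zeros.
      rep-c : rep c ≡ c
      rep-c = decidable-stable (rep c ≟ᶠ c) λ ≢c → 1≢0 (trans (sym w·Vc)
        (sum-zero {m} λ i → trans (cong (w i *_) (when-false (rep c ≟ᶠ c) ≢c)) (zeroʳ (w i))))
      other-columns : ∀ j → ¬ (c ~ j) → dot w (λ i → A i j) ≡ 0#
      other-columns j c≁j = begin
        dot w (λ i → A i j)                          ≡⟨ sum-cong-≗ {m} (λ i → trans (cong (w i *_) (trans (column i j)
                                                          (cong (ratio j *_) (sym (V-rep i (rep-rep j))))))
                                                          (solve 3 (λ w r a → w :* (r :* a) := r :* (w :* a)) refl (w i) (ratio j) (V i (rep j)))) ⟩
        sum (λ i → ratio j * (w i * V i (rep j)))    ≡⟨ sym (*-distribˡ-sum (ratio j) (λ i → w i * V i (rep j))) ⟩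
        ratio j * dot w (λ i → V i (rep j))          ≡⟨ cong (ratio j *_) (w·V (rep j) (λ eq → c≁j (rep-injective (trans rep-c (sym eq))))) ⟩
        ratio j * 0#                                 ≡⟨ zeroʳ (ratio j) ⟩
        0#                                           ∎
      all-in-class : ∀ j → rep j ≡ c
      all-in-class j = trans (sym (rep-cong (inseparable c w other-columns
        (λ eq → 1≢0 (trans (sym w·Vc) (trans (sum-cong-≗ {m} (λ i → cong (w i *_) (V-rep i rep-c))) eq))) j))) rep-c
      solves : ∀ {n} {x : Fin k → Point n} → Equation ratio n x → System n x
      solves {x = x} eq i t = begin
        sum (λ j → A i j * lookup (x j) t)              ≡⟨ sum-cong-≗ {k} (λ j → trans (cong (_* lookup (x j) t)
                                                             (trans (column i j) (cong (λ h → ratio j * A i h) (all-in-class j))))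
                                                             (solve 3 (λ r a y → r :* a :* y := a :* (r :* y)) refl (ratio j) (A i c) (lookup (x j) t))) ⟩
        sum (λ j → A i c * (ratio j * lookup (x j) t))  ≡⟨ sym (*-distribˡ-sum (A i c) (λ j → ratio j * lookup (x j) t)) ⟩
        A i c * sum (λ j → ratio j * lookup (x j) t)    ≡⟨ cong (A i c *_) (eq t) ⟩
        A i c * 0#                                      ≡⟨ zeroʳ (A i c) ⟩
        0#                                              ∎

    -- The difference x (c , false) - x (c , true) replaces the class of c: its
    -- first variable is x (c , false), and the others have x (c , true) as weighted mean.
    private
      remainder : Fin k → Fin k → Scalar
      remainder c j = when (¬? (c ≟ᶠ j)) (classRatio c j)

      coefficients : Fin k → Fin (suc k) → Scalar
      coefficients c = classRatio c c ∷ remainder c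

      coefficients-sum : ∀ c → sum (coefficients c) ≡ 0#
      coefficients-sum c = trans (sym (sum-split (classRatio c) c)) (classTotal-zero c)

      special? : ∀ c → Dec (support (coefficients c) ≡ 2)
      special? c = support (coefficients c) ℕ.≟ 2

      remainder-in : ∀ {c j} → rep j ≡ c → c ≢ j → nonzero (remainder c j) ≢ 0
      remainder-in {c} {j} rep-j c≢j = nonzero≢0′ (λ eq → ratio≢0 j (trans (sym (classRatio-in rep-j))
        (trans (sym (when-true (¬? (c ≟ᶠ j)) c≢j)) eq)))

      -- The representative has coefficient 1, so support 2 leaves one further member. Being the
      -- only one, it can be placed at the centre without colliding with another variable.
      special-unique : ∀ {c j j′} → rep c ≡ c → support (coefficients c) ≡ 2 →
        rep j ≡ c → rep j′ ≡ c → c ≢ j → c ≢ j′ → j ≡ j′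
      special-unique {c} rep-c s rep-j rep-j′ c≢j c≢j′
        with _ , _ , unique ← single-term (λ j → nonzero (remainder c j)) (λ j → nonzero≤1 (remainder c j))
               (ℕ.suc-injective (trans (cong (ℕ._+ support (remainder c)) (sym (nonzero-nonzero
                 (λ eq → 1≢0 (trans (sym (classRatio-rep rep-c)) eq))))) s))
        = trans (unique _ (remainder-in rep-j c≢j)) (sym (unique _ (remainder-in rep-j′ c≢j′)))

      Places : Set
      Places = (Fin k × Bool) × Maybe (Fin k × Fin k)

      placeIn : ∀ c → Fin k → Dec (support (coefficients c) ≡ 2) → Places
      placeIn c j (yes _) = (c , true) , nothing
      placeIn c j (no _)  = (c , true) , just (c , j)

      place : ∀ j → Dec (rep j ≡ j) → Places
      place j (yes _) = (j , false) , nothing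
      place j (no _)  = placeIn (rep j) j (special? (rep j))

      placeIn-side : ∀ c j d → proj₂ (proj₁ (placeIn c j d)) ≡ true
      placeIn-side c j (yes _) = refl
      placeIn-side c j (no _)  = refl

      placeIn-class : ∀ c j d → proj₁ (proj₁ (placeIn c j d)) ≡ c
      placeIn-class c j (yes _) = refl
      placeIn-class c j (no _)  = refl

      placeIn-injective : ∀ {c j j′} d → rep c ≡ c → rep j ≡ c → rep j′ ≡ c → c ≢ j → c ≢ j′ →
        placeIn c j d ≡ placeIn c j′ d → j ≡ j′
      placeIn-injective (yes s) rep-c rep-j rep-j′ c≢j c≢j′ eq = special-unique rep-c s rep-j rep-j′ c≢j c≢j′
      placeIn-injective (no _)  rep-c rep-j rep-j′ c≢j c≢j′ refl = refl

      place-injective : ∀ {j j′} d d′ → place j d ≡ place j′ d′ → j ≡ j′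
      place-injective (yes _) (yes _) refl = refl
      place-injective {j} {j′} (yes _) (no _) eq = contradiction
        (trans (cong (proj₂ ∘ proj₁) eq) (placeIn-side (rep j′) j′ (special? (rep j′)))) λ ()
      place-injective {j} {j′} (no _) (yes _) eq = contradiction
        (trans (sym (placeIn-side (rep j) j (special? (rep j)))) (cong (proj₂ ∘ proj₁) eq)) λ ()
      place-injective {j} {j′} (no ≢j) (no ≢j′) eq = same-class (rep j) (rep j′) refl refl ≢j ≢j′ eq
        (trans (sym (placeIn-class (rep j) j (special? (rep j))))
          (trans (cong (proj₁ ∘ proj₁) eq) (placeIn-class (rep j′) j′ (special? (rep j′)))))
        where
        same-class : ∀ c c′ → rep j ≡ c → rep j′ ≡ c′ → c ≢ j → c′ ≢ j′ →
          placeIn c j (special? c) ≡ placeIn c′ j′ (special? c′) → c ≡ c′ → j ≡ j′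
        same-class c c rep-j rep-j′ c≢j c≢j′ eq refl =
          placeIn-injective (special? c) (trans (cong rep (sym rep-j)) (trans (rep-rep j) rep-j)) rep-j rep-j′ c≢j c≢j′ eq

    differences-forced : Forced (Fin k × Bool) (DifferenceEquations V) → Forced (Fin k) System
    differences-forced differences = reindex (λ j → place j (rep j ≟ᶠ j))
      (λ {j} {j′} → place-injective (rep j ≟ᶠ j) (rep j′ ≟ᶠ j′))
      (λ {n} {x} (difference-eqs , class-eqs) → solves x difference-eqs class-eqs)
      (attach {R = DifferenceEquations V} k (λ c → drop (special? c) (coefficients c))
        (λ c → drop-forced (coefficients c) (coefficients-sum c) (special? c)) differences)
      where
      open ≡-Reasoning
      solves : ∀ {n} (x : Places → Point n) → DifferenceEquations V n (λ j → x (j , nothing)) →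
        (∀ c j → Equation (drop (special? c) (coefficients c)) n (x (j , nothing) ∷ λ i → x (j , just (c , i)))) →
        System n (λ j → x (place j (rep j ≟ᶠ j)))
      solves x difference-eqs class-eqs i t = begin
        sum (λ j → A i j * value j)                                     ≡⟨ sum-by-classes i value
                                                                             (λ c → when (rep c ≟ᶠ c) (first c - second c)) class-sum ⟩
        sum (λ c → A i c * when (rep c ≟ᶠ c) (first c - second c))      ≡⟨ sum-cong-≗ {k} (λ c → swap (rep c ≟ᶠ c) (A i c) _) ⟩
        sum (λ c → V i c * (first c - second c))                        ≡⟨ difference-eqs i t ⟩
        0#                                                              ∎
        where
        first second value : Fin k → Scalar
        first c  = lookup (x ((c , false) , nothing)) t
        second c = lookup (x ((c , true) , nothing)) t
        value j  = lookup (x (place j (rep j ≟ᶠ j))) t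
        swap : ∀ {P : Set} (d : Dec P) a y → a * when d y ≡ when d a * y
        swap (yes _) a y = refl
        swap (no _)  a y = trans (zeroʳ a) (sym (zeroˡ y))
        place-first : ∀ {c} → rep c ≡ c → ∀ d → place c d ≡ ((c , false) , nothing)
        place-first rep-c (yes _) = refl
        place-first rep-c (no ≢)  = contradiction rep-c ≢
        place-other : ∀ {c j} → rep j ≡ c → c ≢ j → ∀ d → place j d ≡ placeIn c j (special? c)
        place-other refl c≢j (yes eq) = contradiction eq c≢j
        place-other refl c≢j (no _)   = refl
        others : ∀ c j → when (¬? (c ≟ᶠ j)) (classRatio c j * value j) ≡
          remainder c j * lookup (x (placeIn c j (special? c))) t
        others c j with c ≟ᶠ j
        ... | yes _ = sym (zeroˡ _)
        ... | no c≢j = classRatio-cong {c} {j} (λ rep-j →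
          cong (λ h → lookup (x h) t) (place-other rep-j c≢j (rep j ≟ᶠ j)))
        class-equation : ∀ c d → Equation (drop d (coefficients c)) _ (x ((c , true) , nothing) ∷ λ j → x ((c , true) , just (c , j))) →
          classRatio c c * second c + sum (λ j → remainder c j * lookup (x (placeIn c j d)) t) ≡ 0#
        class-equation c (no _)  eq = eq t
        -- The equation has been dropped; with the other variables of the class at the centre, it
        -- holds because the coefficients sum to zero.
        class-equation c (yes _) eq = begin
          classRatio c c * second c + sum (λ j → remainder c j * second c)
            ≡⟨ cong (classRatio c c * second c +_) (sym (*-distribʳ-sum (second c) (remainder c))) ⟩
          classRatio c c * second c + sum (remainder c) * second c
            ≡⟨ sym (distribʳ (second c) (classRatio c c) (sum (remainder c))) ⟩
          sum (coefficients c) * second c   ≡⟨ cong (_* second c) (coefficients-sum c) ⟩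
          0# * second c                     ≡⟨ zeroˡ (second c) ⟩
          0#                                ∎
        class-sum : ∀ c → sum (λ j → classRatio c j * value j) ≡ when (rep c ≟ᶠ c) (first c - second c)
        class-sum c = cases (rep c ≟ᶠ c)
          where
          rest : Scalar
          rest = sum (λ j → remainder c j * lookup (x (placeIn c j (special? c))) t)
          cases : (d : Dec (rep c ≡ c)) → sum (λ j → classRatio c j * value j) ≡ when d (first c - second c)
          cases (no ≢c) = sum-zero {k} (λ j → trans (cong (_* value j) (classRatio-out (class-empty ≢c j))) (zeroˡ (value j)))
          cases (yes rep-c) = begin
            sum (λ j → classRatio c j * value j)
              ≡⟨ sum-split (λ j → classRatio c j * value j) c ⟩
            classRatio c c * value c + sum (λ j → when (¬? (c ≟ᶠ j)) (classRatio c j * value j))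
              ≡⟨ cong₂ _+_ (cong₂ _*_ (classRatio-rep rep-c) (cong (λ h → lookup (x h) t) (place-first rep-c (rep c ≟ᶠ c))))
                   (sum-cong-≗ {k} (others c)) ⟩
            1# * first c + rest
              -- The other variables contribute minus the centre by the equation of the class, so
              -- the centre is added and subtracted.
              ≡⟨ solve 3 (λ f s r → :1 :* f :+ r := (f :- s) :+ (:1 :* s :+ r)) refl (first c) (second c) rest ⟩
            first c - second c + (1# * second c + rest)
              ≡⟨ cong (λ z → first c - second c + (z * second c + rest)) (sym (classRatio-rep rep-c)) ⟩
            first c - second c + (classRatio c c * second c + rest)
              ≡⟨ cong (first c - second c +_) (class-equation c (special? c) (class-eqs c (c , true))) ⟩
            first c - second c + 0#
              ≡⟨ +-identityʳ (first c - second c) ⟩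
            first c - second c ∎

    cancelling-classes-forced : ∀ k₀ → k ≡ 3 ℕ.+ k₀ → Forced (Fin k) System
    cancelling-classes-forced k₀ refl = cases (all-or-any (related-or-isolated V))
      where
      cases : (∀ c → Related V c) ⊎ (∃[ c ] Isolated V c) → Forced (Fin k) System
      cases (inj₁ related) = differences-forced
        (differences V (λ c → proj₁ (related c)) (λ c → proj₁ (proj₂ (related c))) (λ c → proj₂ (proj₂ (related c))))
      cases (inj₂ (c , w , w·V , w·Vc)) = isolated-forced (nonzero-equation k₀) c w w·V w·Vc

-- From integral to rational rates

module RationalRates where
  import Data.Integer.Base as ℤ
  open ℤ using (+_)
  import Data.Integer.Properties as ℤ
  import Data.Nat.Coprimality as Coprime
  open import Data.Rational.Base as ℚ using (ℚ; mkℚ; 0ℚ; 1/_)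
  import Data.Rational.Properties as ℚ
  open import Relation.Binary.PropositionalEquality using (refl; sym; trans; cong; cong₂; subst₂; module ≡-Reasoning)

  private
    -- The explicit normal form of n / 1, on which order and multiplication compute for a variable
    -- n, unlike on the normalised quotient `ℕ→ℚ n`.
    whole : ℕ → ℚ
    whole n = mkℚ (+ n) 0 (Coprime.sym (Coprime.1-coprimeTo n))

    ℕ→ℚ≡whole : ∀ n → ℕ→ℚ n ≡ whole n
    ℕ→ℚ≡whole n = ℚ.normalize-coprime (Coprime.sym (Coprime.1-coprimeTo n))

  ℕ→ℚ-* : ∀ m n → ℕ→ℚ (m ℕ.* n) ≡ ℕ→ℚ m ℚ.* ℕ→ℚ n
  ℕ→ℚ-* m n = trans (cong (λ z → z ℚ./ 1) (ℤ.pos-* m n)) (sym (cong₂ ℚ._*_ (ℕ→ℚ≡whole m) (ℕ→ℚ≡whole n)))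

  ℕ→ℚ-cancel-≤ : ∀ {m n} → ℕ→ℚ m ℚ.≤ ℕ→ℚ n → m ℕ.≤ n
  ℕ→ℚ-cancel-≤ {m} {n} le with subst₂ ℚ._≤_ (ℕ→ℚ≡whole m) (ℕ→ℚ≡whole n) le
  ... | ℚ.*≤* le′ = ℤ.drop‿+≤+ (subst₂ ℤ._≤_ (ℤ.*-identityʳ (+ m)) (ℤ.*-identityʳ (+ n)) le′)

  ℕ→ℚ-mono-< : ∀ {m n} → m ℕ.< n → ℕ→ℚ m ℚ.< ℕ→ℚ n
  ℕ→ℚ-mono-< {m} {n} lt = subst₂ ℚ._<_ (sym (ℕ→ℚ≡whole m)) (sym (ℕ→ℚ≡whole n))
    (ℚ.*<* (subst₂ ℤ._<_ (sym (ℤ.*-identityʳ (+ m))) (sym (ℤ.*-identityʳ (+ n))) (ℤ.+<+ lt)))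

  private
    ℕ→ℚ-positive : ∀ {n} → 0 ℕ.< n → ℚ.Positive (ℕ→ℚ n)
    ℕ→ℚ-positive 0<n = ℚ.positive (ℕ→ℚ-mono-< 0<n)

  module _ {q N} (g : GrowsBelow q N) where
    open GrowsBelow g

    private
      instance
        Q-positive : ℚ.Positive (ℕ→ℚ Q)
        Q-positive = ℕ→ℚ-positive 0<Q

        Q-nonNegative : ℚ.NonNegative (ℕ→ℚ Q)
        Q-nonNegative = ℚ.pos⇒nonNeg (ℕ→ℚ Q)

        Q-nonZero : ℚ.NonZero (ℕ→ℚ Q)
        Q-nonZero = ℚ.pos⇒nonZero (ℕ→ℚ Q)

    γ : ℚ
    γ = ℕ→ℚ P ℚ.* 1/ ℕ→ℚ Q

    private
      γQ : γ ℚ.* ℕ→ℚ Q ≡ ℕ→ℚ P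
      γQ = trans (ℚ.*-assoc (ℕ→ℚ P) (1/ ℕ→ℚ Q) (ℕ→ℚ Q))
        (trans (cong (ℕ→ℚ P ℚ.*_) (ℚ.*-inverseˡ (ℕ→ℚ Q))) (ℚ.*-identityʳ (ℕ→ℚ P)))

      interchange : ∀ a b c d → (a ℚ.* b) ℚ.* (c ℚ.* d) ≡ (a ℚ.* c) ℚ.* (b ℚ.* d)
      interchange a b c d = trans (ℚ.*-assoc a b (c ℚ.* d)) (trans (cong (a ℚ.*_) (trans (sym (ℚ.*-assoc b c d))
        (trans (cong (ℚ._* d) (ℚ.*-comm b c)) (ℚ.*-assoc c b d)))) (sym (ℚ.*-assoc a c (b ℚ.* d))))

      γQ^ : ∀ n → (γ ^ℚ n) ℚ.* ℕ→ℚ (Q ℕ.^ n) ≡ ℕ→ℚ (P ℕ.^ n)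
      γQ^ zero = refl
      γQ^ (suc n) = begin
        γ ℚ.* (γ ^ℚ n) ℚ.* ℕ→ℚ (Q ℕ.* Q ℕ.^ n)            ≡⟨ cong (γ ℚ.* (γ ^ℚ n) ℚ.*_) (ℕ→ℚ-* Q (Q ℕ.^ n)) ⟩
        γ ℚ.* (γ ^ℚ n) ℚ.* (ℕ→ℚ Q ℚ.* ℕ→ℚ (Q ℕ.^ n))      ≡⟨ interchange γ (γ ^ℚ n) (ℕ→ℚ Q) (ℕ→ℚ (Q ℕ.^ n)) ⟩
        γ ℚ.* ℕ→ℚ Q ℚ.* ((γ ^ℚ n) ℚ.* ℕ→ℚ (Q ℕ.^ n))      ≡⟨ cong₂ ℚ._*_ γQ (γQ^ n) ⟩
        ℕ→ℚ P ℚ.* ℕ→ℚ (P ℕ.^ n)                           ≡⟨ sym (ℕ→ℚ-* P (P ℕ.^ n)) ⟩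
        ℕ→ℚ (P ℕ.* P ℕ.^ n)                               ∎
        where open ≡-Reasoning

    0<γ : 0ℚ ℚ.< γ
    0<γ = ℚ.*-cancelʳ-<-nonNeg (ℕ→ℚ Q) (subst₂ ℚ._<_ (sym (ℚ.*-zeroˡ (ℕ→ℚ Q))) (sym γQ)
      (ℕ→ℚ-mono-< (ℕ.<-≤-trans 0<Q Q≤P)))

    γ<q : γ ℚ.< ℕ→ℚ q
    γ<q = ℚ.*-cancelʳ-<-nonNeg (ℕ→ℚ Q) (subst₂ ℚ._<_ (sym γQ) (ℕ→ℚ-* q Q) (ℕ→ℚ-mono-< P<qQ))

    -- The successor makes the constant positive even if `B` is 0.
    β : ℚ
    β = ℕ→ℚ (suc B)

    0<β : 0ℚ ℚ.< β
    0<β = ℕ→ℚ-mono-< {0} {suc B} (ℕ.s≤s ℕ.z≤n)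

    threshold-reached : ∀ n {size} → β ℚ.* (γ ^ℚ n) ℚ.≤ ℕ→ℚ size → N n ℕ.≤ size
    threshold-reached n {size} le = ℕ.*-cancelʳ-≤ (N n) size (Q ℕ.^ n) ⦃ ℕ.m^n≢0 Q n ⦃ ℕ.>-nonZero 0<Q ⦄ ⦄
      (ℕ.≤-trans (bound n) (ℕ.≤-trans (ℕ.*-monoˡ-≤ (P ℕ.^ n) (ℕ.n≤1+n B)) (ℕ→ℚ-cancel-≤
        (subst₂ ℚ._≤_ scaled (sym (ℕ→ℚ-* size (Q ℕ.^ n)))
          (ℚ.*-monoʳ-≤-nonNeg (ℕ→ℚ (Q ℕ.^ n)) ⦃ Q^n-nonNegative ⦄ le)))))
      where
      Q^n-nonNegative : ℚ.NonNegative (ℕ→ℚ (Q ℕ.^ n))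
      Q^n-nonNegative = ℚ.pos⇒nonNeg (ℕ→ℚ (Q ℕ.^ n)) ⦃ ℕ→ℚ-positive (ℕ.m^n>0 Q ⦃ ℕ.>-nonZero 0<Q ⦄ n) ⦄
      scaled : β ℚ.* (γ ^ℚ n) ℚ.* ℕ→ℚ (Q ℕ.^ n) ≡ ℕ→ℚ (suc B ℕ.* P ℕ.^ n)
      scaled = trans (ℚ.*-assoc β (γ ^ℚ n) _) (trans (cong (β ℚ.*_) (γQ^ n)) (sym (ℕ→ℚ-* (suc B) (P ℕ.^ n))))

module Subsets where
  open import Data.Fin.Subset using (⁅_⁆; _∪_)
  open import Data.Fin.Subset.Properties using (∣⁅x⁆∣≡1; ∪-identityˡ; ∪-identityʳ)
  open import Relation.Binary.PropositionalEquality using (refl; trans; cong)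
  open import Relation.Nullary.Negation using (contradiction)

  ∣pair∣ : ∀ {n} (i j : Fin n) → i ≢ j → ∣ ⁅ i ⁆ ∪ ⁅ j ⁆ ∣ ≡ 2
  ∣pair∣ zero    zero    i≢j = contradiction refl i≢j
  ∣pair∣ zero    (suc j) i≢j = cong suc (trans (cong ∣_∣ (∪-identityˡ ⁅ j ⁆)) (∣⁅x⁆∣≡1 j))
  ∣pair∣ (suc i) zero    i≢j = cong suc (trans (cong ∣_∣ (∪-identityʳ ⁅ i ⁆)) (∣⁅x⁆∣≡1 i))
  ∣pair∣ (suc i) (suc j) i≢j = ∣pair∣ i j (λ eq → i≢j (cong suc eq))

-- Transport of the field to `Fin q`

module Transfer (F : FiniteField) where
  open FiniteField F using (_≈_; enum; enum-inj; enum-sur; 1≉0)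
  private module F = FiniteField F
  open import Algebra.Morphism.Structures using (IsRingMonomorphism)
  import Algebra.Morphism.RingMonomorphism as RingMonomorphism
  open import Data.Fin.Base using (cast)
  open import Data.Fin.Properties using (cast-involutive)
  open import Data.Product using (proj₁; proj₂)
  open import Relation.Binary.PropositionalEquality using (refl; sym; trans; cong)
  open import Relation.Nullary.Negation using (contradiction)

  private
    index : F.Carrier → Fin F.q
    index x = proj₁ (enum-sur x)

    index-cong : ∀ {x y} → x ≈ y → index x ≡ index y
    index-cong {x} {y} x≈y = enum-inj _ _ (F.trans (proj₂ (enum-sur x)) (F.trans x≈y (F.sym (proj₂ (enum-sur y)))))

    at-least-two : ∀ {n} {a b : Fin n} → a ≢ b → ∃[ r ] (n ≡ 2 ℕ.+ r)
    at-least-two {suc zero} {zero} {zero} a≢b = contradiction refl a≢b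
    at-least-two {suc (suc r)} a≢b = r , refl

    order : ∃[ r ] (F.q ≡ 2 ℕ.+ r)
    order = at-least-two {a = index F.1#} {index F.0#} λ eq →
      1≉0 (F.trans (F.sym (proj₂ (enum-sur F.1#))) (F.trans (F.reflexive (cong enum eq)) (proj₂ (enum-sur F.0#))))

  q≡ : F.q ≡ 2 ℕ.+ proj₁ order
  q≡ = proj₂ order

  Scalar = Fin (2 ℕ.+ proj₁ order)

  to : F.Carrier → Scalar
  to x = cast q≡ (index x)

  from : Scalar → F.Carrier
  from a = enum (cast (sym q≡) a)

  from-to : ∀ x → from (to x) ≈ x
  from-to x = F.trans (F.reflexive (cong enum (cast-involutive (sym q≡) q≡ (index x)))) (proj₂ (enum-sur x))

  to-cong : ∀ {x y} → x ≈ y → to x ≡ to y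
  to-cong x≈y = cong (cast q≡) (index-cong x≈y)

  to-injective : ∀ {x y} → to x ≡ to y → x ≈ y
  to-injective {x} {y} eq = F.trans (F.sym (from-to x)) (F.trans (F.reflexive (cong from eq)) (from-to y))

  to-from : ∀ a → to (from a) ≡ a
  to-from a = trans (cong (cast q≡) (enum-inj _ _ (proj₂ (enum-sur (from a))))) (cast-involutive q≡ (sym q≡) a)

  from-injective : ∀ {a b} → from a ≈ from b → a ≡ b
  from-injective {a} {b} eq = trans (sym (to-from a)) (trans (to-cong eq) (to-from b))

  -- The operations are transported along the enumeration, which makes `from` an injective
  -- homomorphism; the ring laws are reflected along it.
  K : FinField
  K = record
    { q-2 = proj₁ order
    ; _+_ = λ a b → to (from a F.+ from b)
    ; _*_ = λ a b → to (from a F.* from b)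
    ; -_ = λ a → to (F.- from a)
    ; 0# = to F.0#
    ; 1# = to F.1#
    ; isCommutativeRing = RingMonomorphism.isCommutativeRing from-monomorphism F.isCommutativeRing
    ; 1≢0 = λ eq → 1≉0 (to-injective eq)
    ; inverse = λ a a≢0 →
        let y , eq = F.inverse (from a) (λ ≈0 → a≢0 (trans (sym (to-from a)) (to-cong ≈0)))
        in to y , to-cong (F.trans (F.*-congˡ (from-to y)) eq)
    }
    where
    rawRing : RawRing 0ℓ 0ℓ
    rawRing = record
      { Carrier = Scalar
      ; _≈_ = _≡_
      ; _+_ = λ a b → to (from a F.+ from b)
      ; _*_ = λ a b → to (from a F.* from b)
      ; -_ = λ a → to (F.- from a)
      ; 0# = to F.0#
      ; 1# = to F.1#
      }
    from-monomorphism : IsRingMonomorphism rawRing F.rawRing from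
    from-monomorphism = record
      { isRingHomomorphism = record
        { isSemiringHomomorphism = record
          { isNearSemiringHomomorphism = record
            { +-isMonoidHomomorphism = record
              { isMagmaHomomorphism = record
                { isRelHomomorphism = record { cong = λ eq → F.reflexive (cong from eq) }
                ; homo = λ _ _ → from-to _
                }
              ; ε-homo = from-to _
              }
            ; *-homo = λ _ _ → from-to _
            }
          ; 1#-homo = from-to _
          }
        ; -‿homo = λ _ → from-to _
        }
      ; injective = from-injective
      }

  module K = FieldLemmas K

  to-+ : ∀ x y → to (x F.+ y) ≡ to x K.+ to y
  to-+ x y = to-cong (F.sym (F.+-cong (from-to x) (from-to y)))

  to-* : ∀ x y → to (x F.* y) ≡ to x K.* to y
  to-* x y = to-cong (F.sym (F.*-cong (from-to x) (from-to y)))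

  to-∑ : ∀ k (f : Fin k → F.Carrier) → to (∑ F k f) ≡ K.sum (λ j → to (f j))
  to-∑ zero    f = refl
  to-∑ (suc k) f = trans (to-+ (f zero) _) (cong (to (f zero) K.+_) (to-∑ k (λ j → f (suc j))))

  to-∑-* : ∀ k (f g : Fin k → F.Carrier) →
    to (∑ F k (λ j → f j F.* g j)) ≡ K.sum (λ j → to (f j) K.* to (g j))
  to-∑-* k f g = trans (to-∑ k _) (K.sum-cong-≗ {k} (λ j → to-* (f j) (g j)))

-- Translation of the hypotheses and of the conclusion

module FieldToScalars (F : FiniteField) {m k : ℕ} (A : Matrix F m k) (nondegenerate : NonDegenerate F A) where
  open Transfer F
  open LinearAlgebra K
  open ForcedConfigurations K using (Forced)
  open Monomials K using (Point)
  private module F = FiniteField F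
  open import Data.Bool.Base using (true; false; if_then_else_)
  open import Data.Bool.Properties using (¬-not)
  open import Data.Fin.Base using (inject≤)
  open import Data.Fin.Properties using (inject≤-injective) renaming (_≟_ to _≟ᶠ_)
  open import Data.Fin.Subset using (Subset; ⁅_⁆; _∪_; _∈_)
  open import Data.Fin.Subset.Properties using (x∈⁅x⁆; x∈⁅y⁆⇒x≡y; ∣⁅x⁆∣≡1; x∈p∪q⁺; x∈p∪q⁻)
  import Data.List.Base as List
  open import Data.List.Membership.Propositional.Properties using (∈-lookup)
  import Data.List.Relation.Unary.All as All
  open import Data.List.Relation.Unary.AllPairs using (_∷_)
  import Data.List.Relation.Unary.Any as Any
  open import Data.Product using (Σ-syntax; proj₁; proj₂)
  open import Data.Sum as Sum using (inj₁; inj₂)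
  import Data.Vec.Base as Vec
  open import Data.Vec.Properties using ([]=⇒lookup; lookup⇒[]=; lookup∘tabulate)
  open import Function.Base using (_∘_)
  open import Function.Bundles using (mk⇔)
  open import Relation.Binary.PropositionalEquality using (refl; sym; trans; cong; cong₂; subst; module ≡-Reasoning)
  open import Relation.Nullary using (Dec; yes; no; does)
  open import Relation.Nullary.Decidable using (decidable-stable)
  open import Relation.Nullary.Negation using (contradiction)

  A′ : Fin m → Fin k → Scalar
  A′ i j = to (A i j)

  column≢0 : ∀ j → ∃[ i ] (A′ i j ≢ K.0#)
  column≢0 j = let i , ≢0 = proj₂ nondegenerate j in i , λ eq → ≢0 (to-injective eq)

  open ColumnClasses K A′ column≢0 using (_~_; _~?_; ~-refl; sum-pair; System)

  to-≢0 : ∀ {a} → a ≢ K.0# → ¬ (from a F.≈ F.0#)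
  to-≢0 {a} a≢0 ≈0 = a≢0 (trans (sym (to-from a)) (to-cong ≈0))

  ~⇒ColEquiv : ∀ {j j′} → j ~ j′ → ColEquiv F A j j′
  ~⇒ColEquiv {j} (c , c≢0 , eq) = from c , to-≢0 c≢0 , λ i → to-injective (trans (eq i)
    (trans (cong (K._* A′ i j) (sym (to-from c))) (sym (to-* (from c) (A i j)))))

  ColEquiv⇒~ : ∀ {j j′} → ColEquiv F A j j′ → j ~ j′
  ColEquiv⇒~ {j} (c , ≢0 , eq) = to c , (λ eq → ≢0 (to-injective eq)) , λ i → trans (to-cong (eq i)) (to-* c (A i j))

  balanced : Balanced F A → ∀ i → K.sum (A′ i) ≡ K.0#
  balanced bal i = trans (sym (to-∑ k (A i))) (to-cong (bal i))

  singleton-class : ∀ j → (∀ l → j ~ l → l ≡ j) → IsColClass F A ⁅ j ⁆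
  singleton-class j alone = j , λ l → mk⇔
    (λ l∈ → subst (ColEquiv F A j) (sym (x∈⁅y⁆⇒x≡y j l∈)) (~⇒ColEquiv ~-refl))
    (λ j~l → subst (_∈ ⁅ j ⁆) (sym (alone l (ColEquiv⇒~ j~l))) (x∈⁅x⁆ j))

  one-singleton : TypeRC F A → ∀ j j′ → (∀ l → j ~ l → l ≡ j) → (∀ l → j′ ~ l → l ≡ j′) → j ≡ j′
  one-singleton (_ , unique) j j′ alone alone′ = x∈⁅y⁆⇒x≡y j′ (subst (j ∈_)
    (unique ⁅ j ⁆ ⁅ j′ ⁆ (singleton-class j alone) (singleton-class j′ alone′) (∣⁅x⁆∣≡1 j) (∣⁅x⁆∣≡1 j′)) (x∈⁅x⁆ j))

  private
    to-if : ∀ b x → to (if b then x else F.0#) ≡ (if b then to x else K.0#)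
    to-if true  x = refl
    to-if false x = refl

    lookup-∈ : ∀ {l} {C : Subset k} → l ∈ C → Vec.lookup C l ≡ true
    lookup-∈ = []=⇒lookup

    lookup-∉ : ∀ {l} {C : Subset k} → ¬ (l ∈ C) → Vec.lookup C l ≡ false
    lookup-∉ {l} {C} l∉C = ¬-not (λ eq → l∉C (lookup⇒[]= l C eq))

    class-sum : ∀ C i → to (∑ F k (λ j → if Vec.lookup C j then A i j else F.0#)) ≡
      K.sum (λ j → if Vec.lookup C j then A′ i j else K.0#)
    class-sum C i = trans (to-∑ k _) (K.sum-cong-≗ {k} (λ j → to-if (Vec.lookup C j) (A i j)))

  no-cancelling-pair : (∀ C → IsColClass F A C → ∣ C ∣ ≡ 2 → ¬ SumsToZero F A C) →
    ∀ j j′ → j ≢ j′ → j ~ j′ → (∀ l → j ~ l → l ≡ j ⊎ l ≡ j′) → ¬ (∀ i → A′ i j K.+ A′ i j′ ≡ K.0#)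
  no-cancelling-pair hyp j j′ j≢j′ j~j′ cover cancel = hyp C isClass (Subsets.∣pair∣ j j′ j≢j′) sums-to-zero
    where
    C : Subset k
    C = ⁅ j ⁆ ∪ ⁅ j′ ⁆
    members : ∀ {l} → l ∈ C → l ≡ j ⊎ l ≡ j′
    members l∈C = Sum.map (x∈⁅y⁆⇒x≡y j) (x∈⁅y⁆⇒x≡y j′) (x∈p∪q⁻ ⁅ j ⁆ ⁅ j′ ⁆ l∈C)
    j∈C : j ∈ C
    j∈C = x∈p∪q⁺ (inj₁ (x∈⁅x⁆ j))
    j′∈C : j′ ∈ C
    j′∈C = x∈p∪q⁺ {p = ⁅ j ⁆} (inj₂ (x∈⁅x⁆ j′))
    isClass : IsColClass F A C
    isClass = j , λ l → mk⇔
      (λ l∈C → Sum.[ (λ { refl → ~⇒ColEquiv ~-refl }) , (λ { refl → ~⇒ColEquiv j~j′ }) ] (members l∈C))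
      (λ j~l → Sum.[ (λ { refl → j∈C }) , (λ { refl → j′∈C }) ] (cover l (ColEquiv⇒~ j~l)))
    sums-to-zero : SumsToZero F A C
    sums-to-zero i = to-injective (begin
      to (∑ F k (λ l → if Vec.lookup C l then A i l else F.0#))         ≡⟨ class-sum C i ⟩
      K.sum entry                                                       ≡⟨ sum-pair entry j j′ j≢j′ (λ h h≢j h≢j′ →
                                                                            cong (λ b → if b then A′ i h else K.0#)
                                                                              (lookup-∉ (λ h∈C → Sum.[ h≢j , h≢j′ ] (members h∈C)))) ⟩
      entry j K.+ entry j′                                              ≡⟨ cong₂ (λ b b′ → (if b then A′ i j else K.0#) K.+
                                                                            (if b′ then A′ i j′ else K.0#)) (lookup-∈ j∈C) (lookup-∈ j′∈C) ⟩
      A′ i j K.+ A′ i j′                                                ≡⟨ cancel i ⟩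
      K.0#                                                              ∎)
      where
      open ≡-Reasoning
      entry : Fin k → Scalar
      entry l = if Vec.lookup C l then A′ i l else K.0#

  class-sums : (∀ C → IsColClass F A C → SumsToZero F A C) →
    ∀ c i → K.sum (λ j → when (c ~? j) (A′ i j)) ≡ K.0#
  class-sums hyp c i = begin
    K.sum (λ j → when (c ~? j) (A′ i j))                             ≡⟨ K.sum-cong-≗ {k} (λ j → trans (when-if (c ~? j) (A′ i j))
                                                                          (cong (λ b → if b then A′ i j else K.0#) (sym (lookup-C j)))) ⟩
    K.sum (λ j → if Vec.lookup C j then A′ i j else K.0#)            ≡⟨ sym (class-sum C i) ⟩
    to (∑ F k (λ j → if Vec.lookup C j then A i j else F.0#))        ≡⟨ to-cong (hyp C isClass i) ⟩
    K.0#                                                             ∎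
    where
    open ≡-Reasoning
    C : Subset k
    C = Vec.tabulate (λ j → does (c ~? j))
    lookup-C : ∀ j → Vec.lookup C j ≡ does (c ~? j)
    lookup-C = lookup∘tabulate (λ j → does (c ~? j))
    when-if : ∀ {P : Set} (d : Dec P) x → when d x ≡ (if does d then x else K.0#)
    when-if (yes _) x = refl
    when-if (no _)  x = refl
    true⇒ : ∀ {P : Set} (d : Dec P) → does d ≡ true → P
    true⇒ (yes p) _ = p
    ⇒true : ∀ {P : Set} (d : Dec P) → P → does d ≡ true
    ⇒true (yes _) p = refl
    ⇒true (no ¬p) p = contradiction p ¬p
    isClass : IsColClass F A C
    isClass = c , λ j → mk⇔
      (λ j∈C → ~⇒ColEquiv (true⇒ (c ~? j) (trans (sym (lookup-C j)) (lookup-∈ j∈C))))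
      (λ c~j → lookup⇒[]= j C (trans (lookup-C j) (⇒true (c ~? j) (ColEquiv⇒~ c~j))))

  -- If w A is supported on the class of c, then clearing column c in the other
  -- rows by means of w A leaves rows that do not use the variables of that class.
  inseparable : Irreducible F A → ∀ c w → (∀ j → ¬ (c ~ j) → dot w (λ i → A′ i j) ≡ K.0#) →
    dot w (λ i → A′ i c) ≢ K.0# → ∀ j → c ~ j
  inseparable irreducible c w supported ≢0 j₀ = decidable-stable (c ~? j₀) λ c≁j₀ → irreducible
    (suc m , B , (B-from-A , A-from-B) , 2 , class , ℕ.≤-refl ,
      (λ { zero → c , class-yes (c ~? c) ~-refl ; (suc zero) → j₀ , class-no (c ~? j₀) c≁j₀ }) ,
      λ { zero → zero , first-row ; (suc i) → suc zero , other-row i })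
    where
    open ≡-Reasoning
    u : Fin k → Scalar
    u j = dot w (λ i → A′ i j)
    d = proj₁ (K.inverse (u c) ≢0)
    κ : Fin m → Scalar
    κ i = A′ i c K.* d
    -- w A becomes an additional row instead of replacing one, which avoids the choice of an i with
    -- w i ≠ 0; the new system need not have independent rows.
    row : Fin (suc m) → Fin m → Scalar
    row zero    = w
    row (suc i) = λ i′ → when (i ≟ᶠ i′) K.1# K.+ K.- κ i K.* w i′
    B : Matrix F (suc m) k
    B i j = ∑ F m (λ i′ → from (row i i′) F.* A i′ j)
    to-B : ∀ i j → to (B i j) ≡ dot (row i) (λ i′ → A′ i′ j)
    to-B i j = trans (to-∑-* m (λ i′ → from (row i i′)) (λ i′ → A i′ j))
      (K.sum-cong-≗ {m} (λ i′ → cong (K._* A′ i′ j) (to-from (row i i′))))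
    dot-unit : ∀ i j → dot (λ i′ → when (i ≟ᶠ i′) K.1#) (λ i′ → A′ i′ j) ≡ A′ i j
    dot-unit i j = trans (K.sum-cong-≗ {m} (λ i′ → trans (K.*-comm _ _) (trans (sym (when-* (i ≟ᶠ i′) (A′ i′ j) K.1#))
      (cong (when (i ≟ᶠ i′)) (K.*-identityʳ (A′ i′ j)))))) (sum-when (λ i′ → A′ i′ j) i)
    to-B-suc : ∀ i j → to (B (suc i) j) ≡ A′ i j K.+ K.- κ i K.* u j
    to-B-suc i j = trans (to-B (suc i) j) (trans
      (dot-combinationˡ (λ i′ → when (i ≟ᶠ i′) K.1#) w (λ i′ → A′ i′ j) (K.- κ i))
      (cong (K._+ K.- κ i K.* u j) (dot-unit i j)))
    B-from-A : RowsCombinationsOf F B A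
    B-from-A i = (λ i′ → from (row i i′)) , λ j → F.refl
    A-from-B : RowsCombinationsOf F A B
    A-from-B i = from ∘ coefficient , λ j → to-injective (sym (begin
        to (∑ F (suc m) (λ i′ → from (coefficient i′) F.* B i′ j))
          ≡⟨ to-∑-* (suc m) (from ∘ coefficient) (λ i′ → B i′ j) ⟩
        K.sum (λ i′ → to (from (coefficient i′)) K.* to (B i′ j))
          ≡⟨ K.sum-cong-≗ {suc m} (λ i′ → cong (K._* to (B i′ j)) (to-from (coefficient i′))) ⟩
        κ i K.* to (B zero j) K.+ K.sum (λ i′ → when (i ≟ᶠ i′) K.1# K.* to (B (suc i′) j))
          ≡⟨ cong₂ K._+_ (cong (κ i K.*_) (to-B zero j)) (trans (K.sum-cong-≗ {m} (λ i′ → trans (K.*-comm _ _)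
               (trans (sym (when-* (i ≟ᶠ i′) (to (B (suc i′) j)) K.1#)) (cong (when (i ≟ᶠ i′)) (K.*-identityʳ _)))))
               (trans (sum-when (λ i′ → to (B (suc i′) j)) i) (to-B-suc i j))) ⟩
        κ i K.* u j K.+ (A′ i j K.+ K.- κ i K.* u j)
          ≡⟨ K.solve 3 (λ κ u a → κ K.:* u K.:+ (a K.:+ (K.:- κ) K.:* u) K.:= a) refl (κ i) (u j) (A′ i j) ⟩
        A′ i j ∎))
      where
      coefficient : Fin (suc m) → Scalar
      coefficient zero     = κ i
      coefficient (suc i′) = when (i ≟ᶠ i′) K.1#
    side : ∀ {j} → Dec (c ~ j) → Fin 2
    side (yes _) = zero
    side (no _)  = suc zero
    class : Fin k → Fin 2
    class j = side (c ~? j)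
    class-yes : ∀ {j} (d : Dec (c ~ j)) → c ~ j → side d ≡ zero
    class-yes (yes _) c~j = refl
    class-yes (no c≁j) c~j = contradiction c~j c≁j
    class-no : ∀ {j} (d : Dec (c ~ j)) → ¬ (c ~ j) → side d ≡ suc zero
    class-no (yes c~j) c≁j = contradiction c~j c≁j
    class-no (no _) c≁j = refl
    first-row : ∀ j → ¬ (B zero j F.≈ F.0#) → class j ≡ zero
    first-row j ≉0 = class-yes (c ~? j) (decidable-stable (c ~? j) λ c≁j →
      ≉0 (to-injective (trans (to-B zero j) (supported j c≁j))))
    other-row : ∀ i j → ¬ (B (suc i) j F.≈ F.0#) → class j ≡ suc zero
    -- The columns in the class of `c` are multiples of column `c`, so they are cleared together
    -- with it.
    other-row i j ≉0 = class-no (c ~? j) λ (r , _ , proportional) → ≉0 (to-injective (begin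
      to (B (suc i) j)
        ≡⟨ to-B-suc i j ⟩
      A′ i j K.+ K.- κ i K.* u j
        ≡⟨ cong₂ (λ a u → a K.+ K.- κ i K.* u) (proportional i) (trans (K.sum-cong-≗ {m} (λ i′ →
             trans (cong (w i′ K.*_) (proportional i′))
               (K.solve 3 (λ w r a → w K.:* (r K.:* a) K.:= r K.:* (w K.:* a)) refl (w i′) r (A′ i′ c))))
             (sym (K.*-distribˡ-sum r (λ i′ → w i′ K.* A′ i′ c)))) ⟩
      r K.* A′ i c K.+ K.- κ i K.* (r K.* u c)
        ≡⟨ K.solve 4 (λ r a d u → r K.:* a K.:+ (K.:- (a K.:* d)) K.:* (r K.:* u) K.:= r K.:* a K.:* (K.:1 K.:- u K.:* d)) refl
             r (A′ i c) d (u c) ⟩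
      r K.* A′ i c K.* (K.1# K.- u c K.* d)
        ≡⟨ cong (λ z → r K.* A′ i c K.* (K.1# K.- z)) (proj₂ (K.inverse (u c) ≢0)) ⟩
      r K.* A′ i c K.* (K.1# K.- K.1#)
        ≡⟨ K.solve 1 (λ x → x K.:* (K.:1 K.:- K.:1) K.:= K.:0) refl (r K.* A′ i c) ⟩
      K.0# ∎))

  private
    distinct-lookup : ∀ {n} {S : List.List (Fin n → F.Carrier)} → DistinctList F S →
      ∀ i j → _≋_ F (List.lookup S i) (List.lookup S j) → i ≡ j
    distinct-lookup (_ ∷ _)        zero    zero    eq = refl
    distinct-lookup (fresh ∷ _)    zero    (suc j) eq = contradiction eq (All.lookup fresh (∈-lookup j))
    distinct-lookup (fresh ∷ _)    (suc i) zero    eq = contradiction (λ t → F.sym (eq t)) (All.lookup fresh (∈-lookup i))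
    distinct-lookup (_ ∷ distinct) (suc i) (suc j) eq = cong suc (distinct-lookup distinct i j eq)

  forced⇒moderate : Forced (Fin k) System → Moderate F A
  forced⇒moderate forced = RationalRates.β below , RationalRates.γ below ,
    RationalRates.0<β below , RationalRates.0<γ below ,
    subst (λ q → RationalRates.γ below ℚ.< ℕ→ℚ q) (sym q≡) (RationalRates.γ<q below) ,
    λ n S distinct large → solution S distinct (RationalRates.threshold-reached below n large)
    where
    import Data.Rational.Base as ℚ
    open Forced forced
    solution : ∀ {n} (S : List.List (Fin n → F.Carrier)) → DistinctList F S → threshold n ℕ.≤ List.length S →
      Σ[ x ∈ (Fin k → Fin n → F.Carrier) ]
        ((∀ j → _∈S_ F (x j) S) × (∀ j j′ → j ≢ j′ → ¬ (_≋_ F (x j) (x j′))) × IsSolution F A x)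
    solution {n} S distinct enough = x , x∈S , x-distinct , x-solves
      where
      vector : Fin (threshold n) → Fin n → F.Carrier
      -- `find` takes exactly `threshold n` points, so an initial part of `S` suffices.
      vector i = List.lookup S (inject≤ i enough)
      point : Fin (threshold n) → Point n
      point i = Vec.tabulate (λ t → to (vector i t))
      lookup-point : ∀ i t → Vec.lookup (point i) t ≡ to (vector i t)
      lookup-point i = lookup∘tabulate (λ t → to (vector i t))
      point-injective : ∀ {i j} → point i ≡ point j → i ≡ j
      point-injective {i} {j} eq = inject≤-injective enough enough i j (distinct-lookup distinct _ _ λ t →
        to-injective (trans (sym (lookup-point i t)) (trans (cong (λ v → Vec.lookup v t) eq) (lookup-point j t))))
      found = find point point-injective
      x : Fin k → Fin n → F.Carrier
      x j = vector (proj₁ found j)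
      x∈S : ∀ j → _∈S_ F (x j) S
      x∈S j = Any.map (λ eq t → F.reflexive (cong (λ v → v t) eq)) (∈-lookup (inject≤ (proj₁ found j) enough))
      x-distinct : ∀ j j′ → j ≢ j′ → ¬ (_≋_ F (x j) (x j′))
      x-distinct j j′ j≢j′ eq = j≢j′ (proj₁ (proj₂ found)
        (inject≤-injective enough enough _ _ (distinct-lookup distinct _ _ eq)))
      x-solves : IsSolution F A x
      x-solves i t = to-injective (trans (to-∑-* k (A i) (λ j → x j t)) (trans
        (K.sum-cong-≗ {k} (λ j → cong (A′ i j K.*_) (sym (lookup-point (proj₁ found j) t))))
        (proj₂ (proj₂ found) i t)))

theoremA : (F : FiniteField) {m k : ℕ} (A : Matrix F m k) →
    TypeRC F A → NonDegenerate F A → Irreducible F A →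
    ((∀ C → IsColClass F A C → ∣ C ∣ ≡ 2 → ¬ SumsToZero F A C)
    ⊎ ((∀ C → IsColClass F A C → SumsToZero F A C) × k ≥ 3)) →
    Moderate F A
theoremA F {m} {k} A rc nondegenerate irreducible = λ where
    (inj₁ no-pair) → forced⇒moderate (no-cancelling-pair⇒forced
      (balanced (proj₁ rc)) (one-singleton rc) (no-cancelling-pair no-pair))
    (inj₂ (all-zero , k≥3)) → forced⇒moderate (cancelling-classes-forced
      (class-sums all-zero) (inseparable irreducible) (k ℕ.∸ 3) (sym (ℕ.m+[n∸m]≡n k≥3)))
  where
  open Transfer F using (K)
  open FieldToScalars F A nondegenerate
  open NoCancellingPair K A′ column≢0
  open CancellingClasses K A′ column≢0
  open import Data.Product using (proj₁)
  open import Data.Sum using (inj₁; inj₂)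
  open import Relation.Binary.PropositionalEquality using (sym)
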